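{- Let $\lambda\ge 1$ be a real number. $\lambda$-Loose Interval-Constrained Scheduling is solvable in $\ell^{O(\lambda m)}\cdot n+O(n\log n)$ time, where $n$ is the number of jobs, $m$ is the number of machines, and $\ell:=\max_{j\in J}|d_j-t_j|$.
   Context: Convention: $0\in\mathbb N$. Interval-Constrained Scheduling is the following decision problem. Input: a set $J=\{1,\dots,n\}$ of jobs, a number $m\in\mathbb N$ of machines, and for each job $j$ a release time $t_j\in\mathbb N$, a deadline $d_j\in\mathbb N$, and a processing time $p_j\in\mathbb N$. Question: is there a (feasible) schedule that schedules all jobs onto $m$ parallel identical machines such that (1) each job $j$ is executed non-preemptively for $p_j$ time units, (2) each machine executes at most one job at a time, and (3) each job $j$ starts no earlier than $t_j$ and is finished by $d_j$? An instance has looseness $\lambda$ if $|d_j-t_j|\le\lambda p_j$ for all jobs $j\in J$. $\lambda$-Loose Interval-Constrained Scheduling is Interval-Constrained Scheduling restricted to instances of looseness $\lambda$. -}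

module Defs where

open import Data.Bool.Base using (if_then_else_; _∧_)
open import Data.Fin.Base using (Fin; zero; suc)
import Data.Integer.Base as ℤ
open import Data.Nat.Base using (ℕ; zero; suc; _+_; _∸_; _*_; _⊔_; _≤_; _<_; _≡ᵇ_; ∣_-_∣)
open import Data.Product.Base using (Σ; ∃-syntax; _×_)
import Data.Rational.Base as ℚ
open ℚ using (ℚ)
open import Data.Sum.Base using (_⊎_)
open import Data.Vec.Functional using (Vector; foldr)
open import Function.Bundles using (_⇔_)
open import Level using (0ℓ)
open import Relation.Binary.PropositionalEquality.Core using (_≡_; _≢_)
open import Relation.Nullary.Negation.Core using (¬_)
open import Relation.Unary using (Pred; Satisfiable)

------------------------------------------------------------------------
-- Real numbers, as two-sided Dedekind cuts

record ℝ : Set₁ where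
  field
    -- L q means q < x, and U q means x < q.
    L U         : Pred ℚ 0ℓ
    L-inhabited : Satisfiable L
    U-inhabited : Satisfiable U
    L-rounded   : ∀ q → L q ⇔ (∃[ r ] (q ℚ.< r × L r))
    U-rounded   : ∀ q → U q ⇔ (∃[ r ] (r ℚ.< q × U r))
    disjoint    : ∀ q → ¬ (L q × U q)
    located     : ∀ {q r} → q ℚ.< r → L q ⊎ U r

ℕ→ℚ : ℕ → ℚ
ℕ→ℚ n = (ℤ.+ n) ℚ./ 1

-- a ≤ x · b.  Since b ≥ 0, the product x · b is the infimum of the numbers
-- q · b over the rationals q > x.
_≤_·_ : ℕ → ℝ → ℕ → Set
a ≤ x · b = ∀ q → ℝ.U x q → ℕ→ℚ a ℚ.≤ q ℚ.* ℕ→ℚ b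

infix 4 _≤_·_

------------------------------------------------------------------------
-- Interval-Constrained Scheduling

record Instance : Set where
  field
    n        : ℕ
    m        : ℕ
    release  : Vector ℕ n
    deadline : Vector ℕ n
    ptime    : Vector ℕ n

  ℓ : ℕ
  ℓ = foldr _⊔_ 0 (λ j → ∣ deadline j - release j ∣)

record Schedule (I : Instance) : Set where
  open Instance I
  field
    start   : Fin n → ℕ
    machine : Fin n → Fin m

  -- Job j occupies its machine during the unit time slot [τ , τ + 1).
  ExecutedAt : Fin n → ℕ → Set
  ExecutedAt j τ = start j ≤ τ × τ < start j + ptime j

record IsFeasible (I : Instance) (S : Schedule I) : Set where
  open Instance I
  open Schedule S
  field
    oneJobPerMachine : ∀ i j τ → machine i ≡ machine j →
                       ExecutedAt i τ → ExecutedAt j τ → i ≡ j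
    afterRelease     : ∀ j → release j ≤ start j
    beforeDeadline   : ∀ j → start j + ptime j ≤ deadline j

Schedulable : Instance → Set
Schedulable I = Σ (Schedule I) (IsFeasible I)

HasLooseness : ℝ → Instance → Set
HasLooseness lam I = ∀ j → ∣ deadline j - release j ∣ ≤ lam · ptime j
  where open Instance I

------------------------------------------------------------------------
-- Random access machine
--
-- Structured programs for a unit-cost RAM with addition and truncated
-- subtraction.  The memory is divided into arrays of natural numbers, named
-- by numerals occurring in the program.  A program mentions only finitely
-- many arrays, so interleaving them in a single memory costs a constant
-- factor; a register is an array used only at index 0.

data Expr : Set where
  lit     : ℕ → Expr
  _[_]    : (a : ℕ) → Expr → Expr
  _⊕_ _⊖_ : Expr → Expr → Expr

data Program : Set where
  skip          : Program
  _[_]≔_        : (a : ℕ) → Expr → Expr → Program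
  _⨾_           : Program → Program → Program
  IF_THEN_ELSE_ : Expr → Program → Program → Program
  WHILE_DO_     : Expr → Program → Program

infix  9 _[_]
infixl 6 _⊕_ _⊖_
infix  5 _[_]≔_
infixr 4 _⨾_
infix  5 WHILE_DO_ IF_THEN_ELSE_

State : Set
State = ℕ → ℕ → ℕ

_[_,_↦_] : State → ℕ → ℕ → ℕ → State
(s [ a , i ↦ v ]) b k = if (a ≡ᵇ b) ∧ (i ≡ᵇ k) then v else s b k

⟦_⟧ : Expr → State → ℕ
⟦ lit k ⟧   s = k
⟦ a [ e ] ⟧ s = s a (⟦ e ⟧ s)
⟦ e ⊕ e′ ⟧  s = ⟦ e ⟧ s + ⟦ e′ ⟧ s
⟦ e ⊖ e′ ⟧  s = ⟦ e ⟧ s ∸ ⟦ e′ ⟧ s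

cost : Expr → ℕ
cost (lit k)   = 1
cost (a [ e ]) = 1 + cost e
cost (e ⊕ e′)  = 1 + (cost e + cost e′)
cost (e ⊖ e′)  = 1 + (cost e + cost e′)

-- ⟨ P , s ⟩⇓⟨ s′ , k ⟩: started in s, P halts in s′ after k time units.
-- Nonzero numbers count as true.
data ⟨_,_⟩⇓⟨_,_⟩ : Program → State → State → ℕ → Set where

  ⇓-skip : ∀ {s} → ⟨ skip , s ⟩⇓⟨ s , 1 ⟩

  ⇓-assign : ∀ {s a e e′} →
    ⟨ a [ e ]≔ e′ , s ⟩⇓⟨ s [ a , ⟦ e ⟧ s ↦ ⟦ e′ ⟧ s ] , 1 + (cost e + cost e′) ⟩

  ⇓-seq : ∀ {P Q s s′ s″ k l} →
    ⟨ P , s ⟩⇓⟨ s′ , k ⟩ → ⟨ Q , s′ ⟩⇓⟨ s″ , l ⟩ →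
    ⟨ P ⨾ Q , s ⟩⇓⟨ s″ , k + l ⟩

  ⇓-then : ∀ {e P Q s s′ k} → ⟦ e ⟧ s ≢ 0 → ⟨ P , s ⟩⇓⟨ s′ , k ⟩ →
    ⟨ IF e THEN P ELSE Q , s ⟩⇓⟨ s′ , 1 + (cost e + k) ⟩

  ⇓-else : ∀ {e P Q s s′ k} → ⟦ e ⟧ s ≡ 0 → ⟨ Q , s ⟩⇓⟨ s′ , k ⟩ →
    ⟨ IF e THEN P ELSE Q , s ⟩⇓⟨ s′ , 1 + (cost e + k) ⟩

  ⇓-exit : ∀ {e P s} → ⟦ e ⟧ s ≡ 0 →
    ⟨ WHILE e DO P , s ⟩⇓⟨ s , 1 + cost e ⟩

  ⇓-loop : ∀ {e P s s′ s″ k l} → ⟦ e ⟧ s ≢ 0 →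
    ⟨ P , s ⟩⇓⟨ s′ , k ⟩ → ⟨ WHILE e DO P , s′ ⟩⇓⟨ s″ , l ⟩ →
    ⟨ WHILE e DO P , s ⟩⇓⟨ s″ , 1 + (cost e + (k + l)) ⟩

------------------------------------------------------------------------
-- Deciding schedulability on the machine

padded : ∀ {n} → Vector ℕ n → ℕ → ℕ
padded {zero}  v i       = 0
padded {suc n} v zero    = v zero
padded {suc n} v (suc i) = padded (λ j → v (suc j)) i

-- Arrays 0 and 1 hold n and m at index 0; arrays 2, 3 and 4 hold the job
-- data; all remaining cells are 0.
input : Instance → State
input I 0 0 = Instance.n I
input I 1 0 = Instance.m I
input I 2 i = padded (Instance.release I) i
input I 3 i = padded (Instance.deadline I) i
input I 4 i = padded (Instance.ptime I) i
input I _ _ = 0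

-- The answer is left in array 0 at index 0.
DecidesWithin : Program → Instance → ℕ → Set
DecidesWithin P I T =
  ∃[ s ] ∃[ k ] (⟨ P , input I ⟩⇓⟨ s , k ⟩ × k ≤ T ×
    ((Schedulable I × s 0 0 ≡ 1) ⊎ (¬ Schedulable I × s 0 0 ≡ 0)))

------------------------------------------------------------------------
-- Asymptotics

_∈O[_] : (ℕ → ℕ) → (ℕ → ℕ) → Set
g ∈O[ h ] = ∃[ C ] ∃[ N ] (∀ n → N ≤ n → g n ≤ C * h n)

infix 4 _∈O[_]

-- Windows have length at most ℓ, so there are at most nℓ relevant time slots.
-- Since the memory is sparse and initially zero, they are put in order without
-- sorting: every run of consecutive slots is walked once, from its first slot,
-- and its slots receive consecutive numbers, a virtual time.
--
-- In a feasible instance few jobs have a window containing a given slot x: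
-- those with processing time in [2^e, 2^(e+1)) run within distance O(λ 2^e)
-- of x, so there are O(λm) of them, and O(λm log ℓ) in total.  If some slot
-- has more, the answer is no.  Otherwise a dynamic program sweeps through the
-- virtual time.  A state consists of one bit for each job of the current slot
-- (has it started?) and the remaining time of each machine, which gives
-- 2^O(λm log ℓ) (ℓ + 1)^m = ℓ^O(λm) states.  For ℓ ≤ 1 an instance is feasible
-- as soon as no slot has more than m jobs, which takes linear time to check.
module Submission where

-- The two regimes have very different budgets. For `ℓ ≤ 1` the factor `ℓ ^ f m` is at most 1, so
-- not even a loop over the m machines may be afforded; hence no states are built there. For `ℓ ≥ 2`
-- any fixed power of the number N of states is affordable: N is at most `ℓ ^ (10 * (m * L))`, and
-- all constants and all loop bounds other than n and the number of rows (at most nℓ) are below N,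
-- so that time n · N^35 still has the required form. The estimates are therefore crude, and a pass
-- may visit all N codes, reachable or not. What has to be watched is that n enters only linearly;
-- this is why an instance is refused as soon as one slot has too many active jobs, for then the
-- number of digits of a state does not depend on n. The real number λ enters only through a natural
-- number L with λ < L ≤ 3λ, which becomes the literal `4 * L` of the program. Rounding costs a mere
-- factor because 1 ≤ λ.

open import Defs
open import Data.Bool.Base using (Bool; true; false; if_then_else_; _∨_; T)
open import Data.Empty using (⊥; ⊥-elim)
open import Data.Fin.Base using (Fin; zero; suc; toℕ; fromℕ<; combine; remQuot)
open import Data.Fin.Properties using (toℕ<n; toℕ-fromℕ<; toℕ-injective; combine-injective; combine-remQuot; injective⇒≤)
import Data.Integer.Base as ℤ
import Data.Integer.Properties as ℤₚ
open import Data.List.Base using ([]; _∷_)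
open import Data.Nat.Base
open import Data.Nat.Logarithm using (⌊log₂_⌋; ⌊log₂⌋-mono-≤)
open import Data.Nat.Properties
open import Data.Nat.Tactic.RingSolver using (solve)
open import Data.Product.Base using (Σ-syntax; ∃; ∃-syntax; _×_; _,_; proj₁; proj₂)
import Data.Rational.Base as ℚ
import Data.Rational.Properties as ℚₚ
import Data.Rational.Unnormalised.Base as ℚᵘ
import Data.Rational.Unnormalised.Properties as ℚᵘₚ
open import Data.Sum.Base using (_⊎_; inj₁; inj₂)
open import Data.Vec.Functional using (Vector; foldr)
open import Function.Base using (_∘_; case_of_)
open import Function.Bundles using (Equivalence)
open import Function.Definitions using (Injective)
open import Relation.Binary.Definitions using (tri<; tri≈; tri>)
open import Relation.Binary.PropositionalEquality hiding ([_])
open import Relation.Nullary.Decidable using (Dec; yes; no; _×-dec_)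
open import Relation.Nullary.Negation.Core using (¬_; contradiction)

-- A program logic with running times

-- A linear inequality follows from a sum A ≤ B of hypotheses, with slack e.
lin : ∀ {a b A B} e → A ≤ B → a + B + e ≡ b + A → a ≤ b
lin {a} {b} {A} {B} e h eq =
  +-cancelʳ-≤ A a b (≤-trans (+-monoʳ-≤ a h) (≤-trans (m≤m+n (a + B) e) (≤-reflexive eq)))

_≤!_ : ∀ a b → {T (a ≤ᵇ b)} → a ≤ b
(a ≤! b) {p} = ≤ᵇ⇒≤ a b p

var : ℕ → Expr
var a = a [ lit 0 ]

infix 5.5 _≔_
_≔_ : ℕ → Expr → Program
a ≔ e = a [ lit 0 ]≔ e

FOR : ℕ → Expr → Program → Program
FOR i e P = i ≔ lit 0 ⨾ WHILE e ⊖ var i DO (P ⨾ i ≔ var i ⊕ lit 1)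

writes : Program → ℕ → Bool
writes skip                    b = false
writes (a [ e ]≔ e′)           b = a ≡ᵇ b
writes (P ⨾ Q)                 b = writes P b ∨ writes Q b
writes (IF e THEN P ELSE Q)    b = writes P b ∨ writes Q b
writes (WHILE e DO P)          b = writes P b

-- Arrays are named by numerals, so for a concrete program `writes P b` computes and the side
-- condition is `refl`. Facts about arrays that a program does not assign thus pass through it
-- without entering any invariant.
Same : Program → State → State → Set
Same P s s′ = ∀ b → writes P b ≡ false → ∀ k → s′ b k ≡ s b k

same-trans : ∀ {P Q s s′ s″} → Same P s s′ → Same Q s′ s″ →
             ∀ b → writes P b ≡ false → writes Q b ≡ false → ∀ k → s″ b k ≡ s b k
same-trans f g b e e′ k = trans (g b e′ k) (f b e k)

∨-falseˡ : ∀ x {y} → x ∨ y ≡ false → x ≡ false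
∨-falseˡ false _ = refl

∨-falseʳ : ∀ x {y} → x ∨ y ≡ false → y ≡ false
∨-falseʳ false e = e

frame : ∀ {P s s′ k} → ⟨ P , s ⟩⇓⟨ s′ , k ⟩ → Same P s s′
frame ⇓-skip b w k = refl
frame (⇓-assign {a = a}) b w k rewrite w = refl
frame (⇓-seq {P = P} d d′) b w k =
  trans (frame d′ b (∨-falseʳ (writes P b) w) k) (frame d b (∨-falseˡ (writes P b) w) k)
frame (⇓-then {P = P} _ d) b w k = frame d b (∨-falseˡ (writes P b) w) k
frame (⇓-else {P = P} _ d) b w k = frame d b (∨-falseʳ (writes P b) w) k
frame (⇓-exit _) b w k = refl
frame (⇓-loop _ d d′) b w k = trans (frame d′ b w k) (frame d b w k)

record Runs (P : Program) (s : State) (t : ℕ) (Q : State → Set) : Set where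
  constructor runs
  field
    {final} : State
    {steps} : ℕ
    exec    : ⟨ P , s ⟩⇓⟨ final , steps ⟩
    within  : steps ≤ t
    post    : Q final

weaken : ∀ {P s t t′ Q} → t ≤ t′ → Runs P s t Q → Runs P s t′ Q
weaken le (runs d b q) = runs d (≤-trans b le) q

conseq : ∀ {P s t} {Q Q′ : State → Set} → Runs P s t Q →
         (∀ s′ → Same P s s′ → Q s′ → Q′ s′) → Runs P s t Q′
conseq (runs d b q) f = runs d b (f _ (frame d) q)

skip-runs : ∀ {s} {Q : State → Set} → Q s → Runs skip s 1 Q
skip-runs q = runs ⇓-skip ≤-refl q

assign : ∀ {s a e e′} {Q : State → Set} → Q (s [ a , ⟦ e ⟧ s ↦ ⟦ e′ ⟧ s ]) →
         Runs (a [ e ]≔ e′) s (1 + (cost e + cost e′)) Q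
assign q = runs ⇓-assign ≤-refl q

infixr 4 _▹_
_▹_ : ∀ {P P′ s t t′} {Q R : State → Set} → Runs P s t Q →
      (∀ s′ → Same P s s′ → Q s′ → Runs P′ s′ t′ R) → Runs (P ⨾ P′) s (t + t′) R
runs d b q ▹ f with f _ (frame d) q
... | runs d′ b′ r = runs (⇓-seq d d′) (+-mono-≤ b b′) r

assign-seq : ∀ {P s a e e′ t} {R : State → Set} →
       Runs P (s [ a , ⟦ e ⟧ s ↦ ⟦ e′ ⟧ s ]) t R →
       Runs ((a [ e ]≔ e′) ⨾ P) s (1 + (cost e + cost e′) + t) R
assign-seq (runs d b r) = runs (⇓-seq ⇓-assign d) (+-monoʳ-≤ _ b) r

if-runs : ∀ {P P′ s e t} {Q : State → Set} →
     (⟦ e ⟧ s ≢ 0 → Runs P s t Q) → (⟦ e ⟧ s ≡ 0 → Runs P′ s t Q) →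
     Runs (IF e THEN P ELSE P′) s (1 + (cost e + t)) Q
if-runs {s = s} {e} f g with ⟦ e ⟧ s ≟ 0
... | yes z with g z
...   | runs d b q = runs (⇓-else z d) (s≤s (+-monoʳ-≤ (cost e) b)) q
if-runs {s = s} {e} f g | no nz with f nz
...   | runs d b q = runs (⇓-then nz d) (s≤s (+-monoʳ-≤ (cost e) b)) q

-- The rule for `FOR`. `Inv (suc j)` is demanded of the state whose counter has already advanced,
-- and the body may use that unwritten arrays are as in `s₀`; the bound `e` is evaluated anew in
-- each round and relies on the same fact. With `cost e ≤ 9` a round spends at most 13 on the test
-- and 6 on the increment, rounded up to 20.
module _ (i : ℕ) (e : Expr) (P : Program) (N t : ℕ) (Inv : ℕ → State → Set) (s₀ : State)
         (wi : writes P i ≡ false) (ce : cost e ≤ 9)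
         (he : ∀ s → Same (FOR i e P) s₀ s → ⟦ e ⟧ s ≡ N)
         (body : ∀ j s → j < N → s i 0 ≡ j → Same (FOR i e P) s₀ s → Inv j s →
                 Runs P s t (λ s′ → Inv (suc j) (s′ [ i , 0 ↦ suc j ]))) where
  private
    W : Program
    W = WHILE e ⊖ var i DO (P ⨾ i ≔ var i ⊕ lit 1)

    exit-cost : ∀ c → c ≤ 9 → 1 + (1 + (c + 2)) ≤ 13
    exit-cost c h = lin 0 h (solve (c ∷ []))

    loop-cost : ∀ c k₁ k₂ r → c ≤ 9 → k₁ ≤ t → k₂ ≤ 13 + r * (20 + t) →
                1 + (1 + (c + 2) + (k₁ + 6 + k₂)) ≤ 13 + suc r * (20 + t)
    loop-cost c k₁ k₂ r h b b′ = lin 1 (+-mono-≤ h (+-mono-≤ b b′)) (solve (c ∷ k₁ ∷ k₂ ∷ r ∷ t ∷ []))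

    start-cost : ∀ k → k ≤ 13 + N * (20 + t) → 3 + k ≤ 20 + N * (20 + t)
    start-cost k b = lin 4 b (solve (k ∷ N ∷ t ∷ []))

    self : ∀ s v → (s [ i , 0 ↦ v ]) i 0 ≡ v
    self s v with i ≡ᵇ i in eq
    ... | true  = refl
    ... | false = ⊥-elim (subst T eq (≡⇒≡ᵇ i i refl))

    sameW : ∀ {s s′} → Same (FOR i e P) s₀ s → Same W s s′ → Same (FOR i e P) s₀ s′
    sameW f g b w k = trans (g b (∨-falseʳ (i ≡ᵇ b) w) k) (f b w k)

    loop : ∀ r j s → j + r ≡ N → s i 0 ≡ j → Same (FOR i e P) s₀ s → Inv j s →
           Runs W s (13 + r * (20 + t)) (λ s′ → s′ i 0 ≡ N × Inv N s′)
    loop zero j s eq si f inv =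
      runs (⇓-exit (trans (cong₂ _∸_ (he s f) si) (trans (cong (N ∸_) jN) (n∸n≡0 N))))
           (exit-cost (cost e) ce)
           (trans si jN , subst (λ z → Inv z s) jN inv)
      where jN = trans (sym (+-identityʳ j)) eq
    loop (suc r) j s eq si f inv
      with runs {final = s₁} {steps = k₁} d b q ← body j s (≤-trans (m≤m+n (suc j) r) (≤-reflexive (trans (sym (+-suc j r)) eq))) si f inv
      = go (subst (λ z → Inv (suc j) (s₁ [ i , 0 ↦ z ])) (sym (trans (cong (_+ 1) s₁i) (+-comm j 1))) q)
      where
      s₁i : s₁ i 0 ≡ j
      s₁i = trans (frame d i wi 0) si
      s₂ = s₁ [ i , 0 ↦ s₁ i 0 + 1 ]
      step : ⟨ P ⨾ i ≔ var i ⊕ lit 1 , s ⟩⇓⟨ s₂ , k₁ + 6 ⟩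
      step = ⇓-seq d ⇓-assign
      nz : ⟦ e ⟧ s ∸ s i 0 ≢ 0
      nz z = <⇒≱ (≤-trans (m≤m+n (suc j) r) (≤-reflexive (trans (sym (+-suc j r)) eq)))
                 (m∸n≡0⇒m≤n (trans (sym (cong₂ _∸_ (he s f) si)) z))
      go : Inv (suc j) s₂ → Runs W s (13 + suc r * (20 + t)) (λ s′ → s′ i 0 ≡ N × Inv N s′)
      go inv′ with loop r (suc j) s₂ (trans (sym (+-suc j r)) eq)
                     (trans (self s₁ _) (trans (cong (_+ 1) s₁i) (+-comm j 1)))
                     (sameW f (frame step)) inv′
      ... | runs {steps = k₂} d′ b′ q′ = runs (⇓-loop nz step d′)
              (loop-cost (cost e) k₁ k₂ r ce b b′) q′

    same₀ : Same (FOR i e P) s₀ (s₀ [ i , 0 ↦ 0 ])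
    same₀ b w k rewrite ∨-falseˡ (i ≡ᵇ b) w = refl

  for : Inv 0 (s₀ [ i , 0 ↦ 0 ]) → Runs (FOR i e P) s₀ (20 + N * (20 + t)) (λ s → s i 0 ≡ N × Inv N s)
  for inv with loop N 0 (s₀ [ i , 0 ↦ 0 ]) refl (self s₀ 0) same₀ inv
  ... | runs d b q = runs (⇓-seq ⇓-assign d) (start-cost _ b) q

-- The program

nₐ mₐ relₐ dlₐ ptₐ ℓₐ badₐ jₐ oₐ Aₐ stepₐ powₐ iₐ markₐ fullₐ fuelₐ nextₐ xₐ baseₐ rowsₐ posₐ cntₐ fitₐ nxtₐ wtₐ wₐ accₐ Nₐ curₐ reachₐ Dₐ Eₐ zₐ yₐ uₐ vₐ eₐ cₐ kₐ hₐ rowₐ okₐ Kₐ idxₐ : ℕ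
nₐ     = 0
mₐ     = 1
relₐ   = 2
dlₐ    = 3
ptₐ    = 4
ℓₐ     = 5
badₐ   = 6
jₐ     = 7
oₐ     = 8
Aₐ     = 9
stepₐ  = 10
powₐ   = 11
iₐ     = 12
markₐ  = 13
fullₐ  = 14
fuelₐ  = 15
nextₐ  = 16
xₐ     = 17
baseₐ  = 18
rowsₐ  = 19
posₐ   = 20
cntₐ   = 21
fitₐ   = 22
nxtₐ   = 23
wtₐ    = 24
wₐ     = 25
accₐ   = 26
Nₐ     = 27
curₐ   = 28
reachₐ = 29
Dₐ     = 30
Eₐ     = 31
zₐ     = 32
yₐ     = 33
uₐ     = 34
vₐ     = 35
eₐ     = 36
cₐ     = 37
kₐ     = 38
hₐ     = 39
rowₐ   = 40
okₐ    = 41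
Kₐ     = 42
idxₐ   = 43

widthᵉ windowᵉ : Expr
widthᵉ  = (dlₐ [ var jₐ ] ⊖ relₐ [ var jₐ ]) ⊕ (relₐ [ var jₐ ] ⊖ dlₐ [ var jₐ ])
windowᵉ = dlₐ [ var jₐ ] ⊖ relₐ [ var jₐ ]

scan : Program
scan =
  FOR jₐ (var nₐ) (
    IF widthᵉ ⊖ var ℓₐ THEN ℓₐ ≔ widthᵉ ELSE skip ⨾
    IF (relₐ [ var jₐ ] ⊕ ptₐ [ var jₐ ]) ⊖ dlₐ [ var jₐ ] THEN badₐ ≔ lit 1 ELSE skip)

-- The machine cannot multiply: `stepₐ` becomes m · b by additions, and `Aₐ` grows by it once per
-- doubling of `powₐ`. With b = 4L the result is the bound of `active-rank` on the jobs active in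
-- one slot.
capacity : ℕ → Program
capacity b =
  FOR iₐ (var mₐ) (stepₐ ≔ var stepₐ ⊕ lit b) ⨾
  powₐ ≔ lit 1 ⨾
  FOR iₐ (var ℓₐ ⊕ lit 1) (
    IF (var ℓₐ ⊕ lit 1) ⊖ var powₐ
    THEN (powₐ ≔ var powₐ ⊕ var powₐ ⨾ Aₐ ≔ var Aₐ ⊕ var stepₐ)
    ELSE skip)

-- Times are shifted by one: cell x + 1 of markₐ, posₐ and cntₐ belongs to
-- the time slot x, so that cell 0 of markₐ stays unmarked.
markStep mark : Program
markStep =
  idxₐ ≔ (relₐ [ var jₐ ] ⊕ var oₐ) ⊕ lit 1 ⨾
  markₐ [ var idxₐ ]≔ markₐ [ var idxₐ ] ⊕ lit 1 ⨾
  IF markₐ [ var idxₐ ] ⊖ var Aₐ THEN fullₐ ≔ lit 1 ELSE skip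
mark = FOR jₐ (var nₐ) (FOR oₐ windowᵉ markStep)

-- posₐ is 0 or at least Aₐ, which bounds markₐ: the first test asks for a
-- marked slot that has no number yet.
walkStep walk : Program
walkStep =
  IF markₐ [ var xₐ ] ⊖ posₐ [ var xₐ ]
  THEN (posₐ [ var xₐ ]≔ var baseₐ ⨾
        baseₐ ≔ var baseₐ ⊕ var Aₐ ⨾
        rowsₐ ≔ var rowsₐ ⊕ lit 1 ⨾
        xₐ ≔ var xₐ ⊕ lit 1)
  ELSE (IF var nₐ ⊖ var nextₐ
        -- By the shift, this cell belongs to the slot before the release. If it is marked, the
        -- release does not open a run, and the cursor goes to cell 0, where nothing is ever marked.
        THEN (IF markₐ [ relₐ [ var nextₐ ] ]
              THEN xₐ ≔ lit 0
              ELSE xₐ ≔ relₐ [ var nextₐ ] ⊕ lit 1 ⨾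
              nextₐ ≔ var nextₐ ⊕ lit 1)
        ELSE skip)
walk =
  fuelₐ ≔ var nₐ ⊕ lit 1 ⨾
  FOR jₐ (var nₐ) (fuelₐ ≔ var fuelₐ ⊕ var ℓₐ) ⨾
  -- Row h starts at address (h + 1) · A, so that 0 can mean "no number yet".
  baseₐ ≔ var Aₐ ⨾
  FOR iₐ (var fuelₐ) walkStep

-- An entry of nxtₐ is 0 at a vacant position, 1 for a job that leaves after
-- this slot, and 2 + c for a job with position c in the next row.
rowStep rows : Program
rowStep =
  xₐ ≔ (relₐ [ var jₐ ] ⊕ var oₐ) ⊕ lit 1 ⨾
  idxₐ ≔ posₐ [ var xₐ ] ⊕ cntₐ [ var xₐ ] ⨾
  fitₐ [ var idxₐ ]≔ ptₐ [ var jₐ ] ⨾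
  -- The value 0 bars a start: what is left of the window is too short. It cannot be confused with a
  -- processing time, since looseness makes these positive for nonempty windows.
  IF ptₐ [ var jₐ ] ⊖ (windowᵉ ⊖ var oₐ) THEN fitₐ [ var idxₐ ]≔ lit 0 ELSE skip ⨾
  nxtₐ [ var idxₐ ]≔ lit 1 ⨾
  IF windowᵉ ⊖ (var oₐ ⊕ lit 1)
  -- The job has not yet been counted in cell x + 1, so the counter there is the position that it
  -- receives in the next round.
  THEN nxtₐ [ var idxₐ ]≔ lit 2 ⊕ cntₐ [ var xₐ ⊕ lit 1 ]
  ELSE skip ⨾
  cntₐ [ var xₐ ]≔ cntₐ [ var xₐ ] ⊕ lit 1
rows = FOR jₐ (var nₐ) (FOR oₐ windowᵉ rowStep)

weights : Program
weights =
  Kₐ ≔ var Aₐ ⊕ var mₐ ⨾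
  wₐ ≔ lit 1 ⨾
  FOR iₐ (var Kₐ) (
    wtₐ [ var iₐ ]≔ var wₐ ⨾
    IF var Aₐ ⊖ var iₐ
    THEN wₐ ≔ var wₐ ⊕ var wₐ
    ELSE (accₐ ≔ var wₐ ⨾ FOR oₐ (var ℓₐ) (accₐ ≔ var accₐ ⊕ var wₐ) ⨾ wₐ ≔ var accₐ)) ⨾
  Nₐ ≔ var wₐ

decode : Program
decode =
  yₐ ≔ var zₐ ⨾
  FOR uₐ (var Kₐ) (
    idxₐ ≔ var Kₐ ⊖ (var uₐ ⊕ lit 1) ⨾
    Dₐ [ var idxₐ ]≔ lit 0 ⨾
    FOR vₐ (var ℓₐ) (
      IF (var yₐ ⊕ lit 1) ⊖ wtₐ [ var idxₐ ]
      THEN (yₐ ≔ var yₐ ⊖ wtₐ [ var idxₐ ] ⨾ Dₐ [ var idxₐ ]≔ Dₐ [ var idxₐ ] ⊕ lit 1)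
      ELSE skip))

-- Each level owns a block of N cells of `reachₐ`. Marks go into the block after the current one, so
-- no block is ever cleared.
encode emit : Program
encode =
  eₐ ≔ lit 0 ⨾
  FOR uₐ (var Kₐ) (FOR vₐ (Dₐ [ var uₐ ]) (eₐ ≔ var eₐ ⊕ wtₐ [ var uₐ ]))
emit = encode ⨾ reachₐ [ (var curₐ ⊕ var Nₐ) ⊕ var eₐ ]≔ lit 1

-- `startBody` serves a single machine; since processing times are positive, one start per machine
-- and slot is enough. `boundaryBody` saves the bits in `Eₐ` because positions change from row to
-- row, and a bit moved in place could overwrite one that has not been read.
startBody boundaryBody : Program
startBody =
  emit ⨾
  IF Dₐ [ var Aₐ ⊕ var kₐ ] THEN skip ELSE
  FOR cₐ (var Aₐ) (
    IF fitₐ [ var rowₐ ⊕ var cₐ ]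
    THEN (IF Dₐ [ var cₐ ] THEN skip
          ELSE (Dₐ [ var cₐ ]≔ lit 1 ⨾
                Dₐ [ var Aₐ ⊕ var kₐ ]≔ fitₐ [ var rowₐ ⊕ var cₐ ] ⨾
                emit ⨾
                Dₐ [ var cₐ ]≔ lit 0 ⨾
                Dₐ [ var Aₐ ⊕ var kₐ ]≔ lit 0))
    ELSE skip)
boundaryBody =
  okₐ ≔ lit 1 ⨾
  FOR cₐ (var Aₐ) (Eₐ [ var cₐ ]≔ Dₐ [ var cₐ ] ⨾ Dₐ [ var cₐ ]≔ lit 0) ⨾
  FOR cₐ (var Aₐ) (
    IF nxtₐ [ var rowₐ ⊕ var cₐ ]
    THEN (IF nxtₐ [ var rowₐ ⊕ var cₐ ] ⊖ lit 1
          THEN Dₐ [ nxtₐ [ var rowₐ ⊕ var cₐ ] ⊖ lit 2 ]≔ Eₐ [ var cₐ ]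
          ELSE (IF Eₐ [ var cₐ ] THEN skip ELSE okₐ ≔ lit 0))
    ELSE skip) ⨾
  FOR vₐ (var mₐ) (Dₐ [ var Aₐ ⊕ var vₐ ]≔ Dₐ [ var Aₐ ⊕ var vₐ ] ⊖ lit 1) ⨾
  IF var okₐ THEN emit ELSE skip

level : Program → Program
level body =
  FOR zₐ (var Nₐ) (IF reachₐ [ var curₐ ⊕ var zₐ ] THEN (decode ⨾ body) ELSE skip) ⨾
  curₐ ≔ var curₐ ⊕ var Nₐ

sweep : Program
sweep =
  reachₐ [ lit 0 ]≔ lit 1 ⨾
  rowₐ ≔ var Aₐ ⨾
  FOR hₐ (var rowsₐ) (
    FOR kₐ (var mₐ) (level startBody) ⨾
    level boundaryBody ⨾
    rowₐ ≔ var rowₐ ⊕ var Aₐ)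

answer : ℕ → Program
answer a = nₐ ≔ lit a

dynamicProgram : Program
dynamicProgram =
  walk ⨾ rows ⨾ weights ⨾ sweep ⨾
  IF reachₐ [ var curₐ ] THEN answer 1 ELSE answer 0

schedule solver : ℕ → Program
schedule b =
  IF var ℓₐ ⊖ lit 1 THEN capacity b ELSE Aₐ ≔ var mₐ ⨾
  mark ⨾
  IF var fullₐ THEN answer 0 ELSE
  IF var ℓₐ ⊖ lit 1 THEN dynamicProgram ELSE answer 1
solver b =
  scan ⨾
  IF var badₐ THEN answer 0 ELSE
  IF var mₐ THEN schedule b ELSE
  -- Without machines every job, even one of processing time 0, lacks a machine to be assigned to.
  IF var nₐ THEN answer 0 ELSE answer 1

-- Mixed-radix states

-- Written with the same conditional as the update of a `State`, so that reading a literal array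
-- after an assignment to it reduces to this by computation.
_[_⇐_] : (ℕ → ℕ) → ℕ → ℕ → ℕ → ℕ
(f [ i ⇐ v ]) k = if i ≡ᵇ k then v else f k

upd-≡ : ∀ (f : ℕ → ℕ) i v {k} → i ≡ k → (f [ i ⇐ v ]) k ≡ v
upd-≡ f i v {k} e with i ≡ᵇ k in eq
... | true  = refl
... | false = ⊥-elim (subst T eq (≡⇒≡ᵇ i k e))

upd-≢ : ∀ (f : ℕ → ℕ) i v {k} → i ≢ k → (f [ i ⇐ v ]) k ≡ f k
upd-≢ f i v {k} ne with i ≡ᵇ k in eq
... | true  = ⊥-elim (ne (≡ᵇ⇒≡ i k (subst T (sym eq) _)))
... | false = refl

upd-elim : ∀ (f : ℕ → ℕ) i v k (P : ℕ → Set) → (i ≡ k → P v) → (i ≢ k → P (f k)) → P ((f [ i ⇐ v ]) k)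
upd-elim f i v k P y n with i ≟ k
... | yes e = subst P (sym (upd-≡ f i v e)) (y e)
... | no ne = subst P (sym (upd-≢ f i v ne)) (n ne)

-- Running times bounded by powers of one number

module Powers (N : ℕ) (64≤N : 64 ≤ N) where

  instance
    N≢0 : NonZero N
    N≢0 = >-nonZero (≤-trans (1 ≤! 64) 64≤N)

  infix 4 _≤^_
  _≤^_ : ℕ → ℕ → Set
  a ≤^ e = a ≤ N ^ e

  -- A deliberately crude calculus: a constant up to 64 is at most N, a sum costs one exponent more
  -- than its parts, a product adds exponents. Sharpness is irrelevant because the final exponent is
  -- absorbed by the constant of O(λm).
  const : ∀ a {p : T (a ≤ᵇ 64)} e → a ≤^ suc e
  const a {p} e = ≤-trans (≤-trans (≤ᵇ⇒≤ a 64 p) 64≤N) (≤-trans (≤-reflexive (sym (*-identityʳ N))) (^-monoʳ-≤ N {1} {suc e} (s≤s z≤n)))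

  raise : ∀ {a} e f {p : T (e ≤ᵇ f)} → a ≤^ e → a ≤^ f
  raise e f {p} h = ≤-trans h (^-monoʳ-≤ N (≤ᵇ⇒≤ e f p))

  times : ∀ {a b} e f → a ≤^ e → b ≤^ f → a * b ≤^ e + f
  times e f h k = ≤-trans (*-mono-≤ h k) (≤-reflexive (sym (^-distribˡ-+-* N e f)))

  one : ∀ {a} → a ≤ N → a ≤^ 1
  one h = ≤-trans h (≤-reflexive (sym (*-identityʳ N)))

  plus : ∀ {a b} e → a ≤^ e → b ≤^ e → a + b ≤^ suc e
  plus {a} {b} e h k = ≤-trans (+-mono-≤ h k) (≤-trans (≤-reflexive (cong (N ^ e +_) (sym (+-identityʳ (N ^ e))))) (*-monoˡ-≤ (N ^ e) (≤-trans (2 ≤! 64) 64≤N)))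

  loop : ∀ {I t} e → I ≤ N → t ≤^ suc e → 20 + I * (20 + t) ≤^ 4 + e
  loop e I≤ h = plus (3 + e) (const 20 (2 + e)) (times 1 (2 + e) (one I≤) (plus (1 + e) (const 20 e) h))

  -- Here n is kept apart from the power: the final bound must be linear in n, which may be far
  -- larger than N.
  module PerJob (n : ℕ) (1≤n : 1 ≤ n) where

    infix 4 _≤n^_
    _≤n^_ : ℕ → ℕ → Set
    a ≤n^ e = a ≤ n * N ^ e

    per-job : ∀ {a} e → a ≤^ e → n * a ≤n^ e
    per-job e h = *-monoʳ-≤ n h

    once : ∀ {a} e → a ≤^ e → a ≤n^ e
    once e h = ≤-trans h (≤-trans (≤-reflexive (sym (*-identityˡ (N ^ e)))) (*-monoˡ-≤ (N ^ e) 1≤n))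

    plusₙ : ∀ {a b} e → a ≤n^ e → b ≤n^ e → a + b ≤n^ suc e
    plusₙ {a} {b} e h k = ≤-trans (+-mono-≤ h k) (≤-trans (≤-reflexive (sym (*-distribˡ-+ n (N ^ e) (N ^ e)))) (*-monoʳ-≤ n (plus e ≤-refl ≤-refl)))

    timesₙ : ∀ {a b} e f → a ≤n^ e → b ≤^ f → a * b ≤n^ e + f
    timesₙ e f h k = ≤-trans (*-mono-≤ h k) (≤-reflexive (trans (*-assoc n (N ^ e) (N ^ f)) (cong (n *_) (sym (^-distribˡ-+-* N e f)))))

    raiseₙ : ∀ {a} e f {p : T (e ≤ᵇ f)} → a ≤n^ e → a ≤n^ f
    raiseₙ e f {p} h = ≤-trans h (*-monoʳ-≤ n (raise e f {p} ≤-refl))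

-- Encoding and decoding of states

module Radix (A m ℓ : ℕ) where

  K : ℕ
  K = A + m

  rad wt : ℕ → ℕ
  rad i = if i <ᵇ A then 2 else suc ℓ
  wt zero    = 1
  wt (suc i) = rad i * wt i

  enc : (ℕ → ℕ) → ℕ → ℕ
  enc D zero    = 0
  enc D (suc i) = enc D i + D i * wt i

  Bounded : (ℕ → ℕ) → Set
  Bounded D = ∀ i → i < K → D i < rad i

  enc-cong : ∀ {D D′} j → (∀ i → i < j → D i ≡ D′ i) → enc D j ≡ enc D′ j
  enc-cong zero    h = refl
  enc-cong (suc j) h = cong₂ (λ a b → a + b * wt j) (enc-cong j λ i lt → h i (m<n⇒m<1+n lt)) (h j ≤-refl)

  enc-< : ∀ D j → (∀ i → i < j → D i < rad i) → enc D j < wt j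
  enc-< D zero    h = s≤s z≤n
  enc-< D (suc j) h = begin-strict
    enc D j + D j * wt j <⟨ +-monoˡ-< (D j * wt j) (enc-< D j λ i lt → h i (m<n⇒m<1+n lt)) ⟩
    suc (D j) * wt j     ≤⟨ *-monoˡ-≤ (wt j) (h j ≤-refl) ⟩
    rad j * wt j         ∎
    where open ≤-Reasoning

  quotient-≤ : ∀ {w r r′} q q′ → r < w → r + q * w ≡ r′ + q′ * w → q′ ≤ q
  quotient-≤ {w} {r} {r′} q q′ r<w eq with q′ ≤? q
  ... | yes le = le
  ... | no  nl = contradiction (begin-strict
    r + q * w   <⟨ +-monoˡ-< (q * w) r<w ⟩
    suc q * w   ≤⟨ *-monoˡ-≤ w (≰⇒> nl) ⟩
    q′ * w      ≤⟨ m≤n+m (q′ * w) r′ ⟩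
    r′ + q′ * w ≡⟨ eq ⟨
    r + q * w   ∎) (<-irrefl refl)
    where open ≤-Reasoning

  enc-injective : ∀ {D D′} j → (∀ i → i < j → D i < rad i) → (∀ i → i < j → D′ i < rad i) →
                  enc D j ≡ enc D′ j → ∀ i → i < j → D i ≡ D′ i
  enc-injective {D} {D′} (suc j) b b′ eq = go
    where
    l  = enc-< D j λ i lt → b i (m<n⇒m<1+n lt)
    l′ = enc-< D′ j λ i lt → b′ i (m<n⇒m<1+n lt)
    top : D j ≡ D′ j
    top = ≤-antisym (quotient-≤ (D′ j) (D j) l′ (sym eq)) (quotient-≤ (D j) (D′ j) l eq)
    go : ∀ i → i < suc j → D i ≡ D′ i
    go i lt with m<1+n⇒m<n∨m≡n lt
    ... | inj₂ refl = top
    ... | inj₁ i<j  = enc-injective {D} {D′} j (λ i lt → b i (m<n⇒m<1+n lt)) (λ i lt → b′ i (m<n⇒m<1+n lt))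
      (+-cancelʳ-≡ (D j * wt j) _ _ (trans eq (cong (λ x → enc D′ j + x * wt j) (sym top)))) i i<j

  Digits : Set₁
  Digits = (ℕ → ℕ) → Set

  Image : Digits → ((ℕ → ℕ) → Digits) → Digits
  Image V R D′ = ∃[ D ] (Bounded D × V D × R D D′)

  rad-bit : ∀ {c} → c < A → rad c ≡ 2
  rad-bit {c} lt with c <ᵇ A in eq
  ... | true  = refl
  ... | false = ⊥-elim (subst T eq (<⇒<ᵇ lt))

  rad-machine : ∀ {i} → A ≤ i → rad i ≡ suc ℓ
  rad-machine {i} le with i <ᵇ A in eq
  ... | true  = contradiction (<ᵇ⇒< i A (subst T (sym eq) _)) (≤⇒≯ le)
  ... | false = refl

  rad>0 : ∀ i → 0 < rad i
  rad>0 i with i <ᵇ A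
  ... | true  = s≤s z≤n
  ... | false = s≤s z≤n

  -- What the estimates need: the constants and the loop bounds of encoding, decoding and
  -- transitions lie below the number `wt K` of states.
  record Room : Set where
    field
      1≤ℓ  : 1 ≤ ℓ
      64≤N : 64 ≤ wt K
      K≤N  : K ≤ wt K
      ℓ≤N  : ℓ ≤ wt K

  module Machine (room : Room) where

    open Room room

    N : ℕ
    N = wt K

    open Powers N 64≤N

    rad≤ : ∀ i → rad i ≤ suc ℓ
    rad≤ i with i <ᵇ A
    ... | true  = s≤s 1≤ℓ
    ... | false = ≤-refl

    Weights : State → Set
    Weights s = s Kₐ 0 ≡ K × (∀ i → i < K → s wtₐ i ≡ wt i)

    weights-keep : ∀ {s s′} → s′ Kₐ 0 ≡ s Kₐ 0 → (∀ i → s′ wtₐ i ≡ s wtₐ i) → Weights s → Weights s′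
    weights-keep e e′ (hK , hw) = trans e hK , λ i lt → trans (e′ i) (hw i lt)

    encode-runs : ∀ s → Weights s → Bounded (s Dₐ) → Runs encode s (N ^ 9) (λ s′ → s′ eₐ 0 ≡ enc (s Dₐ) K)
    encode-runs s (hK , hw) bd = weaken (plus 8 (const 3 7) (loop 4 K≤N (loop 1 ℓ≤N (const 8 1))))
      (assign-seq (conseq
        (for uₐ (var Kₐ) (FOR vₐ (Dₐ [ var uₐ ]) (eₐ ≔ var eₐ ⊕ wtₐ [ var uₐ ])) K _ (λ j s′ → s′ eₐ 0 ≡ enc (s Dₐ) j) _ refl (2 ≤! 9)
          (λ s′ f → trans (f Kₐ refl 0) hK) outer refl)
        λ s′ _ q → proj₂ q))
      where
      outer : ∀ j s′ → j < K → s′ uₐ 0 ≡ j → _ → s′ eₐ 0 ≡ enc (s Dₐ) j → Runs _ s′ (20 + ℓ * (20 + 8)) (λ s″ → s″ eₐ 0 ≡ enc (s Dₐ) (suc j))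
      outer j s′ j<K refl f inv =
        weaken (+-monoʳ-≤ 20 (*-monoˡ-≤ 28 (≤-pred (≤-trans (bd j j<K) (rad≤ j)))))
          (conseq (for vₐ (Dₐ [ var uₐ ]) (eₐ ≔ var eₐ ⊕ wtₐ [ var uₐ ]) (s Dₐ j) 8 (λ v s″ → s″ eₐ 0 ≡ enc (s Dₐ) j + v * wt j) s′ refl (3 ≤! 9)
            (λ s″ f′ → trans (f′ Dₐ refl _) (trans (cong (s′ Dₐ) (f′ uₐ refl 0)) (f Dₐ refl _)))
            (λ v s″ v< _ f′ i′ → (assign
              (trans (cong₂ _+_ i′ (trans (f′ wtₐ refl _) (trans (cong (s′ wtₐ) (f′ uₐ refl 0)) (trans (f wtₐ refl _) (hw j j<K)))))
                (trans (+-assoc (enc (s Dₐ) j) (v * wt j) (wt j)) (cong (enc (s Dₐ) j +_) (+-comm (v * wt j) (wt j)))))))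
            (trans inv (sym (+-identityʳ _))))
          λ s″ _ q → proj₂ q)

    emit-runs : ∀ s → Weights s → s Nₐ 0 ≡ N → Bounded (s Dₐ) →
                Runs emit s (N ^ 10) (λ s′ → ∀ a → s′ reachₐ a ≡ (s reachₐ [ (s curₐ 0 + N) + enc (s Dₐ) K ⇐ 1 ]) a)
    emit-runs s W hN bd = weaken (plus 9 ≤-refl (const 10 8))
      (encode-runs s W bd ▹ λ s′ f q → assign λ a →
        trans (cong (λ x → (s′ reachₐ [ x ⇐ 1 ]) a) (cong₂ _+_ (cong₂ _+_ (f curₐ refl 0) (trans (f Nₐ refl 0) hN)) q))
              (cong (if (s curₐ 0 + N) + enc (s Dₐ) K ≡ᵇ a then 1 else_) (f reachₐ refl a)))

    -- The counterpart of `enc` for upper digits. Decoding proceeds from the most significant digit,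
    -- with the invariant that the rest in `yₐ` and the `high` part found so far add up to the code.
    high : (ℕ → ℕ) → ℕ → ℕ → ℕ
    high D i zero    = 0
    high D i (suc r) = D i * wt i + high D (suc i) r

    high-cong : ∀ {D D′} i r → (∀ k → i ≤ k → k < i + r → D k ≡ D′ k) → high D i r ≡ high D′ i r
    high-cong i zero    h = refl
    high-cong i (suc r) h = cong₂ (λ x y → x * wt i + y) (h i ≤-refl (m<m+n i (s≤s z≤n)))
      (high-cong (suc i) r λ k i<k k< → h k (<⇒≤ i<k) (≤-trans k< (≤-reflexive (sym (+-suc i r)))))

    enc-high : ∀ D i r → enc D i + high D i r ≡ enc D (i + r)
    enc-high D i zero    = trans (+-identityʳ _) (cong (enc D) (sym (+-identityʳ i)))
    enc-high D i (suc r) = trans (sym (+-assoc (enc D i) (D i * wt i) _)) (trans (enc-high D (suc i) r) (cong (enc D) (sym (+-suc i r))))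

    digitStep : Program
    digitStep =
      IF (var yₐ ⊕ lit 1) ⊖ wtₐ [ var idxₐ ]
      THEN (yₐ ≔ var yₐ ⊖ wtₐ [ var idxₐ ] ⨾ Dₐ [ var idxₐ ]≔ Dₐ [ var idxₐ ] ⊕ lit 1)
      ELSE skip

    -- Trial subtraction, ℓ times, works for every radix because `rad i` is at most ℓ + 1. Either
    -- all rounds so far have subtracted, or the rest is already below the weight and nothing
    -- changes any more.
    digit-runs : ∀ s i → i < K → s ℓₐ 0 ≡ ℓ → s idxₐ 0 ≡ i → s wtₐ i ≡ wt i → s Dₐ i ≡ 0 → s yₐ 0 < wt (suc i) →
                 Runs (FOR vₐ (var ℓₐ) digitStep) s (20 + ℓ * (20 + 30)) (λ s′ →
                   s′ yₐ 0 < wt i × s′ Dₐ i < rad i × s′ yₐ 0 + s′ Dₐ i * wt i ≡ s yₐ 0 × (∀ k → k ≢ i → s′ Dₐ k ≡ s Dₐ k))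
    digit-runs s i i<K hℓ refl hw hD hy =
      conseq (for vₐ (var ℓₐ) digitStep ℓ 30 Inv s refl (2 ≤! 9) (λ s′ f → trans (f ℓₐ refl 0) hℓ) step
               (trans (cong (λ x → s yₐ 0 + x * w) hD) (+-identityʳ _) , (λ k _ → refl) , inj₁ hD))
        λ s′ _ (_ , e , o , c) → let l = low s′ e c in l , dig s′ e l , e , o
      where
      w = wt i
      Inv : ℕ → State → Set
      Inv v s′ = s′ yₐ 0 + s′ Dₐ i * w ≡ s yₐ 0 × (∀ k → k ≢ i → s′ Dₐ k ≡ s Dₐ k) × (s′ Dₐ i ≡ v ⊎ s′ yₐ 0 < w)
      low : ∀ s′ → s′ yₐ 0 + s′ Dₐ i * w ≡ s yₐ 0 → (s′ Dₐ i ≡ ℓ ⊎ s′ yₐ 0 < w) → s′ yₐ 0 < w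
      low s′ e (inj₂ lt) = lt
      low s′ e (inj₁ r)  = +-cancelʳ-< (ℓ * w) _ _ (begin-strict
        s′ yₐ 0 + ℓ * w       ≡⟨ cong (λ x → s′ yₐ 0 + x * w) r ⟨
        s′ yₐ 0 + s′ Dₐ i * w ≡⟨ e ⟩
        s yₐ 0                <⟨ hy ⟩
        rad i * w             ≤⟨ *-monoˡ-≤ w (rad≤ i) ⟩
        w + ℓ * w             ∎)
        where open ≤-Reasoning
      dig : ∀ s′ → s′ yₐ 0 + s′ Dₐ i * w ≡ s yₐ 0 → s′ yₐ 0 < w → s′ Dₐ i < rad i
      dig s′ e l = *-cancelʳ-< w _ _ (≤-<-trans (≤-trans (m≤n+m _ (s′ yₐ 0)) (≤-reflexive e)) hy)
      step : ∀ v s′ → v < ℓ → s′ vₐ 0 ≡ v → Same (FOR vₐ (var ℓₐ) digitStep) s s′ → Inv v s′ → Runs digitStep s′ 30 (λ s″ → Inv (suc v) (s″ [ vₐ , 0 ↦ suc v ]))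
      step v s′ v<ℓ _ f (e , o , c) = weaken (_ ≤! 30) (if-runs
        (λ nz → let w≤y = ≤-pred (subst₂ _<_ wt≡ (+-comm _ 1) (m∸n≢0⇒n<m nz)) in
          assign-seq (assign (
            (begin
              (s′ yₐ 0 ∸ s′ wtₐ (s′ idxₐ 0)) + (s′ Dₐ [ s′ idxₐ 0 ⇐ s′ Dₐ (s′ idxₐ 0) + 1 ]) i * w
                ≡⟨ cong₂ (λ x y → s′ yₐ 0 ∸ x + y * w) wt≡ (trans (upd-≡ (s′ Dₐ) (s′ idxₐ 0) _ idx≡) (cong (λ x → s′ Dₐ x + 1) idx≡)) ⟩
              (s′ yₐ 0 ∸ w) + (s′ Dₐ i + 1) * w ≡⟨ rearrange (s′ yₐ 0 ∸ w) (s′ Dₐ i) w ⟩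
              (s′ yₐ 0 ∸ w + w) + s′ Dₐ i * w ≡⟨ cong (_+ s′ Dₐ i * w) (m∸n+n≡m w≤y) ⟩
              s′ yₐ 0 + s′ Dₐ i * w ≡⟨ e ⟩
              s yₐ 0 ∎) ,
            (λ k ne → trans (upd-≢ (s′ Dₐ) (s′ idxₐ 0) _ (λ q → ne (trans (sym q) idx≡))) (o k ne)) ,
            next c w≤y)))
        (λ z → weaken (1 ≤! 16) (skip-runs (e , o , inj₂ (≤-trans (≤-reflexive (+-comm 1 _)) (≤-trans (m∸n≡0⇒m≤n z) (≤-reflexive wt≡)))))))
        where
        open ≡-Reasoning
        idx≡ : s′ idxₐ 0 ≡ i
        idx≡ = f idxₐ refl 0
        wt≡ : s′ wtₐ (s′ idxₐ 0) ≡ w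
        wt≡ = trans (f wtₐ refl _) (trans (cong (s wtₐ) idx≡) hw)
        rearrange : ∀ a b w → a + (b + 1) * w ≡ a + w + b * w
        rearrange a b w = solve (a ∷ b ∷ w ∷ [])
        next : (s′ Dₐ i ≡ v ⊎ s′ yₐ 0 < w) → w ≤ s′ yₐ 0 →
               (s′ Dₐ [ s′ idxₐ 0 ⇐ s′ Dₐ (s′ idxₐ 0) + 1 ]) i ≡ suc v ⊎ (s′ yₐ 0 ∸ s′ wtₐ (s′ idxₐ 0)) < w
        next (inj₁ r) _ = inj₁ (trans (upd-≡ (s′ Dₐ) (s′ idxₐ 0) _ idx≡) (trans (cong (λ x → s′ Dₐ x + 1) idx≡) (trans (cong (_+ 1) r) (+-comm v 1))))
        next (inj₂ l) g = contradiction g (<⇒≱ l)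

    decode-runs : ∀ s → Weights s → s ℓₐ 0 ≡ ℓ → s zₐ 0 < N →
                  Runs decode s (N ^ 10) (λ s′ → Bounded (s′ Dₐ) × enc (s′ Dₐ) K ≡ s zₐ 0)
    decode-runs s (hK , hw) hℓ hz = weaken (plus 9 (const 4 8) (loop 5 K≤N (plus 5 (const 13 4) (loop 1 ℓ≤N (const 30 1)))))
      (assign-seq (conseq
        (for uₐ (var Kₐ) body K _ Inv _ refl (2 ≤! 9) (λ s′ f → trans (f Kₐ refl 0) hK) step
          (hz , (λ i a b → contradiction b (≤⇒≯ a)) , +-identityʳ _))
        λ s′ _ (_ , y< , bd , e) → finish s′ y< bd e))
      where
      body = idxₐ ≔ var Kₐ ⊖ (var uₐ ⊕ lit 1) ⨾ Dₐ [ var idxₐ ]≔ lit 0 ⨾ FOR vₐ (var ℓₐ) digitStep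
      Inv : ℕ → State → Set
      Inv j s′ = s′ yₐ 0 < wt (K ∸ j) × (∀ i → K ∸ j ≤ i → i < K → s′ Dₐ i < rad i) × s′ yₐ 0 + high (s′ Dₐ) (K ∸ j) j ≡ s zₐ 0
      finish : ∀ s′ → s′ yₐ 0 < wt (K ∸ K) → (∀ i → K ∸ K ≤ i → i < K → s′ Dₐ i < rad i) →
               s′ yₐ 0 + high (s′ Dₐ) (K ∸ K) K ≡ s zₐ 0 → Bounded (s′ Dₐ) × enc (s′ Dₐ) K ≡ s zₐ 0
      finish s′ y< bd e rewrite n∸n≡0 K =
        (λ i → bd i z≤n) , trans (sym (enc-high (s′ Dₐ) 0 K)) (trans (cong (_+ high (s′ Dₐ) 0 K) (sym (n<1⇒n≡0 y<))) e)
      step : ∀ j s′ → j < K → s′ uₐ 0 ≡ j → _ → Inv j s′ → Runs body s′ _ (λ s″ → Inv (suc j) (s″ [ uₐ , 0 ↦ suc j ]))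
      step j s′ j<K refl f (y< , bd , e) =
        assign-seq (assign-seq (conseq
          (digit-runs _ i i<K (trans (f ℓₐ refl 0) hℓ) idx≡ (trans (f wtₐ refl i) (hw i i<K))
            (upd-≡ (s′ Dₐ) _ 0 idx≡)
            (subst (λ x → s′ yₐ 0 < wt x) (sym si) y<))
          λ s″ g (y<′ , d< , e′ , o) →
            y<′ ,
            (λ k i≤k k<K → case k ≟ i of λ where
              (yes refl) → d<
              (no ne) → subst (_< rad k) (sym (trans (o k ne) (upd-≢ (s′ Dₐ) _ 0 (λ q → ne (sym (trans (sym idx≡) q)))))) (bd k (subst (_≤ k) si (≤∧≢⇒< i≤k (ne ∘ sym))) k<K)) ,
            (begin
              s″ yₐ 0 + (s″ Dₐ i * wt i + high (s″ Dₐ) (suc i) j) ≡⟨ +-assoc (s″ yₐ 0) _ _ ⟨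
              (s″ yₐ 0 + s″ Dₐ i * wt i) + high (s″ Dₐ) (suc i) j ≡⟨ cong₂ _+_ e′ (high-cong (suc i) j λ k l _ → trans (o k (>⇒≢ l)) (upd-≢ (s′ Dₐ) _ 0 (λ q → <⇒≢ l (trans (sym idx≡) q)))) ⟩
              s′ yₐ 0 + high (s′ Dₐ) (suc i) j ≡⟨ cong (λ x → s′ yₐ 0 + high (s′ Dₐ) x j) si ⟩
              s′ yₐ 0 + high (s′ Dₐ) (K ∸ j) j ≡⟨ e ⟩
              s zₐ 0 ∎)))
        where
        open ≡-Reasoning
        i = K ∸ suc j
        si : suc i ≡ K ∸ j
        si = sym (+-∸-assoc 1 j<K)
        i<K : i < K
        i<K = ≤-trans (≤-reflexive si) (m∸n≤m K j)
        idx≡ : s′ Kₐ 0 ∸ (j + 1) ≡ i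
        idx≡ = cong₂ _∸_ (trans (f Kₐ refl 0) hK) (+-comm j 1)

-- One pass over all states

module Levels (A m ℓ : ℕ) (room : Radix.Room A m ℓ) where

  open Radix A m ℓ
  open Room room
  open Machine room
  open Powers N 64≤N

  -- The block of N cells at `curₐ` is a characteristic function of V, with any nonzero entry
  -- counting as true. `fresh` guarantees that the following block starts out empty.
  record Level (V : Digits) (s : State) : Set where
    constructor mkLevel
    field
      sound    : ∀ z → z < N → s reachₐ (s curₐ 0 + z) ≢ 0 → ∃[ D ] (Bounded D × enc D K ≡ z × V D)
      complete : ∀ D → Bounded D → V D → s reachₐ (s curₐ 0 + enc D K) ≢ 0
      fresh    : ∀ a → s curₐ 0 + N ≤ a → s reachₐ a ≡ 0

  -- R is the set of successors of one state. `keep` lets the contributions of different states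
  -- accumulate in one pass; `only` confines new marks to the cells from `new` on, so the block
  -- being read is left alone.
  record Marks (R : Digits) (new : ℕ) (r r′ : ℕ → ℕ) : Set where
    constructor mkMarks
    field
      only : ∀ a → r′ a ≢ 0 → r a ≢ 0 ⊎ (∃[ D ] (Bounded D × R D × a ≡ new + enc D K))
      keep : ∀ a → r a ≢ 0 → r′ a ≢ 0
      hit  : ∀ D → Bounded D → R D → r′ (new + enc D K) ≢ 0

  levelGuarded : Program → Program
  levelGuarded body = IF reachₐ [ var curₐ ⊕ var zₐ ] THEN (decode ⨾ body) ELSE skip

  levelLoop : Program → Program
  levelLoop body = FOR zₐ (var Nₐ) (levelGuarded body)

  or-false : ∀ {b} → b ≡ false → (b ∨ false) ∨ false ≡ false
  or-false refl = refl

  -- `decode` recovers the vector behind a code only on the digits below K, hence the relation has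
  -- to respect agreement there (`R-resp`). The arrays listed in `w` are those on which the
  -- surrounding loop and `decode` rely.
  module _ (body : Program) (R : (ℕ → ℕ) → Digits) (s₀ : State) (e : ℕ)
           (w : ∀ a → a ≡ zₐ ⊎ a ≡ curₐ ⊎ a ≡ Kₐ ⊎ a ≡ Nₐ ⊎ a ≡ ℓₐ ⊎ a ≡ wtₐ → writes body a ≡ false)
           (R-resp : ∀ {D D₁} D′ → (∀ i → i < K → D i ≡ D₁ i) → R D D′ → R D₁ D′)
           (W : Weights s₀) (hN : s₀ Nₐ 0 ≡ N) (hℓ : s₀ ℓₐ 0 ≡ ℓ)
           (bodyRuns : ∀ s → Same (levelLoop body) s₀ s → Bounded (s Dₐ) →
                       Runs body s (N ^ (10 + e)) (λ s′ → Marks (R (s Dₐ)) (s₀ curₐ 0 + N) (s reachₐ) (s′ reachₐ)))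
           where

    level-runs : ∀ V → Level V s₀ → Runs (level body) s₀ (N ^ (16 + e)) (Level (Image V R))
    level-runs V L = weaken (plus (15 + e) (loop (11 + e) ≤-refl (plus (11 + e) (const 7 (10 + e)) (plus (10 + e) (^-monoʳ-≤ N (m≤m+n 10 e)) ≤-refl))) (const 7 (14 + e)))
      (for zₐ (var Nₐ) (levelGuarded body) N _ Inv s₀ (or-z) (2 ≤! 9) (λ s f → trans (f Nₐ (or-false (w Nₐ (inj₂ (inj₂ (inj₂ (inj₁ refl)))))) 0) hN) step
        ((λ a _ z → z) , (λ a z → z) , (λ a le nz → contradiction (Level.fresh L a le) nz) , (λ D bd v ()))
      ▹ λ s f (_ , I) → weaken (7 ≤! 7) (assign (close s f I)))
      where
      new = s₀ curₐ 0 + N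
      or-z : writes (levelGuarded body) zₐ ≡ false
      or-z rewrite w zₐ (inj₁ refl) = refl
      -- The first clause keeps the current block meaningful while the next one is being written: no
      -- cell below `new` gains a mark. The last clause covers the source states with code below z
      -- only.
      Inv : ℕ → State → Set
      Inv z s = (∀ a → a < new → s reachₐ a ≢ 0 → s₀ reachₐ a ≢ 0) ×
                (∀ a → s₀ reachₐ a ≢ 0 → s reachₐ a ≢ 0) ×
                (∀ a → new ≤ a → s reachₐ a ≢ 0 → ∃[ D ] (Bounded D × Image V R D × a ≡ new + enc D K)) ×
                (∀ D → Bounded D → V D → enc D K < z → ∀ D′ → Bounded D′ → R D D′ → s reachₐ (new + enc D′ K) ≢ 0)
      step : ∀ z s → z < N → s zₐ 0 ≡ z → Same (levelLoop body) s₀ s → Inv z s →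
             Runs (levelGuarded body) s (7 + (N ^ 10 + N ^ (10 + e))) (λ s′ → Inv (suc z) (s′ [ zₐ , 0 ↦ suc z ]))
      step z s z<N refl f (i₁ , i₂ , i₃ , i₄) = weaken (≤-refl) (if-runs
        (λ nz → decode-runs s (trans (f Kₐ (or-false (w Kₐ (inj₂ (inj₂ (inj₁ refl))))) 0) (proj₁ W) , λ i lt → trans (f wtₐ (or-false (w wtₐ (inj₂ (inj₂ (inj₂ (inj₂ (inj₂ refl))))))) i) (proj₂ W i lt))
                  (trans (f ℓₐ (or-false (w ℓₐ (inj₂ (inj₂ (inj₂ (inj₂ (inj₁ refl))))))) 0) hℓ) z<N
          ▹ λ s₁ g (bd , en) → conseq (bodyRuns s₁ (λ b q k → trans (g b (inDecode b q) k) (f b q k)) bd)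
            λ s₂ _ (mkMarks only keep hit) →
              let r≡ = g reachₐ refl
                  back : ∀ a → s₁ reachₐ a ≢ 0 → s reachₐ a ≢ 0
                  back a n q = n (trans (r≡ a) q)
                  forth : ∀ a → s reachₐ a ≢ 0 → s₁ reachₐ a ≢ 0
                  forth a n q = n (trans (sym (r≡ a)) q)
                  cur≡ : s curₐ 0 ≡ s₀ curₐ 0
                  cur≡ = f curₐ (or-false (w curₐ (inj₂ (inj₁ refl)))) 0
                  old : s₀ reachₐ (s₀ curₐ 0 + z) ≢ 0
                  old = i₁ _ (+-monoʳ-< (s₀ curₐ 0) z<N) (subst (λ c → s reachₐ (c + z) ≢ 0) cur≡ nz)
              in
              (λ a lt n → case only a n of λ where
                (inj₁ n′) → i₁ a lt (back a n′)
                (inj₂ (D , _ , _ , refl)) → contradiction lt (≤⇒≯ (m≤m+n new _))) ,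
              (λ a n → keep a (forth a (i₂ a n))) ,
              (λ a le n → case only a n of λ where
                (inj₁ n′) → i₃ a le (back a n′)
                (inj₂ (D′ , bd′ , r , eq)) → case Level.sound L z z<N old of λ where
                  (D , bdD , enD , vD) → D′ , bd′ , (D , bdD , vD , R-resp D′ (enc-injective K bd bdD (trans en (sym enD))) r) , eq) ,
              (λ D bdD v lt D′ bd′ r → case m<1+n⇒m<n∨m≡n lt of λ where
                (inj₁ lt′) → keep _ (forth _ (i₄ D bdD v lt′ D′ bd′ r))
                (inj₂ eq) → hit D′ bd′ (R-resp D′ (enc-injective K bdD bd (trans eq (sym en))) r)))
        (λ zero → weaken (≤-trans (1≤^ 10) (m≤m+n (N ^ 10) _)) (skip-runs
          (i₁ , i₂ , i₃ , λ D bdD v lt D′ bd′ r → case m<1+n⇒m<n∨m≡n lt of λ where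
            (inj₁ lt′) → i₄ D bdD v lt′ D′ bd′ r
            (inj₂ eq) → contradiction (subst₂ (λ c x → s reachₐ (c + x) ≡ 0) (f curₐ (or-false (w curₐ (inj₂ (inj₁ refl)))) 0) (sym eq) zero)
                          (i₂ _ (Level.complete L D bdD v))))))
        where
        inDecode : ∀ b → writes (levelLoop body) b ≡ false → writes decode b ≡ false
        inDecode b q = ∨-falseˡ (writes decode b) (∨-falseˡ (writes decode b ∨ writes body b) (∨-falseˡ ((writes decode b ∨ writes body b) ∨ false) (∨-falseʳ (zₐ ≡ᵇ b) q)))
        1≤^ : ∀ e → 1 ≤^ e
        1≤^ e = m^n>0 N e
      close : ∀ s → Same (levelLoop body) s₀ s → Inv N s → Level (Image V R) (s [ curₐ , 0 ↦ s curₐ 0 + s Nₐ 0 ])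
      close s f (i₁ , i₂ , i₃ , i₄) = mkLevel
        (λ z z<N n → case i₃ (new + z) (m≤m+n new z) (subst (λ c → s reachₐ (c + z) ≢ 0) cur≡ n) of λ where
          (D , bd , im , eq) → D , bd , sym (+-cancelˡ-≡ new _ _ eq) , im)
        (λ D′ bd′ (D , bd , v , r) → subst (λ c → s reachₐ (c + enc D′ K) ≢ 0) (sym cur≡) (i₄ D bd v (enc-< D K bd) D′ bd′ r))
        (λ a le → case s reachₐ a ≟ 0 of λ where
          (yes z) → z
          (no n) → case i₃ a (≤-trans (m≤m+n new N) (subst (λ c → c + N ≤ a) cur≡ le)) n of λ where
            (D , bd , _ , refl) → contradiction (subst (λ c → c + N ≤ a) cur≡ le) (<⇒≱ (+-monoʳ-< new (enc-< D K bd))))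
        where
        cur≡ : s curₐ 0 + s Nₐ 0 ≡ new
        cur≡ = cong₂ _+_ (f curₐ (or-false (w curₐ (inj₂ (inj₁ refl)))) 0) (trans (f Nₐ (or-false (w Nₐ (inj₂ (inj₂ (inj₂ (inj₁ refl)))))) 0) hN)

-- Transitions between states

module Transitions (A m ℓ : ℕ) where

  open Radix A m ℓ

  -- The bound b exists for the loop over candidates: at 0 only the transition without a start is
  -- left, at A the relation is `Start`.
  StartBelow : (ℕ → ℕ) → ℕ → ℕ → (ℕ → ℕ) → (ℕ → ℕ) → Set
  StartBelow fit b k D D′ = (∀ i → i < A + m → D′ i ≡ D i) ⊎
    (∃[ c ] (c < b × D c ≡ 0 × D (A + k) ≡ 0 × fit c ≢ 0 × D′ c ≡ 1 × D′ (A + k) ≡ fit c ×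
            (∀ i → i < A + m → i ≢ c → i ≢ A + k → D′ i ≡ D i)))

  Start : (ℕ → ℕ) → ℕ → (ℕ → ℕ) → (ℕ → ℕ) → Set
  Start fit = StartBelow fit A

  -- No successor exists if a job would leave unstarted. Otherwise the remaining clauses fix every
  -- digit below K, a position to which nothing moves being vacant or that of an entering job;
  -- therefore one `emit` covers the whole relation.
  Boundary : (ℕ → ℕ) → (ℕ → ℕ) → (ℕ → ℕ) → Set
  Boundary nxt D D′ =
    (∀ c → c < A → nxt c ≡ 1 → D c ≢ 0) ×
    (∀ c c′ → c < A → nxt c ≡ 2 + c′ → D′ c′ ≡ D c) ×
    (∀ c′ → c′ < A → (∀ c → c < A → nxt c ≢ 2 + c′) → D′ c′ ≡ 0) ×
    (∀ k → k < m → D′ (A + k) ≡ D (A + k) ∸ 1)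

  Start-resp : ∀ {fit k D D₁} D′ → k < m → (∀ i → i < A + m → D i ≡ D₁ i) → Start fit k D D′ → Start fit k D₁ D′
  Start-resp D′ k<m e (inj₁ x) = inj₁ λ i lt → trans (x i lt) (e i lt)
  Start-resp D′ k<m e (inj₂ (c , c<A , d , d′ , f , x , y , z)) =
    inj₂ (c , c<A , trans (sym (e c (≤-trans c<A (m≤m+n A m)))) d , trans (sym (e _ (+-monoʳ-< A k<m))) d′ , f , x , y ,
          λ i lt n n′ → trans (z i lt n n′) (e i lt))

  Boundary-resp : ∀ {nxt D D₁} D′ → (∀ i → i < A + m → D i ≡ D₁ i) → Boundary nxt D D′ → Boundary nxt D₁ D′
  Boundary-resp D′ e (lv , mv , nw , dc) =
    (λ c lt q z → lv c lt q (trans (e c (≤-trans lt (m≤m+n A m))) z)) ,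
    (λ c c′ lt q → trans (mv c c′ lt q) (e c (≤-trans lt (m≤m+n A m)))) , nw ,
    λ k lt → trans (dc k lt) (cong (_∸ 1) (e (A + k) (+-monoʳ-< A lt)))

  private
    machine-digit : ∀ {i} → i < K → ¬ i < A → ∃[ k ] (k < m × A + k ≡ i)
    machine-digit {i} i<K ge = i ∸ A , +-cancelˡ-< A _ _ (subst (_< K) (sym e) i<K) , e
      where e = m+[n∸m]≡n (≮⇒≥ ge)

  boundary-unique : ∀ {nxt} D₀ D D′ → Boundary nxt D₀ D → Boundary nxt D₀ D′ → ∀ i → i < K → D i ≡ D′ i
  boundary-unique {nxt} D₀ D D′ (_ , mv , nw , dc) (_ , mv′ , nw′ , dc′) i i<K with i <? A
  ... | no ge with machine-digit i<K ge
  ...   | k , k<m , refl = trans (dc k k<m) (sym (dc′ k k<m))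
  boundary-unique {nxt} D₀ D D′ (_ , mv , nw , dc) (_ , mv′ , nw′ , dc′) i i<K | yes lt
    with anyUpTo? (λ c → nxt c ≟ 2 + i) A
  ... | yes (c , c<A , e) = trans (mv c i c<A e) (sym (mv′ c i c<A e))
  ... | no none = trans (nw i lt λ c l e → none (c , l , e)) (sym (nw′ i lt λ c l e → none (c , l , e)))

  boundary-bounded : ∀ {nxt} D₀ D → Bounded D₀ → Boundary nxt D₀ D → Bounded D
  boundary-bounded {nxt} D₀ D bd (_ , mv , nw , dc) i i<K with i <? A
  ... | no ge with machine-digit i<K ge
  ...   | k , k<m , refl = ≤-<-trans (≤-trans (≤-reflexive (dc k k<m)) (m∸n≤m (D₀ (A + k)) 1)) (bd (A + k) i<K)
  boundary-bounded {nxt} D₀ D bd (_ , mv , nw , dc) i i<K | yes lt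
    with anyUpTo? (λ c → nxt c ≟ 2 + i) A
  ... | yes (c , c<A , e) = subst₂ _<_ (sym (mv c i c<A e)) (trans (rad-bit c<A) (sym (rad-bit lt))) (bd c (≤-trans c<A (m≤m+n A m)))
  ... | no none = subst (_< rad i) (sym (nw i lt λ c l e → none (c , l , e))) (rad>0 i)

module Reachability (A m ℓ : ℕ) (fit nxt : ℕ → ℕ → ℕ) where

  open Radix A m ℓ
  open Transitions A m ℓ

  -- Lexicographic in row and machine: in row h the first k machines have been offered a start, and
  -- the boundary is crossed once all m have.
  Reach : ℕ → ℕ → Digits
  Reach h       (suc k) D = Image (Reach h k) (Start (fit h) k) D
  Reach zero    zero    D = ∀ i → i < K → D i ≡ 0
  Reach (suc h) zero    D = Image (Reach h m) (Boundary (nxt h)) D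

-- Correctness of the two transition bodies

module Bodies (A m ℓ : ℕ) (room : Radix.Room A m ℓ)
              (fit nxt : ℕ → ℕ) (fit≤ℓ : ∀ c → c < A → fit c ≤ ℓ)
              (nxt<A : ∀ c c′ → c < A → nxt c ≡ 2 + c′ → c′ < A)
              (nxt-injective : ∀ c₁ c₂ c′ → c₁ < A → c₂ < A → nxt c₁ ≡ 2 + c′ → nxt c₂ ≡ 2 + c′ → c₁ ≡ c₂) where

  open Radix A m ℓ
  open Room room
  open Machine room
  open Powers N 64≤N
  open Levels A m ℓ room
  open Transitions A m ℓ

  A≤N : A ≤ N
  A≤N = ≤-trans (m≤m+n A m) K≤N

  m≤N : m ≤ N
  m≤N = ≤-trans (m≤n+m m A) K≤N

  -- One `emit` adds a single vector to the relation. In `down` it is recognised by its digits below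
  -- K alone, since `enc` sees no others.
  marks-emit : ∀ {R R′ : Digits} {new r r₁ r₂} D₁ → Marks R new r r₁ → Bounded D₁ →
               (∀ a → r₂ a ≡ (r₁ [ new + enc D₁ K ⇐ 1 ]) a) → R′ D₁ → (∀ D → R D → R′ D) →
               (∀ D → R′ D → R D ⊎ (∀ i → i < K → D i ≡ D₁ i)) → Marks R′ new r r₂
  marks-emit {R} {R′} {new} {r} {r₁} {r₂} D₁ (mkMarks only keep hit) bd eq r′ up down = mkMarks
    (λ a n → case new + enc D₁ K ≟ a of λ where
      (yes refl) → inj₂ (D₁ , bd , r′ , refl)
      (no ne) → case only a (λ z → n (trans (eq a) (trans (upd-≢ r₁ _ 1 ne) z))) of λ where
        (inj₁ o) → inj₁ o
        (inj₂ (D , b , x , e)) → inj₂ (D , b , up D x , e))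
    (λ a n → more a (keep a n))
    (λ D b x → case down D x of λ where
      (inj₁ y) → more _ (hit D b y)
      (inj₂ e) → λ z → case trans (sym (trans (eq _) (upd-≡ r₁ _ 1 (cong (new +_) (sym (enc-cong K e)))))) z of λ ())
    where
    more : ∀ a → r₁ a ≢ 0 → r₂ a ≢ 0
    more a n z = upd-elim r₁ (new + enc D₁ K) 1 a (_≢ 0) (λ _ ()) (λ _ → n) (trans (sym (eq a)) z)

  marks-map : ∀ {R R′ : Digits} {new r r₁} → (∀ D → R D → R′ D) → (∀ D → R′ D → R D) → Marks R new r r₁ → Marks R′ new r r₁
  marks-map up down (mkMarks only keep hit) = mkMarks
    (λ a n → case only a n of λ where
      (inj₁ o) → inj₁ o
      (inj₂ (D , b , x , e)) → inj₂ (D , b , up D x , e))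
    keep (λ D b x → hit D b (down D x))

  marks-none : ∀ {R : Digits} {new r r₁} → (∀ a → r₁ a ≡ r a) → (∀ D → ¬ R D) → Marks R new r r₁
  marks-none e none = mkMarks (λ a n → inj₁ λ z → n (trans (e a) z)) (λ a n z → n (trans (sym (e a)) z)) (λ D _ x → ⊥-elim (none D x))

  record Ready (s : State) : Set where
    field
      W    : Weights s
      hN   : s Nₐ 0 ≡ N
      hA   : s Aₐ 0 ≡ A
      hm   : s mₐ 0 ≡ m
      hfit : ∀ c → c < A → s fitₐ (s rowₐ 0 + c) ≡ fit c
      hnxt : ∀ c → c < A → s nxtₐ (s rowₐ 0 + c) ≡ nxt c

  module _ (s₀ : State) (ready : Ready s₀) where

    open Ready ready

    new : ℕ
    new = s₀ curₐ 0 + N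

    Kept : State → Set
    Kept s = s curₐ 0 ≡ s₀ curₐ 0 × s Nₐ 0 ≡ s₀ Nₐ 0 × s Kₐ 0 ≡ s₀ Kₐ 0 × (∀ i → s wtₐ i ≡ s₀ wtₐ i)

    emit-marks : ∀ {R R′ : Digits} {r} s → Kept s → Marks R new r (s reachₐ) → Bounded (s Dₐ) →
                 R′ (s Dₐ) → (∀ D → R D → R′ D) → (∀ D → R′ D → R D ⊎ (∀ i → i < K → D i ≡ s Dₐ i)) →
                 Runs emit s (N ^ 10) (λ s′ → Marks R′ new r (s′ reachₐ))
    emit-marks s (f-cur , f-N , f-K , f-wt) M bd r′ up down =
      conseq (emit-runs s (weights-keep {s₀} {s} f-K f-wt W) (trans f-N hN) bd)
        λ s′ _ q → marks-emit (s Dₐ) M bd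
          (λ a → subst (λ c → s′ reachₐ a ≡ (s reachₐ [ (c + N) + enc (s Dₐ) K ⇐ 1 ]) a) f-cur (q a)) r′ up down

    -- The transition without a start is emitted first. Each candidate is then tried on the working
    -- vector itself and undone afterwards, so the invariant keeps `Dₐ` equal to `D₀` while the
    -- relation grows by one position per round.
    start-runs : ∀ k → k < m → s₀ kₐ 0 ≡ k → Bounded (s₀ Dₐ) →
                 Runs startBody s₀ (N ^ 17) (λ s′ → Marks (Start fit k (s₀ Dₐ)) new (s₀ reachₐ) (s′ reachₐ))
    start-runs k k<m refl bd = weaken (plus 16 (raise 10 16 ≤-refl) (plus 15 (const 7 14) (loop 11 A≤N (plus 11 (const 38 10) (raise 10 11 ≤-refl)))))
      (emit-marks {R = λ _ → ⊥} {R′ = StartBelow fit 0 k D₀} s₀ (refl , refl , refl , λ _ → refl) (marks-none (λ _ → refl) λ _ ()) bd (inj₁ λ _ _ → refl) (λ _ ())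
        (λ { D (inj₁ e) → inj₂ e ; D (inj₂ (_ , () , _)) })
      ▹ λ s₁ f M → if-runs
        (λ nz → weaken (s≤s z≤n) (skip-runs (marks-map (λ { D (inj₁ e) → inj₁ e ; D (inj₂ (_ , () , _)) }) (λ { D (inj₁ e) → inj₁ e
            ; D (inj₂ (c , _ , _ , z , _)) → contradiction (trans (trans (f Dₐ refl _) (cong D₀ (cong₂ _+_ (trans (f Aₐ refl 0) hA) (f kₐ refl 0)))) z) nz }) M)))
        (λ z → conseq (for cₐ (var Aₐ) stepP A _ Inv s₁ refl (2 ≤! 9) (λ s f′ → trans (f′ Aₐ refl 0) (trans (f Aₐ refl 0) hA)) (step s₁ f z)
                (f Dₐ refl , M))
              λ s₂ _ (_ , _ , M′) → M′))
      where
      D₀ = s₀ Dₐ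
      stepP : Program
      stepP =
        IF fitₐ [ var rowₐ ⊕ var cₐ ]
        THEN (IF Dₐ [ var cₐ ] THEN skip
              ELSE (Dₐ [ var cₐ ]≔ lit 1 ⨾
                    Dₐ [ var Aₐ ⊕ var kₐ ]≔ fitₐ [ var rowₐ ⊕ var cₐ ] ⨾
                    emit ⨾
                    Dₐ [ var cₐ ]≔ lit 0 ⨾
                    Dₐ [ var Aₐ ⊕ var kₐ ]≔ lit 0))
        ELSE skip
      Inv : ℕ → State → Set
      Inv c s = (∀ i → s Dₐ i ≡ D₀ i) × Marks (StartBelow fit c k D₀) new (s₀ reachₐ) (s reachₐ)
      step : ∀ s₁ → Same emit s₀ s₁ → s₁ Dₐ (s₁ Aₐ 0 + s₁ kₐ 0) ≡ 0 →
             ∀ c s → c < A → s cₐ 0 ≡ c → Same (FOR cₐ (var Aₐ) stepP) s₁ s → Inv c s →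
             Runs stepP s (38 + N ^ 10) (λ s′ → Inv (suc c) (s′ [ cₐ , 0 ↦ suc c ]))
      step s₁ f₁ z c s c<A refl f′ (iD , M) = weaken (total (N ^ 10)) (if-runs
          (λ fit≢0 → if-runs
            (λ Dc≢0 → weaken (s≤s z≤n) (skip-runs (iD , same M λ _ d → Dc≢0 (trans (iD c) d))))
            (λ Dc≡0 → let
                D₁ = (s Dₐ [ c ⇐ 1 ]) [ s Aₐ 0 + s kₐ 0 ⇐ s fitₐ (s rowₐ 0 + c) ]
                D₁-machine : D₁ (A + k) ≡ fit c
                D₁-machine = trans (upd-≡ (s Dₐ [ c ⇐ 1 ]) _ _ Ak) fit≡
                D₁-bit : D₁ c ≡ 1
                D₁-bit = trans (upd-≢ (s Dₐ [ c ⇐ 1 ]) _ _ (λ q → c≢Ak (trans (sym q) Ak))) (upd-≡ (s Dₐ) c 1 refl)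
                D₁-else : ∀ i → i ≢ c → i ≢ A + k → D₁ i ≡ D₀ i
                D₁-else i n n′ = trans (upd-≢ (s Dₐ [ c ⇐ 1 ]) _ _ (λ q → n′ (trans (sym q) Ak))) (trans (upd-≢ (s Dₐ) c 1 (n ∘ sym)) (iD i))
              in assign-seq (assign-seq (
              emit-marks {R = StartBelow fit c k D₀} {R′ = StartBelow fit (suc c) k D₀}
                _ (f curₐ refl 0 , f Nₐ refl 0 , f Kₐ refl 0 , f wtₐ refl) M
                (λ i i<K → upd-elim (s Dₐ [ c ⇐ 1 ]) (s Aₐ 0 + s kₐ 0) _ i (_< rad i)
                   (λ q → subst₂ _<_ (sym fit≡) (sym (rad-machine (≤-trans (m≤m+n A k) (≤-reflexive (trans (sym Ak) q))))) (s≤s (fit≤ℓ c c<A)))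
                   (λ _ → upd-elim (s Dₐ) c 1 i (_< rad i)
                     (λ q → subst (1 <_) (sym (rad-bit (subst (_< A) q c<A))) ≤-refl)
                     (λ _ → subst (_< rad i) (sym (iD i)) (bd i i<K))))
                (inj₂ (c , ≤-refl , trans (sym (iD c)) Dc≡0 , machine≡0 , (λ q → fit≢0 (trans fit≡ q)) , D₁-bit , D₁-machine , λ i _ → D₁-else i))
                (λ { D (inj₁ e) → inj₁ e ; D (inj₂ (c′ , lt , rest)) → inj₂ (c′ , m<n⇒m<1+n lt , rest) })
                (λ { D (inj₁ e) → inj₁ (inj₁ e)
                   ; D (inj₂ (c′ , lt , r₁ , r₂ , r₃ , r₄ , r₅ , r₆)) → case m<1+n⇒m<n∨m≡n lt of λ where
                       (inj₁ lt′) → inj₁ (inj₂ (c′ , lt′ , r₁ , r₂ , r₃ , r₄ , r₅ , r₆))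
                       (inj₂ refl) → inj₂ λ i i<K → case i ≟ c of λ where
                         (yes refl) → trans r₄ (sym D₁-bit)
                         (no n) → case i ≟ A + k of λ where
                           (yes refl) → trans r₅ (sym D₁-machine)
                           (no n′) → trans (r₆ i i<K n n′) (sym (D₁-else i n n′)) })
              ▹ λ s₃ g M′ → assign-seq (assign (
                (λ i → upd-elim (s₃ Dₐ [ s₃ cₐ 0 ⇐ 0 ]) (s₃ Aₐ 0 + s₃ kₐ 0) 0 i (_≡ D₀ i)
                  (λ q → sym (trans (cong D₀ (trans (sym q) (trans (cong₂ _+_ (g Aₐ refl 0) (g kₐ refl 0)) Ak))) machine≡0))
                  (λ n′ → upd-elim (s₃ Dₐ) (s₃ cₐ 0) 0 i (_≡ D₀ i)
                    (λ q → sym (trans (cong D₀ (trans (sym q) (g cₐ refl 0))) (trans (sym (iD c)) Dc≡0)))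
                    (λ n → trans (g Dₐ refl i) (D₁-else i (λ q → n (trans (g cₐ refl 0) (sym q)))
                       (λ q → n′ (trans (trans (cong₂ _+_ (g Aₐ refl 0) (g kₐ refl 0)) Ak) (sym q))))))) ,
                M′))))))
          (λ fit≡0 → weaken (s≤s z≤n) (skip-runs (iD , same M λ q _ → q (trans (sym fit≡) fit≡0)))))
        where
        f : Same startBody s₀ s
        f b w i = trans (f′ b (∨-falseʳ (writes emit b) w) i) (f₁ b (∨-falseˡ (writes emit b) w) i)
        Ak : s Aₐ 0 + s kₐ 0 ≡ A + k
        Ak = cong₂ _+_ (trans (f Aₐ refl 0) hA) (f kₐ refl 0)
        c≢Ak : c ≢ A + k
        c≢Ak q = <⇒≱ c<A (≤-trans (m≤m+n A k) (≤-reflexive (sym q)))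
        fit≡ : s fitₐ (s rowₐ 0 + c) ≡ fit c
        fit≡ = trans (f fitₐ refl _) (trans (cong (λ x → s₀ fitₐ (x + c)) (f rowₐ refl 0)) (hfit c c<A))
        machine≡0 : D₀ (A + k) ≡ 0
        machine≡0 = trans (cong D₀ (cong₂ _+_ (sym (trans (f₁ Aₐ refl 0) hA)) (sym (f₁ kₐ refl 0)))) (trans (sym (f₁ Dₐ refl _)) z)
        same : ∀ {r} → Marks (StartBelow fit c k D₀) new (s₀ reachₐ) r → (fit c ≢ 0 → D₀ c ≡ 0 → ⊥) →
               Marks (StartBelow fit (suc c) k D₀) new (s₀ reachₐ) r
        same M none = marks-map
          (λ { D (inj₁ e) → inj₁ e ; D (inj₂ (c′ , lt , rest)) → inj₂ (c′ , m<n⇒m<1+n lt , rest) })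
          (λ { D (inj₁ e) → inj₁ e
             ; D (inj₂ (c′ , lt , r₁ , r₂ , r₃ , rest)) → case m<1+n⇒m<n∨m≡n lt of λ where
                 (inj₁ lt′) → inj₂ (c′ , lt′ , r₁ , r₂ , r₃ , rest)
                 (inj₂ refl) → ⊥-elim (none r₃ r₁) }) M
        total : ∀ x → 27 + (x + 11) ≤ 38 + x
        total x = ≤-reflexive (solve (x ∷ []))

    private
      D₀ : ℕ → ℕ
      D₀ = s₀ Dₐ

      saveP moveP tickP : Program
      saveP = Eₐ [ var cₐ ]≔ Dₐ [ var cₐ ] ⨾ Dₐ [ var cₐ ]≔ lit 0
      moveP =
        IF nxtₐ [ var rowₐ ⊕ var cₐ ]
        THEN (IF nxtₐ [ var rowₐ ⊕ var cₐ ] ⊖ lit 1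
              THEN Dₐ [ nxtₐ [ var rowₐ ⊕ var cₐ ] ⊖ lit 2 ]≔ Eₐ [ var cₐ ]
              ELSE (IF Eₐ [ var cₐ ] THEN skip ELSE okₐ ≔ lit 0))
        ELSE skip
      tickP = Dₐ [ var Aₐ ⊕ var vₐ ]≔ Dₐ [ var Aₐ ⊕ var vₐ ] ⊖ lit 1

      Saved : ℕ → State → Set
      Saved c s = (∀ i → i < c → s Eₐ i ≡ D₀ i) × (∀ i → i < c → s Dₐ i ≡ 0) × (∀ i → c ≤ i → s Dₐ i ≡ D₀ i)

      Moved : ℕ → State → Set
      Moved c s = (∀ i → A ≤ i → s Dₐ i ≡ D₀ i) ×
                  (∀ c₁ c′ → c₁ < c → nxt c₁ ≡ 2 + c′ → s Dₐ c′ ≡ D₀ c₁) ×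
                  (∀ c′ → c′ < A → (∀ c₁ → c₁ < c → nxt c₁ ≢ 2 + c′) → s Dₐ c′ ≡ 0) ×
                  (s okₐ 0 ≢ 0 → ∀ c₁ → c₁ < c → nxt c₁ ≡ 1 → D₀ c₁ ≢ 0) ×
                  (s okₐ 0 ≡ 0 → ∃[ c₁ ] (c₁ < c × nxt c₁ ≡ 1 × D₀ c₁ ≡ 0))

      Ticked : ℕ → (ℕ → ℕ) → State → Set
      Ticked k D s = (∀ k′ → k′ < k → s Dₐ (A + k′) ≡ D (A + k′) ∸ 1) ×
                     (∀ k′ → k ≤ k′ → s Dₐ (A + k′) ≡ D (A + k′)) ×
                     (∀ i → i < A → s Dₐ i ≡ D i)

    save-runs : ∀ s → s Aₐ 0 ≡ A → (∀ i → s Dₐ i ≡ D₀ i) → Runs (FOR cₐ (var Aₐ) saveP) s (20 + A * (20 + 10)) (Saved A)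
    save-runs s hA′ hD = conseq
      (for cₐ (var Aₐ) saveP A 10 Saved s refl (2 ≤! 9) (λ s′ f → trans (f Aₐ refl 0) hA′) step
        ((λ _ ()) , (λ _ ()) , (λ i _ → hD i)))
      λ s′ _ → proj₂
      where
      step : ∀ c s′ → c < A → s′ cₐ 0 ≡ c → Same (FOR cₐ (var Aₐ) saveP) s s′ → Saved c s′ →
             Runs saveP s′ 10 (λ s″ → Saved (suc c) (s″ [ cₐ , 0 ↦ suc c ]))
      step c s′ c<A refl f (e , z , o) = assign-seq (assign (
        (λ i lt → upd-elim (s′ Eₐ) c _ i (_≡ D₀ i) (λ { refl → o c ≤-refl }) (λ n → e i (≤∧≢⇒< (≤-pred lt) (n ∘ sym)))) ,
        (λ i lt → upd-elim (s′ Dₐ) c 0 i (_≡ 0) (λ _ → refl) (λ n → z i (≤∧≢⇒< (≤-pred lt) (n ∘ sym)))) ,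
        (λ i lt → trans (upd-≢ (s′ Dₐ) c 0 (<⇒≢ lt)) (o i (<⇒≤ lt)))))

    -- `nxt-injective` is what prevents two bits from being moved to the same position. `okₐ` is
    -- tracked in both directions: the value 0 has to refute every successor, not merely withhold
    -- one.
    move-runs : ∀ s → s Aₐ 0 ≡ A → s okₐ 0 ≡ 1 → (∀ c → c < A → s nxtₐ (s rowₐ 0 + c) ≡ nxt c) → Saved A s →
                Runs (FOR cₐ (var Aₐ) moveP) s (20 + A * (20 + 31)) (Moved A)
    move-runs s hA′ hok hn (e , z , o) = conseq
      (for cₐ (var Aₐ) moveP A 31 Moved s refl (2 ≤! 9) (λ s′ f → trans (f Aₐ refl 0) hA′) step
        (o , (λ _ _ ()) , (λ c′ lt _ → z c′ lt) , (λ _ _ ()) , λ q → case trans (sym hok) q of λ ()))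
      λ s′ _ → proj₂
      where
      step : ∀ c s′ → c < A → s′ cₐ 0 ≡ c → Same (FOR cₐ (var Aₐ) moveP) s s′ → Moved c s′ →
             Runs moveP s′ 31 (λ s″ → Moved (suc c) (s″ [ cₐ , 0 ↦ suc c ]))
      step c s′ c<A refl f (hi , mv , nw , ok , bad) = weaken (_ ≤! 31) (if-runs
        (λ n≢0 → if-runs
          (λ n≢1 → let
              n = s′ nxtₐ (s′ rowₐ 0 + c)
              eq : nxt c ≡ 2 + (n ∸ 2)
              eq = trans (sym n≡) (sym (m+[n∸m]≡n (m∸n≢0⇒n<m n≢1)))
            in weaken (≤-refl) (assign (
            (λ i le → trans (upd-≢ (s′ Dₐ) (n ∸ 2) _ (λ q → <⇒≱ (nxt<A c (n ∸ 2) c<A eq) (subst (A ≤_) (sym q) le))) (hi i le)) ,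
            (λ c₁ c′ lt e₁ → upd-elim (s′ Dₐ) (n ∸ 2) _ c′ (_≡ D₀ c₁)
              (λ { refl → trans E≡ (cong D₀ (nxt-injective c c₁ c′ c<A (≤-trans lt c<A) eq e₁)) })
              (λ ne → mv c₁ c′ (≤∧≢⇒< (≤-pred lt) (λ { refl → ne (+-cancelˡ-≡ 2 _ _ (trans (sym eq) e₁)) })) e₁)) ,
            (λ c′ lt none → trans (upd-≢ (s′ Dₐ) (n ∸ 2) _ (λ { refl → none c ≤-refl eq })) (nw c′ lt λ c₁ lt₁ → none c₁ (m<n⇒m<1+n lt₁))) ,
            (λ o c₁ lt e₁ → ok o c₁ (≤∧≢⇒< (≤-pred lt) (λ { refl → case trans (sym eq) e₁ of λ () })) e₁) ,
            (λ o → case bad o of λ { (c₁ , lt , r) → c₁ , m<n⇒m<1+n lt , r }))))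
          (λ n≤1 → let
              eq : nxt c ≡ 1
              eq = trans (sym n≡) (≤-antisym (m∸n≡0⇒m≤n n≤1) (n≢0⇒n>0 n≢0))
              mv′ = λ c₁ c′ lt e₁ → mv c₁ c′ (≤∧≢⇒< (≤-pred lt) (λ { refl → case trans (sym eq) e₁ of λ () })) e₁
              nw′ = λ c′ lt none → nw c′ lt λ c₁ lt₁ → none c₁ (m<n⇒m<1+n lt₁)
            in weaken (_ ≤! 12) (if-runs
            (λ E≢0 → weaken (1 ≤! 3) (skip-runs (hi , mv′ , nw′ ,
              (λ o c₁ lt e₁ d → case m<1+n⇒m<n∨m≡n lt of λ where
                (inj₁ lt₁) → ok o c₁ lt₁ e₁ d
                (inj₂ refl) → E≢0 (trans E≡ d)) ,
              (λ o → case bad o of λ { (c₁ , lt , r) → c₁ , m<n⇒m<1+n lt , r }))))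
            (λ E≡0 → assign (hi , mv′ , nw′ , (λ o → ⊥-elim (o refl)) , (λ _ → c , ≤-refl , eq , trans (sym E≡) E≡0))))))
        (λ n≡0 → weaken (_ ≤! 21) (skip-runs (hi ,
          (λ c₁ c′ lt e₁ → mv c₁ c′ (≤∧≢⇒< (≤-pred lt) (λ { refl → case trans (sym e₁) (trans (sym n≡) n≡0) of λ () })) e₁) ,
          (λ c′ lt none → nw c′ lt λ c₁ lt₁ → none c₁ (m<n⇒m<1+n lt₁)) ,
          (λ o c₁ lt e₁ → ok o c₁ (≤∧≢⇒< (≤-pred lt) (λ { refl → case trans (sym e₁) (trans (sym n≡) n≡0) of λ () })) e₁) ,
          (λ o → case bad o of λ { (c₁ , lt , r) → c₁ , m<n⇒m<1+n lt , r })))))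
        where
        n≡ : s′ nxtₐ (s′ rowₐ 0 + c) ≡ nxt c
        n≡ = trans (f nxtₐ refl _) (trans (cong (λ x → s nxtₐ (x + c)) (f rowₐ refl 0)) (hn c c<A))
        E≡ : s′ Eₐ c ≡ D₀ c
        E≡ = trans (f Eₐ refl c) (e c c<A)

    tick-runs : ∀ s → s Aₐ 0 ≡ A → s mₐ 0 ≡ m → Runs (FOR vₐ (var mₐ) tickP) s (20 + m * (20 + 14)) (Ticked m (s Dₐ))
    tick-runs s hA′ hm′ = conseq
      (for vₐ (var mₐ) tickP m 14 (λ k → Ticked k (s Dₐ)) s refl (2 ≤! 9) (λ s′ f → trans (f mₐ refl 0) hm′) step
        ((λ _ ()) , (λ _ _ → refl) , (λ _ _ → refl)))
      λ s′ _ → proj₂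
      where
      step : ∀ k s′ → k < m → s′ vₐ 0 ≡ k → Same (FOR vₐ (var mₐ) tickP) s s′ → Ticked k (s Dₐ) s′ →
             Runs tickP s′ 14 (λ s″ → Ticked (suc k) (s Dₐ) (s″ [ vₐ , 0 ↦ suc k ]))
      step k s′ k<m refl f (dn , td , ot) = assign (
        (λ k′ lt → upd-elim (s′ Dₐ) (s′ Aₐ 0 + k) _ (A + k′) (_≡ s Dₐ (A + k′) ∸ 1)
          (λ q → cong (_∸ 1) (trans (cong (s′ Dₐ) q) (td k′ (≤-reflexive (inj q)))))
          (λ n → dn k′ (≤∧≢⇒< (≤-pred lt) (λ { refl → n (cong (_+ k) A≡) })))) ,
        (λ k′ lt → trans (upd-≢ (s′ Dₐ) (s′ Aₐ 0 + k) _ (λ q → <⇒≢ lt (inj q))) (td k′ (<⇒≤ lt))) ,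
        (λ i lt → trans (upd-≢ (s′ Dₐ) (s′ Aₐ 0 + k) _ (λ q → <⇒≱ lt (≤-trans (m≤m+n A k) (≤-reflexive (trans (cong (_+ k) (sym A≡)) q))))) (ot i lt)))
        where
        A≡ : s′ Aₐ 0 ≡ A
        A≡ = trans (f Aₐ refl 0) hA′
        inj : ∀ {k′} → s′ Aₐ 0 + k ≡ A + k′ → k ≡ k′
        inj q = +-cancelˡ-≡ A _ _ (trans (cong (_+ k) (sym A≡)) q)

    boundary-runs : Bounded D₀ → Runs boundaryBody s₀ (N ^ 17) (λ s′ → Marks (Boundary nxt D₀) new (s₀ reachₐ) (s′ reachₐ))
    boundary-runs bd = weaken (plus 16 (const 3 15) (plus 15 (raise 5 15 (loop 1 A≤N (const 10 1))) (plus 14 (raise 5 14 (loop 1 A≤N (const 31 1)))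
        (plus 13 (raise 5 13 (loop 1 m≤N (const 14 1))) (plus 12 (const 3 11) (raise 10 12 ≤-refl))))))
      (assign-seq (save-runs _ hA (λ _ → refl)
      ▹ λ s₁ f₁ sv → move-runs s₁ (trans (f₁ Aₐ refl 0) hA) (f₁ okₐ refl 0)
                       (λ c lt → trans (f₁ nxtₐ refl _) (trans (cong (λ x → s₀ nxtₐ (x + c)) (f₁ rowₐ refl 0)) (hnxt c lt))) sv
      ▹ λ s₂ f₂ (hi , mv , nw , ok , bad) → tick-runs s₂ (trans (f₂ Aₐ refl 0) (trans (f₁ Aₐ refl 0) hA)) (trans (f₂ mₐ refl 0) (trans (f₁ mₐ refl 0) hm))
      ▹ λ s₃ f₃ (dn , _ , ot) →
        let r≡ : ∀ a → s₃ reachₐ a ≡ s₀ reachₐ a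
            r≡ a = trans (f₃ reachₐ refl a) (trans (f₂ reachₐ refl a) (f₁ reachₐ refl a))
        in if-runs
        (λ ok≢0 → let
            bdry : Boundary nxt D₀ (s₃ Dₐ)
            bdry = ok (λ q → ok≢0 (trans (f₃ okₐ refl 0) q)) ,
                   (λ c c′ lt e → trans (ot c′ (nxt<A c c′ lt e)) (mv c c′ lt e)) ,
                   (λ c′ lt none → trans (ot c′ lt) (nw c′ lt none)) ,
                   (λ k lt → trans (dn k lt) (cong (_∸ 1) (hi (A + k) (m≤m+n A k))))
          in emit-marks {R = λ _ → ⊥} s₃
               (trans (f₃ curₐ refl 0) (trans (f₂ curₐ refl 0) (f₁ curₐ refl 0)) , trans (f₃ Nₐ refl 0) (trans (f₂ Nₐ refl 0) (f₁ Nₐ refl 0)) ,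
                trans (f₃ Kₐ refl 0) (trans (f₂ Kₐ refl 0) (f₁ Kₐ refl 0)) , λ i → trans (f₃ wtₐ refl i) (trans (f₂ wtₐ refl i) (f₁ wtₐ refl i)))
               (marks-none r≡ λ _ ()) (boundary-bounded _ _ bd bdry) bdry (λ _ ()) (λ D b → inj₂ (boundary-unique D₀ D _ b bdry)))
        (λ ok≡0 → weaken (m^n>0 N 10) (skip-runs (marks-none r≡ λ D (lv , _) →
          case bad (trans (sym (f₃ okₐ refl 0)) ok≡0) of λ { (c , lt , e , d) → lv c lt e d })))))

-- The sweep over the timeline

module Sweep (A m ℓ : ℕ) (room : Radix.Room A m ℓ)
             (R : ℕ) (fit nxt : ℕ → ℕ → ℕ)
             (fit≤ℓ : ∀ h c → h < R → c < A → fit h c ≤ ℓ)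
             (nxt<A : ∀ h c c′ → h < R → c < A → nxt h c ≡ 2 + c′ → c′ < A)
             (nxt-injective : ∀ h c₁ c₂ c′ → h < R → c₁ < A → c₂ < A → nxt h c₁ ≡ 2 + c′ → nxt h c₂ ≡ 2 + c′ → c₁ ≡ c₂) where

  open Radix A m ℓ
  open Room room
  open Machine room
  open Powers N 64≤N
  open Levels A m ℓ room
  open Transitions A m ℓ
  open Reachability A m ℓ fit nxt

  enc-zero : ∀ {D} j → (∀ i → i < j → D i ≡ 0) → enc D j ≡ 0
  enc-zero zero    z = refl
  enc-zero (suc j) z = cong₂ (λ x y → x + y * wt j) (enc-zero j λ i lt → z i (m<n⇒m<1+n lt)) (z j ≤-refl)

  relevel : ∀ {V s s′} → s′ curₐ 0 ≡ s curₐ 0 → (∀ a → s′ reachₐ a ≡ s reachₐ a) → Level V s → Level V s′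
  relevel {s = s} {s′} c r (mkLevel sound complete fresh) = mkLevel
    (λ z lt n → sound z lt λ q → n (trans (r _) (trans (cong (λ x → s reachₐ (x + z)) c) q)))
    (λ D bd v q → complete D bd v (trans (cong (λ x → s reachₐ (x + enc D K)) (sym c)) (trans (sym (r _)) q)))
    (λ a le → trans (r a) (fresh a (subst (λ x → x + N ≤ a) c le)))

  not-wt : ∀ body → writes body zₐ ≡ false → writes body curₐ ≡ false → writes body Kₐ ≡ false →
           writes body Nₐ ≡ false → writes body ℓₐ ≡ false → writes body wtₐ ≡ false →
           ∀ a → a ≡ zₐ ⊎ a ≡ curₐ ⊎ a ≡ Kₐ ⊎ a ≡ Nₐ ⊎ a ≡ ℓₐ ⊎ a ≡ wtₐ → writes body a ≡ false
  not-wt _ p _ _ _ _ _ _ (inj₁ refl) = p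
  not-wt _ _ p _ _ _ _ _ (inj₂ (inj₁ refl)) = p
  not-wt _ _ _ p _ _ _ _ (inj₂ (inj₂ (inj₁ refl))) = p
  not-wt _ _ _ _ p _ _ _ (inj₂ (inj₂ (inj₂ (inj₁ refl)))) = p
  not-wt _ _ _ _ _ p _ _ (inj₂ (inj₂ (inj₂ (inj₂ (inj₁ refl))))) = p
  not-wt _ _ _ _ _ _ p _ (inj₂ (inj₂ (inj₂ (inj₂ (inj₂ refl))))) = p

  module _ (s₀ : State) (W : Weights s₀) (hN : s₀ Nₐ 0 ≡ N) (hℓ : s₀ ℓₐ 0 ≡ ℓ) (hA : s₀ Aₐ 0 ≡ A) (hm : s₀ mₐ 0 ≡ m)
           (hR : s₀ rowsₐ 0 ≡ R)
           (hfit : ∀ h c → h < R → c < A → s₀ fitₐ (suc h * A + c) ≡ fit h c)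
           (hnxt : ∀ h c → h < R → c < A → s₀ nxtₐ (suc h * A + c) ≡ nxt h c)
           (cur₀ : s₀ curₐ 0 ≡ 0) (reach₀ : ∀ a → s₀ reachₐ a ≡ 0) where

    private
      rowP : Program
      rowP =
        FOR kₐ (var mₐ) (level startBody) ⨾
        level boundaryBody ⨾
        rowₐ ≔ var rowₐ ⊕ var Aₐ

    module B {h : ℕ} (h<R : h < R) =
      Bodies A m ℓ room (fit h) (nxt h) (λ c → fit≤ℓ h c h<R) (λ c c′ → nxt<A h c c′ h<R) (λ c c₁ c′ → nxt-injective h c c₁ c′ h<R)

    ready : ∀ {h s} (h<R : h < R) → s Kₐ 0 ≡ s₀ Kₐ 0 → (∀ i → s wtₐ i ≡ s₀ wtₐ i) → s Nₐ 0 ≡ s₀ Nₐ 0 → s Aₐ 0 ≡ s₀ Aₐ 0 →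
            s mₐ 0 ≡ s₀ mₐ 0 → (∀ a → s fitₐ a ≡ s₀ fitₐ a) → (∀ a → s nxtₐ a ≡ s₀ nxtₐ a) → s rowₐ 0 ≡ suc h * A → B.Ready h<R s
    ready {h} {s} h<R eK ew eN eA em ef en er = record
      { W = weights-keep {s₀} {s} eK ew W ; hN = trans eN hN ; hA = trans eA hA ; hm = trans em hm
      ; hfit = λ c lt → trans (ef _) (trans (cong (λ x → s₀ fitₐ (x + c)) er) (hfit h c h<R lt))
      ; hnxt = λ c lt → trans (en _) (trans (cong (λ x → s₀ nxtₐ (x + c)) er) (hnxt h c h<R lt)) }

    start-level : ∀ h k s → h < R → k < m → Same sweep s₀ s → s rowₐ 0 ≡ suc h * A → s kₐ 0 ≡ k → Level (Reach h k) s →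
                  Runs (level startBody) s (N ^ 23) (Level (Reach h (suc k)))
    start-level h k s h<R k<m f hr hk L = level-runs startBody (Start (fit h) k) s 7 (not-wt startBody refl refl refl refl refl refl)
        (λ D′ → Start-resp D′ k<m) (weights-keep {s₀} {s} (f Kₐ refl 0) (f wtₐ refl) W) (trans (f Nₐ refl 0) hN) (trans (f ℓₐ refl 0) hℓ)
        (λ s′ g bd → let both = same-trans {sweep} {levelLoop startBody} f g in subst (λ c → Runs startBody s′ _ (λ s″ → Marks _ (c + N) _ _)) (g curₐ refl 0)
          (B.start-runs h<R s′ (ready h<R (both Kₐ refl refl 0) (both wtₐ refl refl) (both Nₐ refl refl 0) (both Aₐ refl refl 0) (both mₐ refl refl 0)
             (both fitₐ refl refl) (both nxtₐ refl refl) (trans (g rowₐ refl 0) hr))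
             k k<m (trans (g kₐ refl 0) hk) bd))
        (Reach h k) L

    boundary-level : ∀ h s → h < R → Same sweep s₀ s → s rowₐ 0 ≡ suc h * A → Level (Reach h m) s →
                     Runs (level boundaryBody) s (N ^ 23) (Level (Reach (suc h) 0))
    boundary-level h s h<R f hr L = level-runs boundaryBody (Boundary (nxt h)) s 7 (not-wt boundaryBody refl refl refl refl refl refl)
        (λ D′ → Boundary-resp D′) (weights-keep {s₀} {s} (f Kₐ refl 0) (f wtₐ refl) W) (trans (f Nₐ refl 0) hN) (trans (f ℓₐ refl 0) hℓ)
        (λ s′ g bd → let both = same-trans {sweep} {levelLoop boundaryBody} f g in subst (λ c → Runs boundaryBody s′ _ (λ s″ → Marks _ (c + N) _ _)) (g curₐ refl 0)
          (B.boundary-runs h<R s′ (ready h<R (both Kₐ refl refl 0) (both wtₐ refl refl) (both Nₐ refl refl 0) (both Aₐ refl refl 0) (both mₐ refl refl 0)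
             (both fitₐ refl refl) (both nxtₐ refl refl) (trans (g rowₐ refl 0) hr))
             bd))
        (Reach h m) L

    sweep-runs : Runs sweep s₀ (27 + R * (20 + N ^ 28)) (Level (Reach R 0))
    sweep-runs = assign-seq (assign-seq (conseq
      (for hₐ (var rowsₐ) rowP R (N ^ 28) (λ h s → Level (Reach h 0) s × s rowₐ 0 ≡ suc h * A) _ refl (2 ≤! 9)
        (λ s f → trans (f rowsₐ refl 0) hR) step (first , trans hA (sym (+-identityʳ A))))
      λ _ _ (_ , L , _) → L))
      where
      -- Below K the only vector of `Reach 0 0` is zero; its code is 0, the cell marked by hand.
      first : Level (Reach 0 0) (((s₀ [ reachₐ , 0 ↦ 1 ]) [ rowₐ , 0 ↦ s₀ Aₐ 0 ]) [ hₐ , 0 ↦ 0 ])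
      first = mkLevel
        (λ z z<N n → (λ _ → 0) , (λ i _ → rad>0 i) , trans (enc-zero K λ _ _ → refl) (sym (z≡0 z n)) , (λ _ _ → refl))
        (λ D bd v → λ q → case trans (sym q) (upd-≡ (s₀ reachₐ) 0 1 (sym (cong₂ _+_ cur₀ (enc-zero K v)))) of λ ())
        (λ a le → trans (upd-≢ (s₀ reachₐ) 0 1 (λ { refl → <⇒≱ (≤-trans (1 ≤! 64) 64≤N) (≤-trans (m≤n+m N (s₀ curₐ 0)) le) })) (reach₀ a))
        where
        z≡0 : ∀ z → (s₀ reachₐ [ 0 ⇐ 1 ]) (s₀ curₐ 0 + z) ≢ 0 → z ≡ 0
        z≡0 zero    n = refl
        z≡0 (suc z) n = contradiction (trans (upd-≢ (s₀ reachₐ) 0 1 (λ q → 0≢1+n (trans q (+-suc (s₀ curₐ 0) z)))) (reach₀ _)) n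
      step : ∀ h s → h < R → s hₐ 0 ≡ h → Same (FOR hₐ (var rowsₐ) rowP) ((s₀ [ reachₐ , 0 ↦ 1 ]) [ rowₐ , 0 ↦ s₀ Aₐ 0 ]) s →
             Level (Reach h 0) s × s rowₐ 0 ≡ suc h * A →
             Runs rowP s (N ^ 28) (λ s′ → Level (Reach (suc h) 0) (s′ [ hₐ , 0 ↦ suc h ]) × (s′ [ hₐ , 0 ↦ suc h ]) rowₐ 0 ≡ suc (suc h) * A)
      step h s h<R _ f (L , hr) = weaken (plus 27 (raise 26 27 (loop 22 (≤-trans (m≤n+m m A) K≤N) ≤-refl)) (plus 26 (raise 23 26 ≤-refl) (const 7 25)))
        (for kₐ (var mₐ) (level startBody) m (N ^ 23) (λ k s′ → Level (Reach h k) s′) s refl (2 ≤! 9) (λ s′ f′ → trans (f′ mₐ refl 0) (trans (f₀ mₐ refl 0) hm))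
          (λ k s′ k<m hk f′ L′ → conseq (start-level h k s′ h<R k<m (λ b w i → trans (f′ b (inFor b w) i) (f₀ b w i)) (trans (f′ rowₐ refl 0) hr) hk L′) λ _ _ → relevel refl (λ _ → refl))
          (relevel refl (λ _ → refl) L)
        ▹ λ s₁ g (_ , L₁) → boundary-level h s₁ h<R (λ b w i → trans (g b (inFor b w) i) (f₀ b w i)) (trans (g rowₐ refl 0) hr) L₁
        ▹ λ s₂ g₂ L₂ → assign (relevel refl (λ _ → refl) L₂ ,
            trans (cong₂ _+_ (trans (g₂ rowₐ refl 0) (trans (g rowₐ refl 0) hr)) (trans (g₂ Aₐ refl 0) (trans (g Aₐ refl 0) (trans (f₀ Aₐ refl 0) hA)))) (+-comm (suc h * A) A)))
        where
        f₀ : Same sweep s₀ s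
        f₀ b w i = trans (f b (∨-falseʳ (rowₐ ≡ᵇ b) (∨-falseʳ (reachₐ ≡ᵇ b) w)) i)
                    (cells b (∨-falseˡ (reachₐ ≡ᵇ b) w) (∨-falseˡ (rowₐ ≡ᵇ b) (∨-falseʳ (reachₐ ≡ᵇ b) w)))
          where
          cells : ∀ b → (reachₐ ≡ᵇ b) ≡ false → (rowₐ ≡ᵇ b) ≡ false → ((s₀ [ reachₐ , 0 ↦ 1 ]) [ rowₐ , 0 ↦ s₀ Aₐ 0 ]) b i ≡ s₀ b i
          cells b p q rewrite q | p = refl
        inFor : ∀ b → writes sweep b ≡ false → writes (FOR kₐ (var mₐ) (level startBody)) b ≡ false
        inFor b w = ∨-falseˡ (writes (FOR kₐ (var mₐ) (level startBody)) b) (∨-falseˡ (writes rowP b)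
                      (∨-falseʳ (hₐ ≡ᵇ b) (∨-falseʳ (rowₐ ≡ᵇ b) (∨-falseʳ (reachₐ ≡ᵇ b) w))))

-- Reachable states and schedules

-- All that the semantics needs to know of the table. Virtual time runs along each window at unit
-- speed, so slot o of the window of j lies in row `vt j + o`, where `slot j o` is the position of
-- its bit. `vacant` traces every nonzero entry to a job.
record Layout (A R ℓ : ℕ) (vt w p : ℕ → ℕ) (slot fit nxt : ℕ → ℕ → ℕ) : Set where
  field
    inside   : ∀ j o → o < w j → vt j + o < R
    p≤w      : ∀ j → p j ≤ w j
    p>0      : ∀ j → 0 < w j → 0 < p j
    p≤ℓ      : ∀ j → p j ≤ ℓ
    slot<A   : ∀ j o → o < w j → slot j o < A
    slot-inj : ∀ i j o o′ → o < w i → o′ < w j → vt i + o ≡ vt j + o′ → slot i o ≡ slot j o′ → i ≡ j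
    fits     : ∀ j o → o < w j → p j ≤ w j ∸ o → fit (vt j + o) (slot j o) ≡ p j
    misfits  : ∀ j o → o < w j → w j ∸ o < p j → fit (vt j + o) (slot j o) ≡ 0
    stays    : ∀ j o → suc o < w j → nxt (vt j + o) (slot j o) ≡ 2 + slot j (suc o)
    leaves   : ∀ j o → suc o ≡ w j → nxt (vt j + o) (slot j o) ≡ 1
    vacant   : ∀ h c → h < R → c < A →
               (∃[ j ] ∃[ o ] (o < w j × vt j + o ≡ h × slot j o ≡ c)) ⊎ (fit h c ≡ 0 × nxt h c ≡ 0)

-- A schedule in virtual time. J is a parameter because a partial schedule covers just the jobs
-- started so far.
record Plan (m : ℕ) (vt w p : ℕ → ℕ) (J : ℕ → Set) (s μ : ℕ → ℕ) : Set where
  field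
    on    : ∀ j → J j → μ j < m
    from  : ∀ j → J j → vt j ≤ s j
    until : ∀ j → J j → s j + p j ≤ vt j + w j
    apart : ∀ i j → J i → J j → μ i ≡ μ j → i ≢ j → s i + p i ≤ s j ⊎ s j + p j ≤ s i

module Semantics {A m R ℓ : ℕ} {vt w p : ℕ → ℕ} {slot fit nxt : ℕ → ℕ → ℕ} (L : Layout A R ℓ vt w p slot fit nxt) where

  open Layout L
  open Radix A m ℓ
  open Transitions A m ℓ
  open Reachability A m ℓ fit nxt

  fit≤ℓ : ∀ h c → h < R → c < A → fit h c ≤ ℓ
  fit≤ℓ h c h<R c<A with vacant h c h<R c<A
  ... | inj₂ (z , _) = subst (_≤ ℓ) (sym z) z≤n
  ... | inj₁ (j , o , o<w , refl , refl) with p j ≤? w j ∸ o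
  ...   | yes le = subst (_≤ ℓ) (sym (fits j o o<w le)) (p≤ℓ j)
  ...   | no nl  = subst (_≤ ℓ) (sym (misfits j o o<w (≰⇒> nl))) z≤n

  nxt-source : ∀ h c c′ → h < R → c < A → nxt h c ≡ 2 + c′ →
               ∃[ j ] ∃[ o ] (suc o < w j × vt j + o ≡ h × slot j o ≡ c × slot j (suc o) ≡ c′)
  nxt-source h c c′ h<R c<A e with vacant h c h<R c<A
  ... | inj₂ (_ , z) = case trans (sym e) z of λ ()
  ... | inj₁ (j , o , o<w , refl , refl) with m≤n⇒m<n∨m≡n o<w
  ...   | inj₁ lt = j , o , lt , refl , refl , +-cancelˡ-≡ 2 _ _ (trans (sym (stays j o lt)) e)
  ...   | inj₂ q  = case trans (sym e) (leaves j o q) of λ ()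

  nxt<A : ∀ h c c′ → h < R → c < A → nxt h c ≡ 2 + c′ → c′ < A
  nxt<A h c c′ h<R c<A e with nxt-source h c c′ h<R c<A e
  ... | j , o , lt , _ , _ , refl = slot<A j (suc o) lt

  nxt-injective : ∀ h c₁ c₂ c′ → h < R → c₁ < A → c₂ < A → nxt h c₁ ≡ 2 + c′ → nxt h c₂ ≡ 2 + c′ → c₁ ≡ c₂
  nxt-injective h c₁ c₂ c′ h<R l₁ l₂ e₁ e₂
    with nxt-source h c₁ c′ h<R l₁ e₁ | nxt-source h c₂ c′ h<R l₂ e₂
  ... | j , o , lt , refl , refl , q | j′ , o′ , lt′ , q₁ , refl , q₂
    with slot-inj j j′ (suc o) (suc o′) lt lt′ (trans (+-suc (vt j) o) (trans (cong suc (sym q₁)) (sym (+-suc (vt j′) o′)))) (trans q (sym q₂))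
  ... | refl = cong (slot j) (sym (+-cancelˡ-≡ (vt j) _ _ q₁))

  slot<K : ∀ j o → o < w j → slot j o < K
  slot<K j o lt = ≤-trans (slot<A j o lt) (m≤m+n A m)

  slot≢machine : ∀ {c k} → c < A → c ≢ A + k
  slot≢machine {k = k} c<A q = <⇒≱ c<A (≤-trans (m≤m+n A k) (≤-reflexive (sym q)))

  -- By `slot-inj`, a bit moving onto the entry position of j would belong to j itself, which has no
  -- earlier slot. So an entering job has bit 0.
  entry-unreached : ∀ h j c → 0 < w j → vt j ≡ suc h → h < R → c < A → nxt h c ≢ 2 + slot j 0
  entry-unreached h j c w>0 v h<R c<A e with nxt-source h c (slot j 0) h<R c<A e
  ... | i , o , lt , q , _ , q′ with slot-inj i j (suc o) 0 lt w>0 (trans (+-suc (vt i) o) (trans (cong suc q) (trans (sym v) (sym (+-identityʳ (vt j)))))) q′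
  ... | refl = 1+n≰n {h} (≤-trans (≤-reflexive (sym v)) (≤-trans (m≤m+n (vt j) o) (≤-reflexive q)))

  -- The jobs j with st j ≢ 0 have been started.
  record Partial (h : ℕ) (D : ℕ → ℕ) : Set where
    field
      st s μ : ℕ → ℕ
      plan   : Plan m vt w p (λ j → st j ≢ 0) s μ
      bits   : ∀ j o → o < w j → vt j + o ≡ h → D (slot j o) ≡ st j
      -- An upper bound on the completion time is enough: a machine whose digit is 0 is free from
      -- row h on.
      busy   : ∀ j → st j ≢ 0 → s j + p j ≤ h + D (A + μ j)
      future : ∀ j → h < vt j → st j ≡ 0
      gone   : ∀ j → 0 < w j → vt j + w j ≤ h → st j ≢ 0

  partial-init : ∀ D → (∀ i → i < K → D i ≡ 0) → Partial 0 D
  partial-init D z = record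
    { st = λ _ → 0 ; s = λ _ → 0 ; μ = λ _ → 0
    ; plan = record { on = λ _ n → ⊥-elim (n refl) ; from = λ _ n → ⊥-elim (n refl) ; until = λ _ n → ⊥-elim (n refl) ; apart = λ _ _ n → ⊥-elim (n refl) }
    ; bits = λ j o lt _ → z _ (slot<K j o lt)
    ; busy = λ _ n → ⊥-elim (n refl)
    ; future = λ _ _ → refl
    ; gone = λ j w>0 le → ⊥-elim (<⇒≱ w>0 (≤-trans (m≤n+m (w j) (vt j)) le))
    }

  partial-start : ∀ {h k D D′} → h < R → k < m → Start (fit h) k D D′ → Partial h D → Partial h D′
  partial-start h<R k<m (inj₁ e) P = record
    { Partial P
    ; bits = λ j o lt q → trans (e _ (slot<K j o lt)) (bits j o lt q)
    ; busy = λ j n → subst (λ x → s j + p j ≤ _ + x) (sym (e _ (+-monoʳ-< A (Plan.on plan j n)))) (busy j n)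
    }
    where open Partial P
  partial-start {h} {k} {D} {D′} h<R k<m (inj₂ (c , c<A , Dc , Dk , f , D′c , D′k , rest)) P
    with vacant h c h<R c<A
  ... | inj₂ (z , _) = ⊥-elim (f z)
  ... | inj₁ (j , o , o<w , refl , refl) with p j ≤? w j ∸ o
  ...   | no nl  = ⊥-elim (f (misfits j o o<w (≰⇒> nl)))
  ...   | yes le = record
    { st = st [ j ⇐ 1 ] ; s = s [ j ⇐ h ] ; μ = μ [ j ⇐ k ]
    ; plan = record
      { on = λ i n → upd-elim μ j k i (_< m) (λ _ → k<m) (λ ne → on i (old i ne n))
      ; from = λ i n → upd-elim s j h i (vt i ≤_) (λ { refl → m≤m+n (vt j) o }) (λ ne → from i (old i ne n))
      ; until = λ i n → upd-elim s j h i (λ x → x + p i ≤ vt i + w i)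
          (λ { refl → ≤-trans (≤-reflexive (+-assoc (vt j) o (p j))) (+-monoʳ-≤ (vt j) (≤-trans (+-monoʳ-≤ o le) (≤-reflexive (m+[n∸m]≡n (<⇒≤ o<w))))) })
          (λ ne → until i (old i ne n))
      ; apart = apart′
      }
    ; bits = λ i o′ lt q → upd-elim st j 1 i (D′ (slot i o′) ≡_)
        (λ { refl → trans (cong (λ x → D′ (slot j x)) (+-cancelˡ-≡ (vt j) _ _ q)) D′c })
        (λ ne → trans (rest _ (slot<K i o′ lt) (λ e → ne (sym (slot-inj i j o′ o lt o<w q e))) (slot≢machine (slot<A i o′ lt))) (bits i o′ lt q))
    ; busy = λ i n → busy′ i n (i ≟ j)
    ; future = λ i lt → trans (upd-≢ st j 1 (λ { refl → <⇒≱ lt (m≤m+n (vt j) o) })) (future i lt)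
    ; gone = λ i w>0 le → upd-elim st j 1 i (_≢ 0) (λ _ ()) (λ _ → gone i w>0 le)
    }
    where
    open Partial P
    open Plan plan
    old : ∀ i → j ≢ i → (st [ j ⇐ 1 ]) i ≢ 0 → st i ≢ 0
    old i ne n z = n (trans (upd-≢ st j 1 ne) z)
    free : ∀ i → st i ≢ 0 → μ i ≡ k → s i + p i ≤ h
    free i n refl = ≤-trans (busy i n) (≤-reflexive (trans (cong (h +_) Dk) (+-identityʳ h)))
    apart′ : ∀ a b → (st [ j ⇐ 1 ]) a ≢ 0 → (st [ j ⇐ 1 ]) b ≢ 0 → (μ [ j ⇐ k ]) a ≡ (μ [ j ⇐ k ]) b → a ≢ b →
             (s [ j ⇐ h ]) a + p a ≤ (s [ j ⇐ h ]) b ⊎ (s [ j ⇐ h ]) b + p b ≤ (s [ j ⇐ h ]) a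
    apart′ a b na nb e ne with j ≟ a | j ≟ b
    ... | yes refl | yes refl = ⊥-elim (ne refl)
    ... | yes refl | no q rewrite upd-≡ s j h {j} refl | upd-≡ μ j k {j} refl | upd-≢ s j h q | upd-≢ μ j k q = inj₂ (free b (old b q nb) (sym e))
    ... | no q | yes refl rewrite upd-≡ s j h {j} refl | upd-≡ μ j k {j} refl | upd-≢ s j h q | upd-≢ μ j k q = inj₁ (free a (old a q na) e)
    ... | no q | no q′ rewrite upd-≢ s j h q | upd-≢ μ j k q | upd-≢ s j h q′ | upd-≢ μ j k q′ = apart a b (old a q na) (old b q′ nb) e ne
    busy′ : ∀ i → (st [ j ⇐ 1 ]) i ≢ 0 → Dec (i ≡ j) → (s [ j ⇐ h ]) i + p i ≤ h + D′ (A + (μ [ j ⇐ k ]) i)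
    busy′ i n (yes refl) rewrite upd-≡ s j h {j} refl | upd-≡ μ j k {j} refl = ≤-reflexive (cong (h +_) (sym (trans D′k (fits j o o<w le))))
    busy′ i n (no ne) rewrite upd-≢ s j h {i} (ne ∘ sym) | upd-≢ μ j k {i} (ne ∘ sym) with μ i ≟ k
    ... | yes e = ≤-trans (free i (old i (ne ∘ sym) n) e) (m≤m+n h _)
    ... | no q  = subst (λ x → s i + p i ≤ h + x)
                    (sym (rest _ (+-monoʳ-< A (on i (old i (ne ∘ sym) n))) (λ e → slot≢machine (slot<A j o o<w) (sym e)) (λ e → q (+-cancelˡ-≡ A _ _ e))))
                    (busy i (old i (ne ∘ sym) n))

  partial-boundary : ∀ {h D D′} → h < R → Boundary (nxt h) D D′ → Partial h D → Partial (suc h) D′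
  partial-boundary {h} {D} {D′} h<R (lv , mv , nw , dc) P = record
    { Partial P
    ; bits = bits′
    ; busy = λ j n → ≤-trans (busy j n) (≤-trans (tick (D (A + μ j))) (≤-reflexive (cong (suc h +_) (sym (dc (μ j) (Plan.on plan j n))))))
    ; future = λ j lt → future j (<⇒≤ lt)
    ; gone = λ j w>0 le → case m≤n⇒m<n∨m≡n le of λ where
        (inj₁ lt) → gone j w>0 (≤-pred lt)
        (inj₂ e)  → last j w>0 e
    }
    where
    open Partial P
    tick : ∀ x → h + x ≤ suc h + (x ∸ 1)
    tick zero    = n≤1+n (h + 0)
    tick (suc x) = ≤-reflexive (+-suc h x)
    bits′ : ∀ j o → o < w j → vt j + o ≡ suc h → D′ (slot j o) ≡ st j
    bits′ j zero lt e = trans (nw _ (slot<A j 0 lt) (λ c c<A → entry-unreached h j c lt (trans (sym (+-identityʳ (vt j))) e) h<R c<A))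
                          (sym (future j (≤-reflexive (sym (trans (sym (+-identityʳ (vt j))) e)))))
    bits′ j (suc o) lt e with suc-injective (trans (sym (+-suc (vt j) o)) e)
    ... | refl = trans (mv (slot j o) _ (slot<A j o (<⇒≤ lt)) (stays j o lt)) (bits j o (<⇒≤ lt) refl)
    last : ∀ j → 0 < w j → vt j + w j ≡ suc h → st j ≢ 0
    last j w>0 e z = lv (slot j o) (slot<A j o lt) (subst (λ x → nxt x (slot j o) ≡ 1) at (leaves j o so)) (trans (bits j o lt at) z)
      where
      o = w j ∸ 1
      so : suc o ≡ w j
      so = m+[n∸m]≡n w>0
      lt : o < w j
      lt = ≤-reflexive so
      at : vt j + o ≡ h
      at = suc-injective (trans (sym (+-suc (vt j) o)) (trans (cong (vt j +_) so) e))

  reach-partial : ∀ h k D → h ≤ R → k ≤ m → (k ≢ 0 → h < R) → Reach h k D → Partial h D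
  reach-partial zero    zero    D _  _ _ r = partial-init D r
  reach-partial h       (suc k) D le k<m lt (D₀ , _ , r , st) = partial-start (lt λ ()) k<m st (reach-partial h k D₀ le (<⇒≤ k<m) (λ _ → lt λ ()) r)
  reach-partial (suc h) zero    D le _ _ (D₀ , _ , r , bd) = partial-boundary le bd (reach-partial h m D₀ (<⇒≤ le) ≤-refl (λ _ → le) r)

  reach⇒plan : ∀ D → Reach R 0 D → ∃[ s ] ∃[ μ ] Plan m vt w p (λ j → 0 < w j) s μ
  reach⇒plan D r = s , μ , record
    { on = λ j z → on j (all j z) ; from = λ j z → from j (all j z) ; until = λ j z → until j (all j z)
    ; apart = λ i j z z′ → apart i j (all i z) (all j z′) }
    where
    open Partial (reach-partial R 0 D ≤-refl z≤n (λ n → ⊥-elim (n refl)) r)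
    open Plan plan
    all : ∀ j → 0 < w j → st j ≢ 0
    all j z = gone j z (subst (_≤ R) (trans (sym (+-suc (vt j) (w j ∸ 1))) (cong (vt j +_) (m+[n∸m]≡n z)))
      (inside j (w j ∸ 1) (≤-reflexive (m+[n∸m]≡n z))))

  module Complete (n : ℕ) (w>0⇒<n : ∀ j → 0 < w j → j < n) (1≤ℓ : 1 ≤ ℓ) (s μ : ℕ → ℕ)
                  (plan : Plan m vt w p (λ j → 0 < w j) s μ) where
    open Plan plan

    -- The job is started before step (h, k) in the order in which the sweep treats pairs of row and
    -- machine.
    Began : ℕ → ℕ → ℕ → Set
    Began h k j = s j < h ⊎ (s j ≡ h × μ j < k)

    -- The run of the dynamic program that a given plan dictates. Bits are determined exactly and a
    -- nonzero machine digit is the exact remaining time of a job of the plan, so no digit blocks a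
    -- start of the plan, and the last vector turns out to be zero.
    record Follows (h k : ℕ) (D : ℕ → ℕ) : Set where
      field
        bounded : Bounded D
        reached : Reach h k D
        bits    : ∀ j o → o < w j → vt j + o ≡ h → (Began h k j × D (slot j o) ≡ 1) ⊎ (¬ Began h k j × D (slot j o) ≡ 0)
        busy    : ∀ k′ → k′ < m → D (A + k′) ≡ 0 ⊎ (∃[ j ] (0 < w j × Began h k j × μ j ≡ k′ × s j + p j ≡ h + D (A + k′)))
        empty   : ∀ c → c < A → (∀ j o → o < w j → vt j + o ≡ h → slot j o ≢ c) → D c ≡ 0

    follows-init : Follows 0 0 (λ _ → 0)
    follows-init = record
      { bounded = λ i _ → rad>0 i
      ; reached = λ _ _ → refl
      ; bits = λ j o _ _ → inj₂ ((λ { (inj₁ ()) ; (inj₂ (_ , ())) }) , refl)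
      ; busy = λ _ _ → inj₁ refl
      ; empty = λ _ _ _ → refl
      }

    began-suc : ∀ {h k j} → Began h k j → Began h (suc k) j
    began-suc (inj₁ x) = inj₁ x
    began-suc (inj₂ (e , l)) = inj₂ (e , m<n⇒m<1+n l)

    began-pred : ∀ {h k j} → ¬ (s j ≡ h × μ j ≡ k) → Began h (suc k) j → Began h k j
    began-pred ne (inj₁ x) = inj₁ x
    began-pred ne (inj₂ (e , l)) = inj₂ (e , ≤∧≢⇒< (≤-pred l) (λ q → ne (e , q)))

    follows-start : ∀ {h k D} → h < R → k < m → Follows h k D → ∃ (Follows h (suc k))
    follows-start {h} {k} {D} h<R k<m F
      with anyUpTo? (λ j → (0 <? w j) ×-dec (s j ≟ h) ×-dec (μ j ≟ k)) n
    ... | no none = D , record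
      { bounded = bounded
      ; reached = D , bounded , reached , inj₁ λ _ _ → refl
      ; bits = λ j o lt e → case bits j o lt e of λ where
          (inj₁ (b , x)) → inj₁ (began-suc b , x)
          (inj₂ (b , x)) → inj₂ ((λ b′ → b (began-pred (new j (≤-trans (s≤s z≤n) lt)) b′)) , x)
      ; busy = λ k′ l → case busy k′ l of λ where
          (inj₁ z) → inj₁ z
          (inj₂ (j , z , b , r)) → inj₂ (j , z , began-suc b , r)
      ; empty = empty
      }
      where
      open Follows F
      new : ∀ j → 0 < w j → ¬ (s j ≡ h × μ j ≡ k)
      new j z (e , e′) = none (j , w>0⇒<n j z , z , e , e′)
    ... | yes (j , _ , z , refl , refl) = D′ , record
      { bounded = λ i lt → upd-elim (D [ c ⇐ 1 ]) (A + k) (p j) i (_< rad i)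
          (λ { refl → subst (p j <_) (sym (rad-machine (m≤m+n A k))) (s≤s (p≤ℓ j)) })
          (λ _ → upd-elim D c 1 i (_< rad i) (λ { refl → subst (1 <_) (sym (rad-bit c<A)) ≤-refl }) (λ _ → bounded i lt))
      ; reached = D , bounded , reached , inj₂ (c , c<A , Dc≡0 , Dk≡0 , (λ q → <⇒≢ (p>0 j z) (sym (trans (sym fit≡) q))) ,
          D′c , trans D′k (sym fit≡) , λ i _ n n′ → D′else i n n′)
      ; bits = λ i o′ lt e → bits′ i o′ lt e (i ≟ j)
      ; busy = λ k′ l → busy′ k′ l (k′ ≟ k)
      ; empty = λ c′ lt none → trans (D′else c′ (λ { refl → none j o o<w at refl }) (slot≢machine lt)) (empty c′ lt none)
      }
      where
      open Follows F
      o = h ∸ vt j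
      at : vt j + o ≡ h
      at = m+[n∸m]≡n (from j z)
      o+p≤w : o + p j ≤ w j
      o+p≤w = +-cancelˡ-≤ (vt j) _ _ (≤-trans (≤-reflexive (trans (sym (+-assoc (vt j) o (p j))) (cong (_+ p j) at))) (until j z))
      o<w : o < w j
      o<w = ≤-trans (≤-trans (≤-reflexive (+-comm 1 o)) (+-monoʳ-≤ o (p>0 j z))) o+p≤w
      c = slot j o
      c<A = slot<A j o o<w
      fit≡ : fit h c ≡ p j
      fit≡ = subst (λ x → fit x c ≡ p j) at (fits j o o<w (m+n≤o⇒m≤o∸n (p j) (≤-trans (≤-reflexive (+-comm (p j) o)) o+p≤w)))
      unbegun : ¬ Began h k j
      unbegun (inj₁ x) = <-irrefl refl x
      unbegun (inj₂ (_ , x)) = <-irrefl refl x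
      Dc≡0 : D c ≡ 0
      Dc≡0 = case bits j o o<w at of λ where
        (inj₁ (b , _)) → ⊥-elim (unbegun b)
        (inj₂ (_ , x)) → x
      -- A nonzero digit would be the remaining time of a job still running at h on the machine of
      -- j, which `apart` excludes.
      Dk≡0 : D (A + k) ≡ 0
      Dk≡0 = case busy k k<m of λ where
        (inj₁ x) → x
        (inj₂ (i , zi , b , e , q)) → case b of λ where
          (inj₂ (_ , lt)) → ⊥-elim (<-irrefl e lt)
          (inj₁ lt) → case apart i j zi z e (λ { refl → <-irrefl refl lt }) of λ where
            (inj₁ le) → n≤0⇒n≡0 (+-cancelˡ-≤ h _ _ (≤-trans (≤-reflexive (sym q)) (≤-trans le (≤-reflexive (sym (+-identityʳ h))))))
            (inj₂ le) → ⊥-elim (<⇒≱ lt (≤-trans (m≤m+n h (p j)) le))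
      D′ = (D [ c ⇐ 1 ]) [ A + k ⇐ p j ]
      D′k : D′ (A + k) ≡ p j
      D′k = upd-≡ (D [ c ⇐ 1 ]) (A + k) (p j) refl
      D′c : D′ c ≡ 1
      D′c = trans (upd-≢ (D [ c ⇐ 1 ]) (A + k) (p j) (λ q → slot≢machine c<A (sym q))) (upd-≡ D c 1 refl)
      D′else : ∀ i → i ≢ c → i ≢ A + k → D′ i ≡ D i
      D′else i n n′ = trans (upd-≢ (D [ c ⇐ 1 ]) (A + k) (p j) (n′ ∘ sym)) (upd-≢ D c 1 (n ∘ sym))
      -- Two jobs of positive length cannot start together on one machine, so no job other than j
      -- changes its status in this step.
      alone : ∀ i → 0 < w i → i ≢ j → ¬ (s i ≡ h × μ i ≡ k)
      alone i zi ne (e , e′) = case apart i j zi z e′ ne of λ where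
        (inj₁ le) → <⇒≱ (p>0 i zi) (+-cancelˡ-≤ h _ _ (≤-trans (≤-reflexive (cong (_+ p i) (sym e))) (≤-trans le (≤-reflexive (sym (+-identityʳ h))))))
        (inj₂ le) → <⇒≱ (p>0 j z) (+-cancelˡ-≤ h _ _ (≤-trans le (≤-reflexive (trans e (sym (+-identityʳ h))))))
      bits′ : ∀ i o′ → o′ < w i → vt i + o′ ≡ h → Dec (i ≡ j) →
              (Began h (suc k) i × D′ (slot i o′) ≡ 1) ⊎ (¬ Began h (suc k) i × D′ (slot i o′) ≡ 0)
      bits′ i o′ lt e (yes refl) = inj₁ (inj₂ (refl , ≤-refl) , trans (cong (λ x → D′ (slot j x)) (+-cancelˡ-≡ (vt j) _ _ (trans e (sym at)))) D′c)
      bits′ i o′ lt e (no ne) = case bits i o′ lt e of λ where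
          (inj₁ (b , x)) → inj₁ (began-suc b , trans same x)
          (inj₂ (b , x)) → inj₂ ((λ b′ → b (began-pred (alone i (≤-trans (s≤s z≤n) lt) ne) b′)) , trans same x)
        where
        same : D′ (slot i o′) ≡ D (slot i o′)
        same = D′else _ (λ q → ne (slot-inj i j o′ o lt o<w (trans e (sym at)) q)) (slot≢machine (slot<A i o′ lt))
      busy′ : ∀ k′ → k′ < m → Dec (k′ ≡ k) →
              D′ (A + k′) ≡ 0 ⊎ (∃[ i ] (0 < w i × Began h (suc k) i × μ i ≡ k′ × s i + p i ≡ h + D′ (A + k′)))
      busy′ k′ l (yes refl) = inj₂ (j , z , inj₂ (refl , ≤-refl) , refl , cong (h +_) (sym D′k))
      busy′ k′ l (no ne) = case busy k′ l of λ where
          (inj₁ x) → inj₁ (trans same x)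
          (inj₂ (i , zi , b , e , q)) → inj₂ (i , zi , began-suc b , e , trans q (cong (h +_) (sym same)))
        where
        same : D′ (A + k′) ≡ D (A + k′)
        same = D′else _ (λ q → slot≢machine c<A (sym q)) (λ q → ne (+-cancelˡ-≡ A _ _ q))

    -- The successor demanded by `Boundary`, as an explicit function: the position from which a bit
    -- comes is found by bounded search.
    shift : ℕ → (ℕ → ℕ) → ℕ → ℕ
    shift h D i with i <? A
    ... | no _ = D i ∸ 1
    ... | yes _ with anyUpTo? (λ c → nxt h c ≟ 2 + i) A
    ...   | yes (c , _) = D c
    ...   | no _        = 0

    shift-machine : ∀ h D k → shift h D (A + k) ≡ D (A + k) ∸ 1
    shift-machine h D k with A + k <? A
    ... | yes lt = contradiction (m≤m+n A k) (<⇒≱ lt)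
    ... | no _   = refl

    shift-moved : ∀ h D c c′ → h < R → c < A → nxt h c ≡ 2 + c′ → shift h D c′ ≡ D c
    shift-moved h D c c′ h<R c<A e with c′ <? A
    ... | no ge = contradiction (nxt<A h c c′ h<R c<A e) ge
    ... | yes _ with anyUpTo? (λ c → nxt h c ≟ 2 + c′) A
    ...   | yes (c₁ , l , e₁) = cong D (nxt-injective h c₁ c c′ h<R l c<A e₁ e)
    ...   | no none = contradiction (c , c<A , e) none

    shift-new : ∀ h D c′ → c′ < A → (∀ c → c < A → nxt h c ≢ 2 + c′) → shift h D c′ ≡ 0
    shift-new h D c′ lt none with c′ <? A
    ... | no ge = contradiction lt ge
    ... | yes _ with anyUpTo? (λ c → nxt h c ≟ 2 + c′) A
    ...   | yes (c , l , e) = contradiction e (none c l)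
    ...   | no _ = refl

    follows-boundary : ∀ {h D} → h < R → Follows h m D → ∃ (Follows (suc h) 0)
    follows-boundary {h} {D} h<R F = D′ , record
      { bounded = boundary-bounded D D′ bounded bdry
      ; reached = D , bounded , reached , bdry
      ; bits = bits′
      ; busy = busy′
      ; empty = λ c′ lt none → shift-new h D c′ lt λ c c<A e → case nxt-source h c c′ h<R c<A e of λ where
          (j , o , l , q , _ , q′) → none j (suc o) l (trans (+-suc (vt j) o) (cong suc q)) q′
      }
      where
      open Follows F
      D′ = shift h D
      begun : ∀ j → 0 < w j → s j ≤ h → Began h m j
      begun j z le = case m≤n⇒m<n∨m≡n le of λ where
        (inj₁ lt) → inj₁ lt
        (inj₂ e) → inj₂ (e , on j z)
      begun⁻¹ : ∀ {j} → Began h m j → s j ≤ h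
      begun⁻¹ (inj₁ lt) = <⇒≤ lt
      begun⁻¹ (inj₂ (e , _)) = ≤-reflexive e
      -- On the last slot of its window a job has begun, because the window ends at h + 1 and the
      -- job takes at least one unit.
      leave : ∀ c → c < A → nxt h c ≡ 1 → D c ≢ 0
      leave c c<A e D≡0 = case vacant h c h<R c<A of λ where
        (inj₂ (_ , q)) → case trans (sym q) e of λ ()
        (inj₁ (j , o , lt , refl , refl)) → case m≤n⇒m<n∨m≡n lt of λ where
          (inj₁ l) → case trans (sym (stays j o l)) e of λ ()
          (inj₂ q) → case bits j o lt refl of λ where
            (inj₁ (_ , x)) → case trans (sym x) D≡0 of λ ()
            (inj₂ (b , _)) → let z = ≤-trans (s≤s z≤n) lt in b (begun j z (≤-pred (begin
              suc (s j)          ≡⟨ +-comm 1 (s j) ⟩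
              s j + 1            ≤⟨ +-monoʳ-≤ (s j) (p>0 j z) ⟩
              s j + p j          ≤⟨ until j z ⟩
              vt j + w j         ≡⟨ cong (vt j +_) q ⟨
              vt j + suc o       ≡⟨ +-suc (vt j) o ⟩
              suc (vt j + o)     ∎)))
       where open ≤-Reasoning
      bdry : Boundary (nxt h) D D′
      bdry = leave , (λ c c′ lt e → shift-moved h D c c′ h<R lt e) , (λ c′ lt none → shift-new h D c′ lt none) , (λ k _ → shift-machine h D k)
      bits′ : ∀ j o → o < w j → vt j + o ≡ suc h → (Began (suc h) 0 j × D′ (slot j o) ≡ 1) ⊎ (¬ Began (suc h) 0 j × D′ (slot j o) ≡ 0)
      bits′ j zero lt e = inj₂ ((λ { (inj₁ l) → <⇒≱ l (≤-trans (≤-reflexive (trans (sym e) (+-identityʳ (vt j)))) (from j lt)) ; (inj₂ (_ , ())) }) ,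
        shift-new h D _ (slot<A j 0 lt) (λ c c<A → entry-unreached h j c lt (trans (sym (+-identityʳ (vt j))) e) h<R c<A))
      bits′ j (suc o) lt e with suc-injective (trans (sym (+-suc (vt j) o)) e)
      ... | refl = case bits j o (<⇒≤ lt) refl of λ where
          (inj₁ (b , x)) → inj₁ (inj₁ (s≤s (begun⁻¹ b)) , trans moved x)
          (inj₂ (b , x)) → inj₂ ((λ { (inj₁ l) → b (begun j (≤-trans (s≤s z≤n) lt) (≤-pred l)) ; (inj₂ (_ , ())) }) , trans moved x)
        where
        moved : D′ (slot j (suc o)) ≡ D (slot j o)
        moved = shift-moved h D (slot j o) _ h<R (slot<A j o (<⇒≤ lt)) (stays j o lt)
      busy′ : ∀ k → k < m → D′ (A + k) ≡ 0 ⊎ (∃[ j ] (0 < w j × Began (suc h) 0 j × μ j ≡ k × s j + p j ≡ suc h + D′ (A + k)))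
      busy′ k l with busy k l
      ... | inj₁ x = inj₁ (trans (shift-machine h D k) (cong (_∸ 1) x))
      ... | inj₂ (j , z , b , e , q) = from-digit (D (A + k)) refl
        where
        from-digit : ∀ x → D (A + k) ≡ x → D′ (A + k) ≡ 0 ⊎ (∃[ j ] (0 < w j × Began (suc h) 0 j × μ j ≡ k × s j + p j ≡ suc h + D′ (A + k)))
        from-digit zero    x = inj₁ (trans (shift-machine h D k) (cong (_∸ 1) x))
        from-digit (suc v) x = inj₂ (j , z , inj₁ (s≤s (begun⁻¹ b)) , e ,
          trans q (trans (cong (h +_) x) (trans (+-suc h v) (cong (suc h +_) (sym (trans (shift-machine h D k) (cong (_∸ 1) x)))))))

    follows : ∀ h k → h ≤ R → k ≤ m → (k ≢ 0 → h < R) → ∃ (Follows h k)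
    follows h       (suc k) le k<m lt = follows-start (lt λ ()) k<m (proj₂ (follows h k le (<⇒≤ k<m) (λ _ → lt λ ())))
    follows zero    zero    _  _   _  = _ , follows-init
    follows (suc h) zero    le _   _  = follows-boundary le (proj₂ (follows h m (<⇒≤ le) ≤-refl (λ _ → le)))

    -- The program tests only the cell of code 0 at the end. This suffices: after the last row no
    -- job is present, and all completion times are at most R, so every digit is 0.
    plan⇒reach : ∃[ D ] (Bounded D × Reach R 0 D × (∀ i → i < K → D i ≡ 0))
    plan⇒reach with follows R 0 ≤-refl z≤n (λ n → ⊥-elim (n refl))
    ... | D , F = D , bounded , reached , zeros
      where
      open Follows F
      zeros : ∀ i → i < K → D i ≡ 0
      zeros i i<K with i <? A
      ... | yes lt = empty i lt λ j o l e _ → <⇒≢ (inside j o l) e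
      ... | no ge with busy (i ∸ A) (+-cancelˡ-< A _ _ (subst (_< K) (sym (m+[n∸m]≡n (≮⇒≥ ge))) i<K))
      ...   | inj₁ x = trans (cong D (sym (m+[n∸m]≡n (≮⇒≥ ge)))) x
      ...   | inj₂ (j , z , _ , _ , q) = trans (cong D (sym (m+[n∸m]≡n (≮⇒≥ ge)))) (n≤0⇒n≡0 (+-cancelˡ-≤ R _ _ (begin
        R + D (A + (i ∸ A))       ≡⟨ q ⟨
        s j + p j                 ≤⟨ until j z ⟩
        vt j + w j                ≡⟨ cong (vt j +_) (m+[n∸m]≡n z) ⟨
        vt j + suc (w j ∸ 1)      ≡⟨ +-suc (vt j) (w j ∸ 1) ⟩
        suc (vt j + (w j ∸ 1))    ≤⟨ inside j (w j ∸ 1) (≤-reflexive (m+[n∸m]≡n z)) ⟩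
        R                         ≡⟨ +-identityʳ R ⟨
        R + 0                     ∎)))
        where open ≤-Reasoning

-- The jobs whose windows contain a time slot

-- Indicator of the interval (a, a + o]. With times shifted by one, these are the cells of the o
-- slots from a on.
ind : ℕ → ℕ → ℕ → ℕ
ind a o X with (a <? X) ×-dec (X ≤? a + o)
... | yes _ = 1
... | no _  = 0

ind-yes : ∀ {a o X} → a < X → X ≤ a + o → ind a o X ≡ 1
ind-yes {a} {o} {X} l r with (a <? X) ×-dec (X ≤? a + o)
... | yes _ = refl
... | no n  = contradiction (l , r) n

ind-no : ∀ {a o X} → ¬ (a < X × X ≤ a + o) → ind a o X ≡ 0
ind-no {a} {o} {X} n with (a <? X) ×-dec (X ≤? a + o)
... | yes y = contradiction y n
... | no _  = refl

ind-zero : ∀ a X → ind a 0 X ≡ 0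
ind-zero a X = ind-no {a} {0} {X} λ (l , r) → <⇒≱ l (≤-trans r (≤-reflexive (+-identityʳ a)))

ind-suc-≡ : ∀ a o → ind a (suc o) (suc (a + o)) ≡ suc (ind a o (suc (a + o)))
ind-suc-≡ a o = trans (ind-yes {a} {suc o} (s≤s (m≤m+n a o)) (≤-reflexive (sym (+-suc a o))))
                      (cong suc (sym (ind-no {a} {o} λ (_ , r) → 1+n≰n r)))

ind-suc-≢ : ∀ a o X → X ≢ suc (a + o) → ind a (suc o) X ≡ ind a o X
ind-suc-≢ a o X ne with (a <? X) ×-dec (X ≤? a + o)
... | yes (l , r) = ind-yes l (≤-trans r (+-monoʳ-≤ a (n≤1+n o)))
... | no n  = ind-no {a} {suc o} {X} λ (l , r) → n (l , ≤-pred (≤∧≢⇒< (≤-trans r (≤-reflexive (+-suc a o))) ne))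

module Windows (t d p : ℕ → ℕ) where

  w : ℕ → ℕ
  w j = d j ∸ t j

  Act : ℕ → ℕ → Set
  Act j X = t j < X × X ≤ t j + w j

  act-at : ∀ j o → o < w j → Act j (suc (t j + o))
  act-at j o lt = s≤s (m≤m+n (t j) o) , ≤-trans (≤-reflexive (sym (+-suc (t j) o))) (+-monoʳ-≤ (t j) lt)

  act-offset : ∀ j X → Act j X → ∃[ o ] (o < w j × X ≡ suc (t j + o))
  act-offset j (suc x) (s≤s l , r) = x ∸ t j ,
    +-cancelˡ-< (t j) _ _ (≤-trans (s≤s (≤-reflexive (m+[n∸m]≡n l))) r) , cong suc (sym (m+[n∸m]≡n l))

  -- It plays two roles: `rk X n` is the number of jobs active in cell X, computed in `markₐ`, and
  -- for a job j active there `rk X j` is its position in the row.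
  rk : ℕ → ℕ → ℕ
  rk X zero    = 0
  rk X (suc j) = rk X j + ind (t j) (w j) X

  rk-mono : ∀ X {i j} → i ≤ j → rk X i ≤ rk X j
  rk-mono X {i} {zero}  z≤n = z≤n
  rk-mono X {i} {suc j} le with m≤n⇒m<n∨m≡n le
  ... | inj₁ lt   = ≤-trans (rk-mono X (≤-pred lt)) (m≤m+n _ _)
  ... | inj₂ refl = ≤-refl

  rk-< : ∀ X {i j} → i < j → Act i X → rk X i < rk X j
  rk-< X {i} lt (l , r) = ≤-trans (≤-reflexive (trans (+-comm 1 (rk X i)) (cong (rk X i +_) (sym (ind-yes l r))))) (rk-mono X lt)

  rk-inj : ∀ X i j → Act i X → Act j X → rk X i ≡ rk X j → i ≡ j
  rk-inj X i j a b e with <-cmp i j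
  ... | tri< l _ _ = contradiction e (<⇒≢ (rk-< X l a))
  ... | tri≈ _ q _ = q
  ... | tri> _ _ g = contradiction (sym e) (<⇒≢ (rk-< X g b))

  rk-surj : ∀ X n c → c < rk X n → ∃[ j ] (j < n × Act j X × rk X j ≡ c)
  rk-surj X (suc n) c lt with c <? rk X n
  ... | yes l with rk-surj X n c l
  ...   | j , j<n , r = j , m<n⇒m<1+n j<n , r
  rk-surj X (suc n) c lt | no ge with (t n <? X) ×-dec (X ≤? t n + w n)
  ... | yes a = n , ≤-refl , a , ≤-antisym (≮⇒≥ ge) (≤-pred (≤-trans lt (≤-reflexive (+-comm (rk X n) 1))))
  ... | no _  = contradiction (≤-trans lt (≤-reflexive (+-identityʳ (rk X n)))) ge

  record Reads (n m : ℕ) (s : State) : Set where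
    constructor mkReads
    field
      read-n : s nₐ 0 ≡ n
      read-m : s mₐ 0 ≡ m
      read-t : ∀ j → s relₐ j ≡ t j
      read-d : ∀ j → s dlₐ j ≡ d j
      read-p : ∀ j → s ptₐ j ≡ p j

  reads-frame : ∀ {P n m s s′} → writes P nₐ ≡ false → writes P mₐ ≡ false → writes P relₐ ≡ false →
                writes P dlₐ ≡ false → writes P ptₐ ≡ false → Same P s s′ → Reads n m s → Reads n m s′
  reads-frame a b c e g f (mkReads rn rm rt rd rp) = mkReads (trans (f nₐ a 0) rn) (trans (f mₐ b 0) rm)
    (λ j → trans (f relₐ c j) (rt j)) (λ j → trans (f dlₐ e j) (rd j)) (λ j → trans (f ptₐ g j) (rp j))

  module Marking (n m A ℓ : ℕ) (w≤ℓ : ∀ j → w j ≤ ℓ) where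

    -- The flag is raised while counting is under way; as counts never decrease, a cell that raised
    -- it still exceeds A at the end.
    Counted : (ℕ → ℕ) → State → Set
    Counted c s = (∀ X → s markₐ X ≡ c X) × (s fullₐ 0 ≡ 0 → ∀ X → s markₐ X ≤ A) × (s fullₐ 0 ≢ 0 → ∃[ X ] A < s markₐ X)

    mark-runs : ∀ s → Reads n m s → s Aₐ 0 ≡ A → Counted (λ _ → 0) s →
                Runs mark s (20 + n * (20 + (20 + ℓ * (20 + 28)))) (Counted (λ X → rk X n))
    mark-runs s rd hA C = conseq
      (for jₐ (var nₐ) (FOR oₐ windowᵉ markStep) n _ (λ j → Counted (λ X → rk X j)) s refl (2 ≤! 9)
        (λ s′ f → trans (f nₐ refl 0) (Reads.read-n rd)) outer C)
      λ _ _ → proj₂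
      where
      step : ∀ j o s′ → o < w j → s′ jₐ 0 ≡ j → s′ oₐ 0 ≡ o → s′ Aₐ 0 ≡ A → s′ relₐ j ≡ t j →
             Counted (λ X → rk X j + ind (t j) o X) s′ →
             Runs markStep s′ 28 (λ s″ → Counted (λ X → rk X j + ind (t j) (suc o) X) (s″ [ oₐ , 0 ↦ suc o ]))
      step j o s′ o<w refl refl hA′ ht (cnt , ok , over) = assign-seq (assign-seq (if-runs
        (λ nz → weaken (3 ≤! 3) (assign (count , (λ ()) , λ _ → i , subst (_< mk′ i) hA′ (m∸n≢0⇒n<m nz))))
        (λ z → weaken (1 ≤! 3) (skip-runs (count ,
          (λ e X → upd-elim (s′ markₐ) i v X (_≤ A)
            (λ q → subst₂ _≤_ (upd-≡ (s′ markₐ) i v refl) hA′ (m∸n≡0⇒m≤n z)) (λ _ → ok e X)) ,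
          (λ n → let (X , lt) = over n in X , ≤-trans lt (upd-elim (s′ markₐ) i v X (s′ markₐ X ≤_) (λ q → subst (λ x → s′ markₐ x ≤ v) q (m≤m+n (s′ markₐ i) 1)) (λ _ → ≤-refl))))))))
        where
        i = s′ relₐ (s′ jₐ 0) + s′ oₐ 0 + 1
        v = s′ markₐ i + 1
        mk′ = s′ markₐ [ i ⇐ v ]
        i≡ : i ≡ suc (t j + o)
        i≡ = trans (+-comm _ 1) (cong (λ x → suc (x + o)) ht)
        count : ∀ X → mk′ X ≡ rk X j + ind (t j) (suc o) X
        count X = upd-elim (s′ markₐ) i v X (_≡ rk X j + ind (t j) (suc o) X)
          (λ q → trans (+-comm _ 1) (trans (cong suc (trans (cong (s′ markₐ) q) (cnt X))) (trans (sym (+-suc (rk X j) _))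
             (cong (rk X j +_) (subst (λ x → suc (ind (t j) o x) ≡ ind (t j) (suc o) x) (trans (sym i≡) q) (sym (ind-suc-≡ (t j) o)))))))
          (λ ne → trans (cnt X) (cong (rk X j +_) (sym (ind-suc-≢ (t j) o X (λ q → ne (trans i≡ (sym q)))))))
      outer : ∀ j s′ → j < n → s′ jₐ 0 ≡ j → Same mark s s′ → Counted (λ X → rk X j) s′ →
              Runs (FOR oₐ windowᵉ markStep) s′ (20 + ℓ * (20 + 28)) (λ s″ → Counted (λ X → rk X (suc j)) (s″ [ jₐ , 0 ↦ suc j ]))
      outer j s′ _ refl f (cnt , r) = weaken (+-monoʳ-≤ 20 (*-monoˡ-≤ 48 (w≤ℓ j))) (conseq
        (for oₐ windowᵉ markStep (w j) 28 (λ o → Counted (λ X → rk X j + ind (t j) o X)) s′ refl (7 ≤! 9)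
          (λ s″ g → cong₂ _∸_ (trans (g dlₐ refl _) (trans (cong (s′ dlₐ) (g jₐ refl 0)) (trans (f dlₐ refl j) (Reads.read-d rd j))))
                              (trans (g relₐ refl _) (trans (cong (s′ relₐ) (g jₐ refl 0)) (trans (f relₐ refl j) (Reads.read-t rd j)))))
          (λ o s″ o<w ho g C′ → step j o s″ o<w (g jₐ refl 0) ho (trans (g Aₐ refl 0) (trans (f Aₐ refl 0) hA)) (trans (g relₐ refl j) (trans (f relₐ refl j) (Reads.read-t rd j))) C′)
          ((λ X → trans (cnt X) (trans (sym (+-identityʳ (rk X j))) (cong (rk X j +_) (sym (ind-zero (t j) X))))) , r))
        λ _ _ → proj₂)

-- The timeline

module Walking (t d p : ℕ → ℕ) (n m A ℓ : ℕ) (1≤A : 1 ≤ A) (w≤ℓ : ∀ j → Windows.w t d p j ≤ ℓ)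
               (rk≤A : ∀ X → Windows.rk t d p X n ≤ A) where

  open Windows t d p

  record Walked (R : ℕ) (pos : ℕ → ℕ) : Set where
    field
      row       : ∀ X → ∃[ h ] (pos X ≡ 0 ⊎ (h < R × pos X ≡ suc h * A × rk X n ≢ 0))
      injective : ∀ X Y → pos X ≢ 0 → pos X ≡ pos Y → X ≡ Y
      inhabited : ∀ h → h < R → ∃[ X ] pos X ≡ suc h * A

  row-injective : ∀ {h h′} → suc h * A ≡ suc h′ * A → h ≡ h′
  row-injective {h} {h′} e = suc-injective (*-cancelʳ-≡ (suc h) (suc h′) A {{>-nonZero 1≤A}} e)

  row≢0 : ∀ {h} → suc h * A ≢ 0
  row≢0 {h} e = <⇒≱ 1≤A (≤-trans (m≤m+n A (h * A)) (≤-reflexive e))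

  marked-job : ∀ X → rk X n ≢ 0 → ∃[ j ] (j < n × Act j X)
  marked-job X nz with rk-surj X n 0 (n≢0⇒n>0 nz)
  ... | j , lt , a , _ = j , lt , a

  -- A numbered cell is marked, hence an offset in the window of some job; this injects the rows
  -- into the pairs of a job and an offset.
  rows≤ : ∀ {R pos} → Walked R pos → R ≤ n * ℓ
  rows≤ {R} {pos} W = injective⇒≤ {f = f} f-injective
    where
    open Walked W
    witness : ∀ h → h < R → ∃[ X ] (pos X ≡ suc h * A × ∃[ j ] (j < n × ∃[ o ] (o < ℓ × X ≡ suc (t j + o))))
    witness h lt with inhabited h lt
    ... | X , e with row X
    ...   | _ , inj₁ z = contradiction (trans (sym e) z) (row≢0 {h})
    ...   | _ , inj₂ (_ , _ , nz) with marked-job X nz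
    ...     | j , j<n , a with act-offset j X a
    ...       | o , o<w , q = X , e , j , j<n , o , ≤-trans o<w (w≤ℓ j) , q
    f : Fin R → Fin (n * ℓ)
    f i with witness (toℕ i) (toℕ<n i)
    ... | X , _ , j , j<n , o , o<ℓ , _ = combine (fromℕ< j<n) (fromℕ< o<ℓ)
    f-injective : Injective _≡_ _≡_ f
    f-injective {i} {i′} e with witness (toℕ i) (toℕ<n i) | witness (toℕ i′) (toℕ<n i′)
    ... | X , x , j , j<n , o , o<ℓ , q | X′ , x′ , j′ , j′<n , o′ , o′<ℓ , q′
      with combine-injective (fromℕ< j<n) (fromℕ< o<ℓ) (fromℕ< j′<n) (fromℕ< o′<ℓ) e
    ... | e₁ , e₂ = toℕ-injective (row-injective (trans (sym x) (trans (cong pos (trans q (trans (cong₂ (λ a b → suc (t a + b))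
            (trans (sym (toℕ-fromℕ< j<n)) (trans (cong toℕ e₁) (toℕ-fromℕ< j′<n)))
            (trans (sym (toℕ-fromℕ< o<ℓ)) (trans (cong toℕ e₂) (toℕ-fromℕ< o′<ℓ)))) (sym q′)))) x′)))

  marked : ℕ → Set
  marked X = rk X n ≢ 0

  -- The walk interrupted inside a run. The cursor x is the only marked cell that may lack a number
  -- although its predecessor has one, or although a visited job opens a run there. By `back` and
  -- `behind` runs are numbered from their first cell on, so the cell after a marked unnumbered one
  -- is unnumbered too and consecutive numbers can be given. `fuel` counts steps until the walk
  -- idles for good.
  record Progress (i : ℕ) (pos : ℕ → ℕ) (x base R next : ℕ) : Set where
    field
      walked  : Walked R pos
      base≡   : base ≡ suc R * A
      forward : ∀ X → pos X ≢ 0 → marked (suc X) →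
                pos (suc X) ≡ pos X + A ⊎ (suc X ≡ x × pos X + A ≡ base × pos (suc X) ≡ 0)
      starts  : ∀ j → j < next → rk (t j) n ≡ 0 → marked (suc (t j)) → pos (suc (t j)) ≢ 0 ⊎ suc (t j) ≡ x
      back    : ∀ X → pos (suc X) ≢ 0 → marked X → pos X ≢ 0
      behind  : ∀ X → suc X ≡ x → marked X → pos X ≢ 0
      next≤n  : next ≤ n
      fuel    : i ≡ next + R ⊎ (next ≡ n × rk x n ∸ pos x ≡ 0)

  progress-init : ∀ {pos} → (∀ X → pos X ≡ 0) → Progress 0 pos 0 A 0 0
  progress-init z = record
    { walked = record { row = λ X → 0 , inj₁ (z X) ; injective = λ X Y nz → contradiction (z X) nz ; inhabited = λ _ () }
    ; base≡ = sym (+-identityʳ A)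
    ; forward = λ X nz → contradiction (z X) nz
    ; starts = λ _ ()
    ; back = λ X nz → contradiction (z (suc X)) nz
    ; behind = λ _ ()
    ; next≤n = z≤n
    ; fuel = inj₁ refl
    }

  module _ {i pos x base R next} (P : Progress i pos x base R next) where
    open Progress P
    open Walked walked

    pos≥A : ∀ X → pos X ≢ 0 → A ≤ pos X
    pos≥A X nz with row X
    ... | _ , inj₁ z = contradiction z nz
    ... | h , inj₂ (_ , e , _) = ≤-trans (m≤m+n A (h * A)) (≤-reflexive (sym e))

    blocked : ∀ X → rk X n ∸ pos X ≡ 0 → marked X → pos X ≢ 0
    blocked X g mk z = mk (trans (cong (rk X n ∸_) (sym z)) g)

    unassigned : rk x n ∸ pos x ≢ 0 → pos x ≡ 0
    unassigned g with pos x ≟ 0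
    ... | yes z = z
    ... | no nz = contradiction (m≤n⇒m∸n≡0 (≤-trans (rk≤A x) (pos≥A x nz))) g

    progress-assign : rk x n ∸ pos x ≢ 0 → Progress (suc i) (pos [ x ⇐ base ]) (suc x) (base + A) (suc R) next
    progress-assign g = record
      { walked = record
        { row = λ X → case x ≟ X of λ where
            (yes refl) → R , inj₂ (≤-refl , trans (hit refl) base≡ , mk)
            (no ne) → case row X of λ where
              (h , inj₁ z) → h , inj₁ (trans (miss ne) z)
              (h , inj₂ (lt , e , q)) → h , inj₂ (m<n⇒m<1+n lt , trans (miss ne) e , q)
        ; injective = λ X Y nz e → case x ≟ X of λ where
            (yes refl) → case x ≟ Y of λ where
              (yes refl) → refl
              (no ne) → contradiction (trans (sym (miss ne)) (trans (sym e) (hit refl))) (fresh Y)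
            (no ne) → case x ≟ Y of λ where
              (yes refl) → contradiction (trans (sym (miss ne)) (trans e (hit refl))) (fresh X)
              (no ne′) → injective X Y (λ z → nz (trans (miss ne) z)) (trans (sym (miss ne)) (trans e (miss ne′)))
        ; inhabited = λ h lt → case m<1+n⇒m<n∨m≡n lt of λ where
            (inj₂ refl) → x , trans (hit refl) base≡
            (inj₁ lt′) → case inhabited h lt′ of λ where
              (X , e) → X , trans (miss (λ { refl → row≢0 {h} (trans (sym e) z) })) e
        }
      ; base≡ = trans (cong (_+ A) base≡) (+-comm (suc R * A) A)
      ; forward = λ X nz mk′ → case x ≟ X of λ where
          (yes refl) → inj₂ (refl , cong (_+ A) (hit refl) , trans (miss (λ q → 1+n≢n (sym q))) (ahead mk′))
          (no ne) → case forward X (λ q → nz (trans (miss ne) q)) mk′ of λ where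
            (inj₁ e) → case x ≟ suc X of λ where
              (yes refl) → contradiction (m+n≡0⇒m≡0 (pos X) (trans (sym e) z)) (λ q → nz (trans (miss ne) q))
              (no ne′) → inj₁ (trans (miss ne′) (trans e (cong (_+ A) (sym (miss ne)))))
            (inj₂ (refl , e , _)) → inj₁ (trans (hit refl) (trans (sym e) (cong (_+ A) (sym (miss ne)))))
      ; starts = λ j lt a b → case starts j lt a b of λ where
          (inj₁ nz) → inj₁ (keep _ nz)
          (inj₂ refl) → inj₁ λ q → base≢0 (trans (sym (hit refl)) q)
      ; back = λ X nz mk′ → case x ≟ suc X of λ where
          (yes refl) → keep X (behind X refl mk′)
          (no ne) → keep X (back X (λ q → nz (trans (miss ne) q)) mk′)
      ; behind = λ { X refl _ q → base≢0 (trans (sym (hit refl)) q) }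
      ; next≤n = next≤n
      ; fuel = case fuel of λ where
          (inj₁ e) → inj₁ (trans (cong suc e) (sym (+-suc next R)))
          (inj₂ (_ , e)) → contradiction e g
      }
      where
      z = unassigned g
      mk : marked x
      mk e = g (trans (cong (_∸ pos x) e) (0∸n≡0 (pos x)))
      hit : ∀ {X} → x ≡ X → (pos [ x ⇐ base ]) X ≡ base
      hit = upd-≡ pos x base
      miss : ∀ {X} → x ≢ X → (pos [ x ⇐ base ]) X ≡ pos X
      miss = upd-≢ pos x base
      base≢0 : base ≢ 0
      base≢0 e = row≢0 {R} (trans (sym base≡) e)
      keep : ∀ X → pos X ≢ 0 → (pos [ x ⇐ base ]) X ≢ 0
      keep X nz = upd-elim pos x base X (_≢ 0) (λ _ → base≢0) (λ _ → nz)
      fresh : ∀ X → pos X ≢ base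
      fresh X e with row X
      ... | _ , inj₁ q = base≢0 (trans (sym e) q)
      ... | h , inj₂ (lt , q , _) = <⇒≢ lt (row-injective (trans (sym q) (trans e base≡)))
      ahead : marked (suc x) → pos (suc x) ≡ 0
      ahead _ with pos (suc x) ≟ 0
      ... | yes q = q
      ... | no nz = contradiction z (back x nz mk)

    settled : rk x n ∸ pos x ≡ 0 → ∀ X → pos X ≢ 0 → marked (suc X) → pos (suc X) ≡ pos X + A
    settled g X nz mk with forward X nz mk
    ... | inj₁ e = e
    ... | inj₂ (refl , _ , z) = contradiction z (blocked x g mk)

    settled-start : rk x n ∸ pos x ≡ 0 → ∀ j → j < next → rk (t j) n ≡ 0 → marked (suc (t j)) → pos (suc (t j)) ≢ 0
    settled-start g j lt a b with starts j lt a b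
    ... | inj₁ nz = nz
    ... | inj₂ refl = blocked x g b

    -- Covers both choices of the new cursor: `start` concerns a release that opens a run, and
    -- `clear` makes `behind` vacuous at the new place.
    progress-next : rk x n ∸ pos x ≡ 0 → next < n → ∀ x′ →
                    (rk (t next) n ≡ 0 → x′ ≡ suc (t next)) → (∀ X → suc X ≡ x′ → ¬ marked X) →
                    Progress (suc i) pos x′ base R (suc next)
    progress-next g lt x′ start clear = record
      { walked = walked
      ; base≡ = base≡
      ; forward = λ X nz mk → inj₁ (settled g X nz mk)
      ; starts = λ j l a b → case m<1+n⇒m<n∨m≡n l of λ where
          (inj₁ l′) → inj₁ (settled-start g j l′ a b)
          (inj₂ refl) → inj₂ (sym (start a))
      ; back = back
      ; behind = λ X e mk → contradiction mk (clear X e)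
      ; next≤n = lt
      ; fuel = case fuel of λ where
          (inj₁ e) → inj₁ (cong suc e)
          (inj₂ (refl , _)) → contradiction lt (<-irrefl refl)
      }

    progress-idle : rk x n ∸ pos x ≡ 0 → n ≤ next → Progress (suc i) pos x base R next
    progress-idle g le = record
      { walked = walked ; base≡ = base≡ ; forward = forward ; starts = starts ; back = back ; behind = behind
      ; next≤n = next≤n ; fuel = inj₂ (≤-antisym next≤n le , g) }

  record Timeline (R : ℕ) (pos vt : ℕ → ℕ) : Set where
    field
      walked : Walked R pos
      at     : ∀ j o → o < w j → pos (suc (t j + o)) ≡ suc (vt j + o) * A
      inside : ∀ j o → o < w j → vt j + o < R

  -- Until it idles, each step numbers a cell or passes to the next job, which happens at most nℓ +
  -- n times; the one extra unit of fuel thus forces the idle state, where every job has been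
  -- visited and the cursor has nothing left to number.
  progress-end : (∀ j → 0 < w j → j < n) → ∀ {pos x base R next} → Progress (n + 1 + n * ℓ) pos x base R next → ∃ (Timeline R pos)
  progress-end w>0⇒<n {pos} {x} {base} {R} {next} P with Progress.fuel P
  ... | inj₁ e = contradiction (begin-strict
        n + n * ℓ     <⟨ ≤-reflexive (cong (_+ n * ℓ) (+-comm 1 n)) ⟩
        n + 1 + n * ℓ ≡⟨ e ⟩
        next + R      ≤⟨ +-mono-≤ (Progress.next≤n P) (rows≤ (Progress.walked P)) ⟩
        n + n * ℓ     ∎) (<-irrefl refl)
    where open ≤-Reasoning
  ... | inj₂ (refl , g) = vt , record { walked = walked ; at = at ; inside = inside }
    where
    open Progress P
    open Walked walked
    active⇒marked : ∀ j X → Act j X → marked X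
    active⇒marked j X a z = <⇒≱ (rk-< X (w>0⇒<n j (n≢0⇒n>0 λ q → <⇒≱ (proj₁ a) (≤-trans (proj₂ a) (≤-reflexive (trans (cong (t j +_) q) (+-identityʳ _)))))) a)
      (≤-trans (≤-reflexive z) z≤n)
    unmarked-0 : ∀ k → rk 0 k ≡ 0
    unmarked-0 zero    = refl
    unmarked-0 (suc k) = cong₂ _+_ (unmarked-0 k) (ind-no {t k} {w k} {0} λ ())
    -- Induction on the cell: its predecessor is marked and the numbering went on from there, or the
    -- cell opens a run, and then a job active in it is released exactly there.
    all : ∀ X → marked X → pos X ≢ 0
    all zero    mk = contradiction (unmarked-0 n) mk
    all (suc X) mk with rk X n ≟ 0
    ... | no mk′ = λ z → all X mk′ (m+n≡0⇒m≡0 (pos X) (trans (sym (settled P g X (all X mk′) mk)) z))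
    ... | yes um with marked-job (suc X) mk
    ...   | j , lt , (l , r) with m≤n⇒m<n∨m≡n l
    ...     | inj₁ l′ = contradiction um (active⇒marked j X (≤-pred l′ , ≤-trans (n≤1+n X) r))
    ...     | inj₂ refl = settled-start P g j lt um mk
    vt : ℕ → ℕ
    vt j = proj₁ (row (suc (t j)))
    at : ∀ j o → o < w j → pos (suc (t j + o)) ≡ suc (vt j + o) * A
    at j zero lt with row (suc (t j)) | all (suc (t j)) (active⇒marked j _ (subst (λ x → Act j (suc x)) (+-identityʳ (t j)) (act-at j 0 lt)))
    ... | h , inj₁ z | nz = contradiction z nz
    ... | h , inj₂ (_ , e , _) | _ = trans (cong (λ x → pos (suc x)) (+-identityʳ (t j))) (trans e (cong (λ x → suc x * A) (sym (+-identityʳ h))))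
    at j (suc o) lt = trans (cong (λ x → pos (suc x)) (+-suc (t j) o)) (trans
      (settled P g _ (all _ (active⇒marked j _ (act-at j o (<⇒≤ lt)))) (active⇒marked j _ (subst (λ x → Act j (suc x)) (+-suc (t j) o) (act-at j (suc o) lt))))
      (trans (cong (_+ A) (at j o (<⇒≤ lt))) (trans (+-comm (suc (vt j + o) * A) A) (cong (λ x → suc x * A) (sym (+-suc (vt j) o))))))
    inside : ∀ j o → o < w j → vt j + o < R
    inside j o lt with row (suc (t j + o)) | at j o lt
    ... | h , inj₁ z | e = contradiction (trans (sym e) z) (row≢0 {vt j + o})
    ... | h , inj₂ (l , q , _) | e = subst (_< R) (row-injective (trans (sym q) e)) l

  walk-runs : ∀ s → Reads n m s → s Aₐ 0 ≡ A → s ℓₐ 0 ≡ ℓ → (∀ X → s markₐ X ≡ rk X n) → (∀ X → s posₐ X ≡ 0) →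
              s xₐ 0 ≡ 0 → s rowsₐ 0 ≡ 0 → s nextₐ 0 ≡ 0 → (∀ j → 0 < w j → j < n) →
              Runs walk s (6 + (20 + n * 28 + (24 + (n + 1 + n * ℓ) * 60))) (λ s′ → ∃ (Timeline (s′ rowsₐ 0) (s′ posₐ)))
  walk-runs s rd hA hℓ hmk hpos hx hR hnx w>0⇒<n =
    (assign-seq (for jₐ (var nₐ) (fuelₐ ≔ var fuelₐ ⊕ var ℓₐ) n 8 (λ j s′ → s′ fuelₐ 0 ≡ n + 1 + j * ℓ) _ refl (2 ≤! 9)
        (λ s′ f → trans (f nₐ refl 0) (Reads.read-n rd))
        (λ j s′ _ _ f e → weaken (_ ≤! 8) (assign (trans (cong₂ _+_ e (trans (f ℓₐ refl 0) hℓ)) (trans (+-assoc (n + 1) (j * ℓ) ℓ) (cong (n + 1 +_) (+-comm (j * ℓ) ℓ))))))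
        (trans (cong (_+ 1) (Reads.read-n rd)) (sym (+-identityʳ (n + 1))))
    ▹ λ s₁ f (_ , hF) → assign-seq (conseq
      (for iₐ (var fuelₐ) walkStep (n + 1 + n * ℓ) 40 (λ i s′ → Progress i (s′ posₐ) (s′ xₐ 0) (s′ baseₐ 0) (s′ rowsₐ 0) (s′ nextₐ 0)) _ refl (2 ≤! 9)
        (λ s′ g → trans (g fuelₐ refl 0) hF)
        (λ i s′ _ _ g P → step i s′ (trans (g nₐ refl 0) (trans (f nₐ refl 0) (Reads.read-n rd))) (trans (g Aₐ refl 0) (trans (f Aₐ refl 0) hA))
           (λ X → trans (g markₐ refl X) (trans (f markₐ refl X) (hmk X))) (λ j → trans (g relₐ refl j) (trans (f relₐ refl j) (Reads.read-t rd j))) P)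
        (start s₁ f))
      λ s′ _ (_ , P) → progress-end w>0⇒<n P)))
    where
    start : ∀ s₁ → _ → Progress 0 (s₁ posₐ) (s₁ xₐ 0) (s₁ Aₐ 0) (s₁ rowsₐ 0) (s₁ nextₐ 0)
    start s₁ f = subst₂ (λ x b → Progress 0 (s₁ posₐ) x b (s₁ rowsₐ 0) (s₁ nextₐ 0)) (sym (trans (f xₐ refl 0) hx)) (sym (trans (f Aₐ refl 0) hA))
      (subst₂ (λ r k → Progress 0 (s₁ posₐ) 0 A r k) (sym (trans (f rowsₐ refl 0) hR)) (sym (trans (f nextₐ refl 0) hnx))
        (progress-init λ X → trans (f posₐ refl X) (hpos X)))
    step : ∀ i s′ → s′ nₐ 0 ≡ n → s′ Aₐ 0 ≡ A → (∀ X → s′ markₐ X ≡ rk X n) → (∀ j → s′ relₐ j ≡ t j) →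
           Progress i (s′ posₐ) (s′ xₐ 0) (s′ baseₐ 0) (s′ rowsₐ 0) (s′ nextₐ 0) →
           Runs walkStep s′ 40 (λ s″ → Progress (suc i) (s″ posₐ) (s″ xₐ 0) (s″ baseₐ 0) (s″ rowsₐ 0) (s″ nextₐ 0))
    step i s′ hn hA′ mk rel P = weaken (_ ≤! 40) (if-runs
      (λ g → weaken (_ ≤! 25) (assign-seq (assign-seq (assign-seq (assign
        (subst₂ (λ b r → Progress (suc i) (s′ posₐ [ s′ xₐ 0 ⇐ s′ baseₐ 0 ]) (s′ xₐ 0 + 1) b r (s′ nextₐ 0))
          (cong (s′ baseₐ 0 +_) (sym hA′)) (+-comm 1 (s′ rowsₐ 0))
          (subst (λ x → Progress (suc i) (s′ posₐ [ s′ xₐ 0 ⇐ s′ baseₐ 0 ]) x (s′ baseₐ 0 + A) (suc (s′ rowsₐ 0)) (s′ nextₐ 0)) (+-comm 1 (s′ xₐ 0))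
            (progress-assign P (λ e → g (trans (cong (_∸ s′ posₐ (s′ xₐ 0)) (mk (s′ xₐ 0))) e))))))))))
      (λ g → let g′ = trans (cong (_∸ s′ posₐ (s′ xₐ 0)) (sym (mk (s′ xₐ 0)))) g in weaken (_ ≤! 25) (if-runs
        (λ lt → let lt′ = subst (s′ nextₐ 0 <_) hn (m∸n≢0⇒n<m lt)
                    here : rk (t (s′ nextₐ 0)) n ≡ s′ markₐ (s′ relₐ (s′ nextₐ 0))
                    here = trans (cong (λ x → rk x n) (sym (rel (s′ nextₐ 0)))) (sym (mk (s′ relₐ (s′ nextₐ 0))))
          in if-runs {t = 7}
            (λ nz → weaken (_ ≤! 7) (assign (progress-next P g′ lt′ 0 (λ z → contradiction (trans (sym here) z) nz) (λ _ ()))))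
            (λ z → weaken (_ ≤! 7) (assign (progress-next P g′ lt′ (s′ relₐ (s′ nextₐ 0) + 1)
              (λ _ → trans (+-comm _ 1) (cong suc (rel (s′ nextₐ 0))))
              (λ X e → λ mkd → mkd (trans (cong (λ x → rk x n) (suc-injective (trans e (+-comm _ 1)))) (trans (sym (mk _)) z))))))
          ▹ λ s₂ f₂ P₂ → assign (subst (λ x → Progress (suc i) (s₂ posₐ) (s₂ xₐ 0) (s₂ baseₐ 0) (s₂ rowsₐ 0) x)
              (trans (+-comm 1 _) (cong (_+ 1) (sym (f₂ nextₐ refl 0)))) P₂))
        (λ ge → weaken (s≤s z≤n) (skip-runs (progress-idle P g′ (subst (_≤ s′ nextₐ 0) hn (m∸n≡0⇒m≤n ge))))))))

-- The table of rows

upd-upd : ∀ (f : ℕ → ℕ) i v v′ k → ((f [ i ⇐ v ]) [ i ⇐ v′ ]) k ≡ (f [ i ⇐ v′ ]) k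
upd-upd f i v v′ k with i ≡ᵇ k
... | true  = refl
... | false = refl

module Filling (t d p : ℕ → ℕ) (n m A ℓ : ℕ) (1≤A : 1 ≤ A) (w≤ℓ : ∀ j → Windows.w t d p j ≤ ℓ)
               (rk≤A : ∀ X → Windows.rk t d p X n ≤ A)
               (w>0⇒<n : ∀ j → 0 < Windows.w t d p j → j < n)
               (p≤w : ∀ j → p j ≤ Windows.w t d p j) (p>0 : ∀ j → 0 < Windows.w t d p j → 0 < p j)
               {R : ℕ} {pos vt : ℕ → ℕ} (TL : Walking.Timeline t d p n m A ℓ 1≤A w≤ℓ rk≤A R pos vt) where

  open Windows t d p
  open Walking t d p n m A ℓ 1≤A w≤ℓ rk≤A using (row-injective; row≢0; module Timeline; module Walked)
  open Timeline TL
  open Walked walked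

  slot : ℕ → ℕ → ℕ
  slot j o = rk (suc (t j + o)) j

  slot<A : ∀ j o → o < w j → slot j o < A
  slot<A j o lt = ≤-trans (rk-< _ (w>0⇒<n j (≤-trans (s≤s z≤n) lt)) (act-at j o lt)) (rk≤A _)

  -- Different cells never share a row, so an overlap in virtual time is an overlap in real time.
  same-slot : ∀ i j o o′ → o < w i → o′ < w j → vt i + o ≡ vt j + o′ → suc (t i + o) ≡ suc (t j + o′)
  same-slot i j o o′ l l′ e = injective _ _ (λ z → row≢0 {vt i + o} (trans (sym (at i o l)) z))
    (trans (at i o l) (trans (cong (λ h → suc h * A) e) (sym (at j o′ l′))))

  slot-inj : ∀ i j o o′ → o < w i → o′ < w j → vt i + o ≡ vt j + o′ → slot i o ≡ slot j o′ → i ≡ j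
  slot-inj i j o o′ l l′ e q = rk-inj X i j (act-at i o l) (subst (Act j) (sym X≡) (act-at j o′ l′)) (trans q (cong (λ Y → rk Y j) (sym X≡)))
    where
    X = suc (t i + o)
    X≡ = same-slot i j o o′ l l′ e

  cell : ℕ → ℕ → ℕ
  cell j o = suc (vt j + o) * A + slot j o

  -- Row and position are the quotient and the remainder of the address by A.
  address-injective : ∀ {h h′ c c′} → c < A → c′ < A → suc h * A + c ≡ suc h′ * A + c′ → h ≡ h′ × c ≡ c′
  address-injective {h} {h′} {c} {c′} l l′ e with row-eq
    where
    row-eq : suc h ≡ suc h′
    row-eq = ≤-antisym (quotient-≤ {A} {c′} {c} (suc h′) (suc h) l′ (trans (+-comm c′ _) (trans (sym e) (+-comm _ c))))
                       (quotient-≤ {A} {c} {c′} (suc h) (suc h′) l (trans (+-comm c _) (trans e (+-comm _ c′))))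
      where open Radix A 0 0 using (quotient-≤)
  ... | refl = refl , +-cancelˡ-≡ (suc h * A) _ _ e

  cell-injective : ∀ i j o o′ → o < w i → o′ < w j → cell i o ≡ cell j o′ → i ≡ j × o ≡ o′
  cell-injective i j o o′ l l′ e with address-injective {vt i + o} {vt j + o′} (slot<A i o l) (slot<A j o′ l′) e
  ... | q , r with slot-inj i j o o′ l l′ q r
  ...   | refl = refl , +-cancelˡ-≡ (vt i) _ _ q

  FitValue NxtValue : ℕ → ℕ → ℕ → Set
  FitValue j o v = (p j ≤ w j ∸ o → v ≡ p j) × (w j ∸ o < p j → v ≡ 0)
  NxtValue j o v = (suc o < w j → v ≡ 2 + slot j (suc o)) × (suc o ≡ w j → v ≡ 1)

  record Filled (Done : ℕ → ℕ → Set) (fit nxt : ℕ → ℕ) : Set where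
    field
      fit-at  : ∀ j o → Done j o → FitValue j o (fit (cell j o))
      nxt-at  : ∀ j o → Done j o → NxtValue j o (nxt (cell j o))
      nowhere : ∀ a → (∃[ j ] ∃[ o ] (Done j o × a ≡ cell j o)) ⊎ (fit a ≡ 0 × nxt a ≡ 0)

  filled-map : ∀ {Done Done′ fit nxt} → (∀ j o → Done j o → Done′ j o) → (∀ j o → Done′ j o → Done j o) →
               Filled Done fit nxt → Filled Done′ fit nxt
  filled-map up down F = record
    { fit-at = λ j o x → fit-at j o (down j o x)
    ; nxt-at = λ j o x → nxt-at j o (down j o x)
    ; nowhere = λ a → case nowhere a of λ where
        (inj₁ (j , o , x , e)) → inj₁ (j , o , up j o x , e)
        (inj₂ z) → inj₂ z
    }
    where open Filled F

  Before : ℕ → ℕ → ℕ → ℕ → Set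
  Before j o i a = (i < j × a < w i) ⊎ (i ≡ j × a < o)

  filled-step : ∀ {j o fit nxt fit′ nxt′} v v′ → o < w j → Filled (Before j o) fit nxt → FitValue j o v → NxtValue j o v′ →
                (∀ a → fit′ a ≡ (fit [ cell j o ⇐ v ]) a) → (∀ a → nxt′ a ≡ (nxt [ cell j o ⇐ v′ ]) a) →
                Filled (Before j (suc o)) fit′ nxt′
  filled-step {j} {o} {fit} {nxt} {fit′} {nxt′} v v′ o<w F fv nv ef en = record
    { fit-at = λ i a x → case split i a x of λ where
        (inj₁ (refl , refl)) → subst (FitValue j o) (sym (trans (ef _) (upd-≡ fit _ v refl))) fv
        (inj₂ (b , ne)) → subst (FitValue i a) (sym (trans (ef _) (upd-≢ fit _ v ne))) (fit-at i a b)
    ; nxt-at = λ i a x → case split i a x of λ where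
        (inj₁ (refl , refl)) → subst (NxtValue j o) (sym (trans (en _) (upd-≡ nxt _ v′ refl))) nv
        (inj₂ (b , ne)) → subst (NxtValue i a) (sym (trans (en _) (upd-≢ nxt _ v′ ne))) (nxt-at i a b)
    ; nowhere = λ c → case cell j o ≟ c of λ where
        (yes e) → inj₁ (j , o , inj₂ (refl , ≤-refl) , sym e)
        (no ne) → case nowhere c of λ where
          (inj₁ (i , a , b , e)) → inj₁ (i , a , later i a b , e)
          (inj₂ (z , z′)) → inj₂ (trans (ef c) (trans (upd-≢ fit _ v ne) z) , trans (en c) (trans (upd-≢ nxt _ v′ ne) z′))
    }
    where
    open Filled F
    later : ∀ i a → Before j o i a → Before j (suc o) i a
    later i a (inj₁ x) = inj₁ x
    later i a (inj₂ (e , lt)) = inj₂ (e , m<n⇒m<1+n lt)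
    split : ∀ i a → Before j (suc o) i a → (i ≡ j × a ≡ o) ⊎ (Before j o i a × cell j o ≢ cell i a)
    split i a (inj₁ (l , la)) = inj₂ (inj₁ (l , la) , λ q → <⇒≢ l (sym (proj₁ (cell-injective j i o a o<w la q))))
    split i a (inj₂ (refl , la)) with m<1+n⇒m<n∨m≡n la
    ... | inj₂ refl = inj₁ (refl , refl)
    ... | inj₁ lt   = inj₂ (inj₂ (refl , lt) , λ q → <⇒≢ lt (sym (proj₂ (cell-injective j i o a o<w (<-trans lt o<w) q))))

  Counts : (ℕ → ℕ) → ℕ → ℕ → Set
  Counts cnt j o = ∀ X → cnt X ≡ rk X j + ind (t j) o X

  rowStep-runs : ∀ j o s → o < w j → s jₐ 0 ≡ j → s oₐ 0 ≡ o → s relₐ j ≡ t j → s dlₐ j ≡ d j → s ptₐ j ≡ p j →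
                 (∀ X → s posₐ X ≡ pos X) → Counts (s cntₐ) j o → Filled (Before j o) (s fitₐ) (s nxtₐ) →
                 Runs rowStep s 90 (λ s′ → Counts (s′ cntₐ) j (suc o) × Filled (Before j (suc o)) (s′ fitₐ) (s′ nxtₐ))
  rowStep-runs j o s o<w refl refl ht hd hp hpos cnt F = weaken (_ ≤! 90)
    (assign-seq (assign-seq (assign-seq (fitRuns ▹ λ s₂ f₂ (v , fv , e₂) →
      assign-seq (nxtRuns s₂ f₂ ▹ λ s₃ f₃ (v′ , nv , e₃) → assign
        ((λ Y → upd-elim (s₃ cntₐ) (s₃ xₐ 0) (s₃ cntₐ (s₃ xₐ 0) + 1) Y (_≡ rk Y j + ind (t j) (suc o) Y)
            (λ q → trans (+-comm _ 1) (trans (cong suc (trans (cong (s₃ cntₐ) q) (trans (f₃ cntₐ refl Y) (trans (f₂ cntₐ refl Y) (cnt Y)))))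
               (trans (sym (+-suc (rk Y j) _)) (cong (rk Y j +_) (subst (λ x → suc (ind (t j) o x) ≡ ind (t j) (suc o) x)
                 (trans (sym X≡) (trans (sym (trans (f₃ xₐ refl 0) (f₂ xₐ refl 0))) q)) (sym (ind-suc-≡ (t j) o)))))))
            (λ ne → trans (f₃ cntₐ refl Y) (trans (f₂ cntₐ refl Y) (trans (cnt Y) (cong (rk Y j +_)
               (sym (ind-suc-≢ (t j) o Y (λ q → ne (trans (trans (f₃ xₐ refl 0) (f₂ xₐ refl 0)) (trans X≡ (sym q))))))))))) ,
         filled-step v v′ o<w F fv nv
           (λ a → trans (f₃ fitₐ refl a) (e₂ a))
           (λ a → e₃ a)))))))
    where
    X = s relₐ (s jₐ 0) + s oₐ 0 + 1
    X≡ : X ≡ suc (t j + o)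
    X≡ = trans (+-comm _ 1) (cong (λ x → suc (x + o)) ht)
    cntX : s cntₐ X ≡ slot j o
    cntX = trans (cnt X) (trans (cong₂ _+_ (cong (λ x → rk x j) X≡) (ind-no {t j} {o} {X} λ (_ , r) → 1+n≰n (≤-trans (≤-reflexive (sym X≡)) r))) (+-identityʳ _))
    cell≡ : s posₐ X + s cntₐ X ≡ cell j o
    cell≡ = cong₂ _+_ (trans (hpos X) (trans (cong pos X≡) (at j o o<w))) cntX
    s₁ = ((s [ xₐ , 0 ↦ X ]) [ idxₐ , 0 ↦ s posₐ X + s cntₐ X ]) [ fitₐ , s posₐ X + s cntₐ X ↦ s ptₐ (s jₐ 0) ]
    w≡ : s dlₐ j ∸ s relₐ j ≡ w j
    w≡ = cong₂ _∸_ hd ht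
    fitP = IF ptₐ [ var jₐ ] ⊖ (windowᵉ ⊖ var oₐ) THEN fitₐ [ var idxₐ ]≔ lit 0 ELSE skip
    fitRuns : Runs fitP s₁ 20 (λ s′ → ∃[ v ] (FitValue j o v × (∀ a → s′ fitₐ a ≡ (s fitₐ [ cell j o ⇐ v ]) a)))
    fitRuns = weaken (_ ≤! 20) (if-runs {t = 4}
      (λ nz → weaken (_ ≤! 4) (assign (0 ,
        ((λ le → contradiction (m≤n⇒m∸n≡0 (subst₂ _≤_ (sym hp) (cong (_∸ o) (sym w≡)) le)) nz) , λ _ → refl) ,
        λ a → trans (upd-upd (s fitₐ) (s posₐ X + s cntₐ X) (s ptₐ (s jₐ 0)) 0 a) (cong (λ c → (s fitₐ [ c ⇐ 0 ]) a) cell≡))))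
      (λ z → weaken (_ ≤! 4) (skip-runs (p j ,
        ((λ _ → refl) , λ lt → contradiction (subst₂ _≤_ hp (cong (_∸ o) w≡) (m∸n≡0⇒m≤n z)) (<⇒≱ lt)) ,
        λ a → cong₂ (λ c v → (s fitₐ [ c ⇐ v ]) a) cell≡ hp))))
    nxtP = IF windowᵉ ⊖ (var oₐ ⊕ lit 1) THEN nxtₐ [ var idxₐ ]≔ lit 2 ⊕ cntₐ [ var xₐ ⊕ lit 1 ] ELSE skip
    nxtRuns : ∀ s₂ → Same fitP s₁ s₂ →
              Runs nxtP (s₂ [ nxtₐ , s₂ idxₐ 0 ↦ 1 ]) 30 (λ s′ → ∃[ v ] (NxtValue j o v × (∀ a → s′ nxtₐ a ≡ (s nxtₐ [ cell j o ⇐ v ]) a)))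
    nxtRuns s₂ f = weaken (_ ≤! 30) (if-runs {t = 12}
      (λ nz → weaken (_ ≤! 12) (assign (2 + s₂ cntₐ (s₂ xₐ 0 + 1) ,
        ((λ _ → cong (2 +_) (trans (f cntₐ refl _) (trans (cong (s cntₐ) X+1) (trans (cnt _) (trans (cong (rk (suc (t j + suc o)) j +_)
              (ind-no {t j} {o} {suc (t j + suc o)} λ (_ , r) → <⇒≱ (s≤s (+-monoʳ-≤ (t j) (n≤1+n o))) r)) (+-identityʳ _)))))) ,
         λ e → contradiction (trans (w≡₂) (trans (cong (w j ∸_) (trans (+-comm _ 1) e)) (n∸n≡0 (w j)))) nz) ,
        λ a → trans (upd-upd (s₂ nxtₐ) (s₂ idxₐ 0) 1 _ a) (old a _))))
      (λ z → weaken (_ ≤! 12) (skip-runs (1 ,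
        ((λ lt → contradiction (≤-trans (m∸n≡0⇒m≤n (trans (sym w≡₂) z)) (≤-reflexive (+-comm _ 1))) (<⇒≱ lt)) , λ _ → refl) ,
        λ a → old a 1))))
      where
      w≡₂ : (s₂ dlₐ (s₂ jₐ 0) ∸ s₂ relₐ (s₂ jₐ 0)) ∸ (s₂ oₐ 0 + 1) ≡ w j ∸ (o + 1)
      w≡₂ = cong₂ _∸_ (trans (cong₂ _∸_ (trans (f dlₐ refl _) (cong (s dlₐ) (f jₐ refl 0))) (trans (f relₐ refl _) (cong (s relₐ) (f jₐ refl 0)))) w≡)
                      (cong (_+ 1) (f oₐ refl 0))
      X+1 : s₂ xₐ 0 + 1 ≡ suc (t j + suc o)
      X+1 = trans (+-comm _ 1) (cong suc (trans (f xₐ refl 0) (trans X≡ (sym (+-suc (t j) o)))))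
      old : ∀ a v → (s₂ nxtₐ [ s₂ idxₐ 0 ⇐ v ]) a ≡ (s nxtₐ [ cell j o ⇐ v ]) a
      old a v = trans (cong (λ c → (s₂ nxtₐ [ c ⇐ v ]) a) (trans (f idxₐ refl 0) cell≡))
                      (cong (if cell j o ≡ᵇ a then v else_) (f nxtₐ refl a))

  Table : (ℕ → ℕ) → ℕ → ℕ → ℕ
  Table f h c = f (suc h * A + c)

  rows-runs : ∀ s → Reads n m s → (∀ X → s posₐ X ≡ pos X) → (∀ X → s cntₐ X ≡ 0) → (∀ a → s fitₐ a ≡ 0) → (∀ a → s nxtₐ a ≡ 0) →
              Runs rows s (20 + n * (20 + (20 + ℓ * (20 + 90))))
                (λ s′ → Layout A R ℓ vt w p slot (Table (s′ fitₐ)) (Table (s′ nxtₐ)))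
  rows-runs s rd hpos hcnt hfit hnxt = conseq
    (for jₐ (var nₐ) (FOR oₐ windowᵉ rowStep) n _ (λ j s′ → Counts (s′ cntₐ) j 0 × Filled (Before j 0) (s′ fitₐ) (s′ nxtₐ)) s refl (2 ≤! 9)
      (λ s′ f → trans (f nₐ refl 0) (Reads.read-n rd)) outer
      ((λ X → trans (hcnt X) (sym (ind-zero (t 0) X))) ,
       record { fit-at = λ { _ _ (inj₁ ()) ; _ _ (inj₂ (_ , ())) } ; nxt-at = λ { _ _ (inj₁ ()) ; _ _ (inj₂ (_ , ())) } ; nowhere = λ a → inj₂ (hfit a , hnxt a) }))
    λ s′ _ (_ , _ , F) → layout (s′ fitₐ) (s′ nxtₐ) F
    where
    outer : ∀ j s′ → j < n → s′ jₐ 0 ≡ j → Same rows s s′ → Counts (s′ cntₐ) j 0 × Filled (Before j 0) (s′ fitₐ) (s′ nxtₐ) →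
            Runs (FOR oₐ windowᵉ rowStep) s′ (20 + ℓ * (20 + 90))
              (λ s″ → Counts (s″ cntₐ) (suc j) 0 × Filled (Before (suc j) 0) (s″ fitₐ) (s″ nxtₐ))
    outer j s′ _ refl f (cnt , F) = weaken (+-monoʳ-≤ 20 (*-monoˡ-≤ 110 (w≤ℓ j))) (conseq
      (for oₐ windowᵉ rowStep (w j) 90 (λ o s″ → Counts (s″ cntₐ) j o × Filled (Before j o) (s″ fitₐ) (s″ nxtₐ)) s′ refl (7 ≤! 9)
        (λ s″ g → cong₂ _∸_ (trans (cong (s″ dlₐ) (g jₐ refl 0)) (d≡ s″ g)) (trans (cong (s″ relₐ) (g jₐ refl 0)) (t≡ s″ g)))
        (λ o s″ o<w ho g (cnt′ , F′) → rowStep-runs j o s″ o<w (g jₐ refl 0) ho (t≡ s″ g) (d≡ s″ g)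
          (trans (g ptₐ refl j) (trans (f ptₐ refl j) (Reads.read-p rd j)))
          (λ X → trans (g posₐ refl X) (trans (f posₐ refl X) (hpos X))) cnt′ F′)
        (cnt , F))
      λ s″ _ (_ , cnt′ , F′) →
        (λ X → trans (cnt′ X) (sym (trans (cong (rk X (suc j) +_) (ind-zero (t (suc j)) X)) (+-identityʳ _)))) ,
        filled-map up down F′)
      where
      d≡ : ∀ s″ → Same (FOR oₐ windowᵉ rowStep) s′ s″ → s″ dlₐ j ≡ d j
      d≡ s″ g = trans (g dlₐ refl j) (trans (f dlₐ refl j) (Reads.read-d rd j))
      t≡ : ∀ s″ → Same (FOR oₐ windowᵉ rowStep) s′ s″ → s″ relₐ j ≡ t j
      t≡ s″ g = trans (g relₐ refl j) (trans (f relₐ refl j) (Reads.read-t rd j))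
      up : ∀ i a → Before j (w j) i a → Before (suc j) 0 i a
      up i a (inj₁ (l , la)) = inj₁ (m<n⇒m<1+n l , la)
      up i a (inj₂ (refl , la)) = inj₁ (≤-refl , la)
      down : ∀ i a → Before (suc j) 0 i a → Before j (w j) i a
      down i a (inj₁ (l , la)) with m<1+n⇒m<n∨m≡n l
      ... | inj₁ lt   = inj₁ (lt , la)
      ... | inj₂ refl = inj₂ (refl , la)
    layout : ∀ fit nxt → Filled (Before n 0) fit nxt → Layout A R ℓ vt w p slot (Table fit) (Table nxt)
    layout fit nxt F = record
      { inside = inside ; p≤w = p≤w ; p>0 = p>0 ; p≤ℓ = λ j → ≤-trans (p≤w j) (w≤ℓ j)
      ; slot<A = slot<A ; slot-inj = slot-inj
      ; fits = λ j o l le → proj₁ (fit-at j o (done j o l)) le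
      ; misfits = λ j o l lt → proj₂ (fit-at j o (done j o l)) lt
      ; stays = λ j o l → proj₁ (nxt-at j o (done j o (<⇒≤ l))) l
      ; leaves = λ j o e → proj₂ (nxt-at j o (done j o (≤-reflexive e))) e
      ; vacant = λ h c _ c<A → case nowhere (suc h * A + c) of λ where
          (inj₂ z) → inj₂ z
          (inj₁ (j , o , inj₁ (_ , l) , e)) → case address-injective {h} {vt j + o} c<A (slot<A j o l) e of λ where
            (refl , refl) → inj₁ (j , o , l , refl , refl)
      }
      where
      open Filled F
      done : ∀ j o → o < w j → Before n 0 j o
      done j o l = inj₁ (w>0⇒<n j (≤-trans (s≤s z≤n) l) , l)

-- Counting

bit : ∀ {P : Set} → Dec P → ℕ
bit (yes _) = 1
bit (no _)  = 0

count : ∀ {P : ℕ → Set} → (∀ j → Dec (P j)) → ℕ → ℕ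
count P? zero    = 0
count P? (suc n) = count P? n + bit (P? n)

bit-⊎ : ∀ {P Q R : Set} (p : Dec P) (q : Dec Q) (r : Dec R) → (P → Q ⊎ R) → bit p ≤ bit q + bit r
bit-⊎ (no _)  q       r       f = z≤n
bit-⊎ (yes p) (yes _) r       f = s≤s z≤n
bit-⊎ (yes p) (no ¬q) (yes _) f = s≤s z≤n
bit-⊎ (yes p) (no ¬q) (no ¬r) f with f p
... | inj₁ q = contradiction q ¬q
... | inj₂ r = contradiction r ¬r

count-⊎ : ∀ {P Q R : ℕ → Set} (P? : ∀ j → Dec (P j)) (Q? : ∀ j → Dec (Q j)) (R? : ∀ j → Dec (R j)) →
          (∀ j → P j → Q j ⊎ R j) → ∀ n → count P? n ≤ count Q? n + count R? n
count-⊎ P? Q? R? f zero    = z≤n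
count-⊎ P? Q? R? f (suc n) = lin 0 (+-mono-≤ (count-⊎ P? Q? R? f n) (bit-⊎ (P? n) (Q? n) (R? n) (f n)))
  (rearrange (count P? n) (count Q? n) (count R? n) (bit (P? n)) (bit (Q? n)) (bit (R? n)))
  where
  rearrange : ∀ a b c x y z → a + x + (b + c + (y + z)) + 0 ≡ b + y + (c + z) + (a + x)
  rearrange a b c x y z = solve (a ∷ b ∷ c ∷ x ∷ y ∷ z ∷ [])

count-none : ∀ {P : ℕ → Set} (P? : ∀ j → Dec (P j)) n → (∀ j → ¬ P j) → count P? n ≡ 0
count-none P? zero    none = refl
count-none P? (suc n) none with P? n
... | yes p = contradiction p (none n)
... | no _  = trans (+-identityʳ _) (count-none P? n none)

count-surj : ∀ {P : ℕ → Set} (P? : ∀ j → Dec (P j)) n c → c < count P? n → ∃[ j ] (j < n × P j × count P? j ≡ c)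
count-surj P? (suc n) c lt with c <? count P? n
... | yes l with count-surj P? n c l
...   | j , j<n , r = j , m<n⇒m<1+n j<n , r
count-surj P? (suc n) c lt | no ge with P? n
... | yes p = n , ≤-refl , p , ≤-antisym (≮⇒≥ ge) (≤-pred (≤-trans lt (≤-reflexive (+-comm (count P? n) 1))))
... | no _  = contradiction (≤-trans lt (≤-reflexive (+-identityʳ _))) ge

-- Feasibility with natural numbers as jobs and machines, matching the indices of the arrays; values
-- at indices from n on are unconstrained.
record Feasible (n m : ℕ) (t d p s μ : ℕ → ℕ) : Set where
  field
    on    : ∀ j → j < n → μ j < m
    from  : ∀ j → j < n → t j ≤ s j
    until : ∀ j → j < n → s j + p j ≤ d j
    alone : ∀ i j τ → i < n → j < n → μ i ≡ μ j → s i ≤ τ → τ < s i + p i → s j ≤ τ → τ < s j + p j → i ≡ j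

module Volume {n m : ℕ} {t d p s μ : ℕ → ℕ} (F : Feasible n m t d p s μ) where

  open Feasible F
  open Windows t d p

  -- The volume argument: the first U units of every counted job occupy pairs of machine and time in
  -- a box of m · len cells, and `alone` makes this assignment injective.
  packing : ∀ {P : ℕ → Set} (P? : ∀ j → Dec (P j)) U lo len →
            (∀ j → j < n → P j → U ≤ p j × lo ≤ s j × s j + U ≤ lo + len) → count P? n * U ≤ m * len
  packing {P} P? U lo len fit = injective⇒≤ {f = f} f-injective
    where
    C = count P? n
    job : ∀ (c : Fin C) → ∃[ j ] (j < n × P j × count P? j ≡ toℕ c)
    job c = count-surj P? n (toℕ c) (toℕ<n c)
    place : ∀ j → j < n → P j → (o : Fin U) → s j + toℕ o ∸ lo < len
    place j j<n pj o with fit j j<n pj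
    ... | _ , l , r = +-cancelˡ-< lo _ _ (≤-trans (s≤s (≤-reflexive (m+[n∸m]≡n (≤-trans l (m≤m+n (s j) (toℕ o))))))
                        (≤-trans (+-monoʳ-< (s j) (toℕ<n o)) r))
    g : Fin C × Fin U → Fin (m * len)
    g (c , o) with job c
    ... | j , j<n , pj , _ = combine (fromℕ< (on j j<n)) (fromℕ< (place j j<n pj o))
    g-injective : ∀ x y → g x ≡ g y → x ≡ y
    g-injective (c , o) (c′ , o′) e with job c | job c′
    ... | j , j<n , pj , q | j′ , j′<n , pj′ , q′
      with combine-injective (fromℕ< (on j j<n)) (fromℕ< (place j j<n pj o)) (fromℕ< (on j′ j′<n)) (fromℕ< (place j′ j′<n pj′ o′)) e
    ... | e₁ , e₂ with fit j j<n pj | fit j′ j′<n pj′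
    ...   | U≤p , l , _ | U≤p′ , l′ , _ = cong₂ _,_ c≡ (toℕ-injective o≡)
      where
      τ≡ : s j + toℕ o ≡ s j′ + toℕ o′
      τ≡ = ∸-cancelʳ-≡ (≤-trans l (m≤m+n (s j) (toℕ o))) (≤-trans l′ (m≤m+n (s j′) (toℕ o′)))
             (trans (sym (toℕ-fromℕ< _)) (trans (cong toℕ e₂) (toℕ-fromℕ< _)))
      μ≡ : μ j ≡ μ j′
      μ≡ = trans (sym (toℕ-fromℕ< _)) (trans (cong toℕ e₁) (toℕ-fromℕ< _))
      j≡ : j ≡ j′
      j≡ = alone j j′ (s j + toℕ o) j<n j′<n μ≡ (m≤m+n (s j) _) (+-monoʳ-< (s j) (≤-trans (toℕ<n o) U≤p))
             (≤-trans (m≤m+n (s j′) (toℕ o′)) (≤-reflexive (sym τ≡)))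
             (≤-trans (s≤s (≤-reflexive τ≡)) (+-monoʳ-< (s j′) (≤-trans (toℕ<n o′) U≤p′)))
      c≡ : c ≡ c′
      c≡ = toℕ-injective (trans (sym q) (trans (cong (count P?) j≡) q′))
      o≡ : toℕ o ≡ toℕ o′
      o≡ = +-cancelˡ-≡ (s j) _ _ (trans τ≡ (cong (λ x → s x + toℕ o′) (sym j≡)))
    f : Fin (C * U) → Fin (m * len)
    f x = g (remQuot {C} U x)
    f-injective : Injective _≡_ _≡_ f
    f-injective {x} {y} e = trans (sym (combine-remQuot {C} U x))
      (trans (cong (λ z → combine (proj₁ z) (proj₂ z)) (g-injective (remQuot {C} U x) (remQuot {C} U y) e)) (combine-remQuot {C} U y))

  act? : ∀ X j → Dec (Act j X)
  act? X j = (t j <? X) ×-dec (X ≤? t j + w j)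

  rk-count : ∀ X k → rk X k ≡ count (act? X) k
  rk-count X zero    = refl
  rk-count X (suc k) = cong₂ _+_ (rk-count X k) ind-bit
    where
    ind-bit : ind (t k) (w k) X ≡ bit (act? X k)
    ind-bit with act? X k
    ... | yes _ = refl
    ... | no _  = refl

  d≤t+w : ∀ j → d j ≤ t j + w j
  d≤t+w j = m≤n+m∸n (d j) (t j)

  -- Packing with unit length: with windows of at most one slot, the jobs active in a slot all run
  -- in that slot.
  unit-rank : (∀ j → 0 < w j → 0 < p j) → (∀ j → w j ≤ 1) → ∀ X → rk X n ≤ m
  unit-rank p>0 w≤1 zero    = ≤-trans (≤-reflexive (trans (rk-count 0 n) (count-none (act? 0) n λ { j (() , _) }))) z≤n
  unit-rank p>0 w≤1 (suc x) = subst₂ _≤_ (trans (*-identityʳ _) (sym (rk-count (suc x) n))) (*-identityʳ m)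
    (packing (act? (suc x)) 1 x 1 λ j j<n a → let
        w>0 = positive j a
        x≤s = ≤-trans (≤-pred (≤-trans (proj₂ a) (≤-trans (+-monoʳ-≤ (t j) (w≤1 j)) (≤-reflexive (+-comm (t j) 1))))) (from j j<n)
      in p>0 j w>0 , x≤s ,
         ≤-trans (+-monoʳ-≤ (s j) (p>0 j w>0)) (≤-trans (until j j<n) (≤-trans (d≤t+w j) (+-mono-≤ (≤-pred (proj₁ a)) (w≤1 j)))))
    where
    positive : ∀ j → Act j (suc x) → 0 < w j
    positive j (l , r) = +-cancelˡ-< (t j) _ _ (≤-trans (s≤s (≤-reflexive (+-identityʳ (t j)))) (≤-trans l r))

  -- Jobs active in the slot x with processing time in [2^e, 2^(e+1)) run
  -- within distance 2^(e+1) L of x; so a slot has few of them on each scale e.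
  module _ (L : ℕ) (w≤Lp : ∀ j → w j ≤ L * p j) where

    Small : ℕ → ℕ → ℕ → Set
    Small X e j = Act j X × p j < 2 ^ e

    Scale : ℕ → ℕ → ℕ → Set
    Scale X e j = Act j X × 2 ^ e ≤ p j × p j < 2 ^ suc e

    small? : ∀ X e j → Dec (Small X e j)
    small? X e j = act? X j ×-dec (p j <? 2 ^ e)

    scale? : ∀ X e j → Dec (Scale X e j)
    scale? X e j = act? X j ×-dec ((2 ^ e ≤? p j) ×-dec (p j <? 2 ^ suc e))

    -- Here the 4 arises: windows have length at most V = L · 2^(e+1), so those containing the slot
    -- lie in a stretch of length 2V. Packing with U = 2^e bounds the count times 2^e by m · 2V = m
    -- · 4L · 2^e.
    scale-≤ : ∀ X e → count (scale? X e) n ≤ m * (4 * L)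
    scale-≤ X e = *-cancelʳ-≤ _ _ (2 ^ e) {{m^n≢0 2 e}} (≤-trans
      (packing (scale? X e) (2 ^ e) (X ∸ suc V) (V + V) λ j j<n ((l , r) , lo , hi) → let
          w≤V = ≤-trans (w≤Lp j) (*-monoʳ-≤ L (<⇒≤ hi))
        in lo ,
           ≤-trans (m≤n+o⇒m∸n≤o X (suc V) (≤-trans r (≤-trans (+-monoʳ-≤ (t j) w≤V) (≤-trans (≤-reflexive (+-comm (t j) V)) (n≤1+n (V + t j)))))) (from j j<n) ,
           ≤-trans (+-monoʳ-≤ (s j) lo) (≤-trans (until j j<n) (≤-trans (d≤t+w j) (≤-trans (+-monoʳ-≤ (t j) w≤V)
             (≤-pred (≤-trans (+-monoˡ-≤ V l) (≤-trans (+-monoˡ-≤ V (m≤n+m∸n X (suc V)))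
                (≤-reflexive (rearrange V (X ∸ suc V))))))))))
      (≤-reflexive (regroup m L (2 ^ e))))
      where
      V = L * 2 ^ suc e
      rearrange : ∀ V y → suc V + y + V ≡ suc (y + (V + V))
      rearrange V y = solve (V ∷ y ∷ [])
      regroup : ∀ m L x → m * (L * (x + (x + 0)) + L * (x + (x + 0))) ≡ m * (4 * L) * x
      regroup m L x = solve (m ∷ L ∷ x ∷ [])

    small-≤ : ∀ X e → count (small? X e) n ≤ e * (m * (4 * L))
    small-≤ X zero    = ≤-reflexive (count-none (small? X 0) n λ j ((l , r) , p<1) →
      <⇒≱ l (≤-trans r (≤-trans (+-monoʳ-≤ (t j) (≤-trans (w≤Lp j) (≤-reflexive (trans (cong (L *_) (n<1⇒n≡0 p<1)) (*-zeroʳ L))))) (≤-reflexive (+-identityʳ (t j))))))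
    small-≤ X (suc e) = ≤-trans
      (count-⊎ (small? X (suc e)) (scale? X e) (small? X e)
        (λ j (a , lt) → case 2 ^ e ≤? p j of λ where
          (yes le) → inj₁ (a , le , lt)
          (no nl) → inj₂ (a , ≰⇒> nl)) n)
      (+-mono-≤ (scale-≤ X e) (small-≤ X e))

    active-rank : ∀ S → (∀ j → p j < 2 ^ S) → ∀ X → rk X n ≤ S * (m * (4 * L))
    active-rank S p< X = ≤-trans (≤-reflexive (rk-count X n)) (≤-trans
      -- With an empty third predicate, `count-⊎` is the monotonicity of `count`.
      (count-⊎ (act? X) (small? X S) (λ _ → no (λ ())) (λ j a → inj₁ (a , p< j)) n)
      (≤-trans (≤-reflexive (trans (cong (count (small? X S) n +_) (count-none {λ _ → ⊥} (λ _ → no (λ ())) n (λ _ ()))) (+-identityʳ _))) (small-≤ X S)))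

-- Scanning the input, and parameters

module Scanning (t d p : ℕ → ℕ) (n m : ℕ) where

  open Windows t d p

  u : ℕ → ℕ
  u j = (d j ∸ t j) + (t j ∸ d j)

  Scanned : ℕ → State → Set
  Scanned k s = (∀ j → j < k → u j ≤ s ℓₐ 0) × (∀ B → (∀ j → j < k → u j ≤ B) → s ℓₐ 0 ≤ B) ×
                (s badₐ 0 ≡ 0 → ∀ j → j < k → t j + p j ≤ d j) × (s badₐ 0 ≢ 0 → ∃[ j ] (j < k × d j < t j + p j))

  scan-runs : ∀ s → Reads n m s → s ℓₐ 0 ≡ 0 → s badₐ 0 ≡ 0 → Runs scan s (20 + n * (20 + 60)) (Scanned n)
  scan-runs s rd hℓ hb = conseq
    (for jₐ (var nₐ) body n 60 Scanned s refl (2 ≤! 9) (λ s′ f → trans (f nₐ refl 0) (Reads.read-n rd)) step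
      ((λ _ ()) , (λ B _ → ≤-trans (≤-reflexive hℓ) z≤n) , (λ _ _ ()) , λ nz → contradiction hb nz))
    λ _ _ → proj₂
    where
    widen wrong body : Program
    widen = IF widthᵉ ⊖ var ℓₐ THEN ℓₐ ≔ widthᵉ ELSE skip
    wrong = IF (relₐ [ var jₐ ] ⊕ ptₐ [ var jₐ ]) ⊖ dlₐ [ var jₐ ] THEN badₐ ≔ lit 1 ELSE skip
    body = widen ⨾ wrong
    step : ∀ j s′ → j < n → s′ jₐ 0 ≡ j → Same scan s s′ → Scanned j s′ → Runs body s′ 60 (λ s″ → Scanned (suc j) (s″ [ jₐ , 0 ↦ suc j ]))
    step j s′ j<n refl f (ub , lub , ok , bad) = weaken (_ ≤! 60)
      (if-runs {t = 17} {Q = λ s″ → s″ ℓₐ 0 ≡ s′ ℓₐ 0 ⊔ u j}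
        (λ nz → weaken (_ ≤! 17) (assign (trans u≡ (sym (m≤n⇒m⊔n≡n (<⇒≤ (subst (s′ ℓₐ 0 <_) u≡ (m∸n≢0⇒n<m nz))))))))
        (λ z → weaken (_ ≤! 17) (skip-runs (sym (m≥n⇒m⊔n≡m (subst (_≤ s′ ℓₐ 0) u≡ (m∸n≡0⇒m≤n z))))))
      ▹ λ s₁ f₁ ℓ≡ → let
          grown : (∀ i → i < suc j → u i ≤ s₁ ℓₐ 0) × (∀ B → (∀ i → i < suc j → u i ≤ B) → s₁ ℓₐ 0 ≤ B)
          grown = (λ i lt → ≤-trans (case m<1+n⇒m<n∨m≡n lt of λ where
                      (inj₁ l) → ≤-trans (ub i l) (m≤m⊔n (s′ ℓₐ 0) (u j))
                      (inj₂ refl) → m≤n⊔m (s′ ℓₐ 0) (u j)) (≤-reflexive (sym ℓ≡))) ,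
                  (λ B h → ≤-trans (≤-reflexive ℓ≡) (⊔-lub (lub B λ i l → h i (m<n⇒m<1+n l)) (h j ≤-refl)))
          bad≡ = f₁ badₐ refl 0
          j≡ = f₁ jₐ refl 0
          tp≡ : s₁ relₐ (s₁ jₐ 0) + s₁ ptₐ (s₁ jₐ 0) ≡ t j + p j
          tp≡ = cong₂ _+_ (trans (f₁ relₐ refl _) (trans (cong (s′ relₐ) j≡) t≡)) (trans (f₁ ptₐ refl _) (trans (cong (s′ ptₐ) j≡) p≡))
          d≡₁ : s₁ dlₐ (s₁ jₐ 0) ≡ d j
          d≡₁ = trans (f₁ dlₐ refl _) (trans (cong (s′ dlₐ) j≡) d≡)
        in if-runs {t = 3}
        (λ nz → assign (proj₁ grown , proj₂ grown , (λ ()) , λ _ → j , ≤-refl , subst₂ _<_ d≡₁ tp≡ (m∸n≢0⇒n<m nz)))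
        (λ z → weaken (_ ≤! 3) (skip-runs (proj₁ grown , proj₂ grown ,
          (λ e i lt → case m<1+n⇒m<n∨m≡n lt of λ where
            (inj₁ l) → ok (trans (sym bad≡) e) i l
            (inj₂ refl) → subst₂ _≤_ tp≡ d≡₁ (m∸n≡0⇒m≤n z)) ,
          λ nz → case bad (λ e → nz (trans bad≡ e)) of λ { (i , l , r) → i , m<n⇒m<1+n l , r }))))
      where
      t≡ = trans (f relₐ refl j) (Reads.read-t rd j)
      d≡ = trans (f dlₐ refl j) (Reads.read-d rd j)
      p≡ = trans (f ptₐ refl j) (Reads.read-p rd j)
      u≡ : (s′ dlₐ j ∸ s′ relₐ j) + (s′ relₐ j ∸ s′ dlₐ j) ≡ u j
      u≡ = cong₂ _+_ (cong₂ _∸_ d≡ t≡) (cong₂ _∸_ t≡ d≡)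

n<2^n : ∀ n → n < 2 ^ n
n<2^n zero    = s≤s z≤n
n<2^n (suc n) = ≤-trans (+-mono-≤ (m^n>0 2 n) (n<2^n n)) (≤-reflexive (cong (2 ^ n +_) (sym (+-identityʳ (2 ^ n)))))

-- Both bounds on S are used: `ℓ < 2 ^ S` puts all processing times on S scales, and `2 ^ S ≤ 2 * ℓ`
-- keeps 2^A = (2^S)^(4mL) a power of ℓ with exponent O(mL). In the invariant, `S ≡ i` records that
-- every round has doubled, so ℓ + 1 rounds suffice by `n<2^n`.
capacity-runs : ∀ b m ℓ s → 1 ≤ ℓ → s mₐ 0 ≡ m → s ℓₐ 0 ≡ ℓ → s stepₐ 0 ≡ 0 → s Aₐ 0 ≡ 0 →
                Runs (capacity b) s (20 + m * (20 + 6) + (23 + (ℓ + 1) * (20 + 30)))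
                  (λ s′ → ∃[ S ] (s′ Aₐ 0 ≡ S * (m * b) × ℓ < 2 ^ S × 2 ^ S ≤ 2 * ℓ))
capacity-runs b m ℓ s 1≤ℓ hm hℓ h0 hA =
  for iₐ (var mₐ) (stepₐ ≔ var stepₐ ⊕ lit b) m 6 (λ i s′ → s′ stepₐ 0 ≡ i * b) s refl (2 ≤! 9)
    (λ s′ f → trans (f mₐ refl 0) hm)
    (λ i s′ _ _ f e → assign (trans (cong (_+ b) e) (+-comm (i * b) b))) h0
  ▹ λ s₁ f (_ , e₁) → assign-seq (conseq
    (for iₐ (var ℓₐ ⊕ lit 1) body (ℓ + 1) 30 Inv _ refl (4 ≤! 9)
      (λ s′ g → cong (_+ 1) (trans (g ℓₐ refl 0) (trans (f ℓₐ refl 0) hℓ)))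
      (λ i s′ _ _ g → step i s′ (trans (g ℓₐ refl 0) (trans (f ℓₐ refl 0) hℓ)) (trans (g stepₐ refl 0) e₁))
      (0 , refl , trans (f Aₐ refl 0) hA , ≤-trans 1≤ℓ (m≤m+n ℓ (ℓ + 0)) , inj₂ refl))
    λ s′ _ → λ where
      (_ , S , _ , a , le , inj₁ lt) → S , a , lt , le
      (_ , S , _ , a , le , inj₂ refl) → S , a , ≤-trans (s≤s (m≤m+n ℓ 1)) (n<2^n S) , le)
  where
  body : Program
  body = IF (var ℓₐ ⊕ lit 1) ⊖ var powₐ THEN (powₐ ≔ var powₐ ⊕ var powₐ ⨾ Aₐ ≔ var Aₐ ⊕ var stepₐ) ELSE skip
  Inv : ℕ → State → Set
  Inv i s = ∃[ S ] (s powₐ 0 ≡ 2 ^ S × s Aₐ 0 ≡ S * (m * b) × 2 ^ S ≤ 2 * ℓ × (ℓ < 2 ^ S ⊎ S ≡ i))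
  step : ∀ i s′ → s′ ℓₐ 0 ≡ ℓ → s′ stepₐ 0 ≡ m * b → Inv i s′ → Runs body s′ 30 (λ s″ → Inv (suc i) (s″ [ iₐ , 0 ↦ suc i ]))
  step i s′ refl hs (S , e , a , le , r) = weaken (_ ≤! 30) (if-runs {t = 14}
    (λ nz → let small = ≤-pred (subst₂ _<_ e (+-comm _ 1) (m∸n≢0⇒n<m nz)) in assign-seq (assign (suc S ,
      trans (cong₂ _+_ e e) (cong (2 ^ S +_) (sym (+-identityʳ (2 ^ S)))) ,
      trans (cong₂ _+_ a hs) (+-comm (S * (m * b)) (m * b)) ,
      *-monoʳ-≤ 2 small ,
      (case r of λ where
        (inj₁ lt) → contradiction small (<⇒≱ lt)
        (inj₂ q) → inj₂ (cong suc q)))))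
    (λ z → weaken (_ ≤! 14) (skip-runs (S , e , a , le ,
      inj₁ (≤-trans (≤-reflexive (+-comm 1 ℓ)) (≤-trans (m∸n≡0⇒m≤n z) (≤-reflexive e)))))))

module Weighing (A m ℓ : ℕ) where

  open Radix A m ℓ

  weights-runs : ∀ s → s Aₐ 0 ≡ A → s mₐ 0 ≡ m → s ℓₐ 0 ≡ ℓ →
                 Runs weights s (10 + (20 + K * (20 + (50 + ℓ * (20 + 7))) + 4))
                   (λ s′ → s′ Kₐ 0 ≡ K × (∀ i → i < K → s′ wtₐ i ≡ wt i) × s′ Nₐ 0 ≡ wt K)
  weights-runs s hA hm hℓ = assign-seq (assign-seq (
    for iₐ (var Kₐ) body K (50 + ℓ * (20 + 7)) Inv _ refl (2 ≤! 9)
      (λ s′ f → trans (f Kₐ refl 0) (cong₂ _+_ hA hm))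
      (λ i s′ _ hi f I → step i s′ hi (trans (f Aₐ refl 0) hA) (trans (f ℓₐ refl 0) hℓ) I)
      (refl , λ _ ())
    ▹ λ s₁ f (_ , e , W) → assign (trans (f Kₐ refl 0) (cong₂ _+_ hA hm) , W , e)))
    where
    body : Program
    body =
      wtₐ [ var iₐ ]≔ var wₐ ⨾
      IF var Aₐ ⊖ var iₐ
      THEN wₐ ≔ var wₐ ⊕ var wₐ
      ELSE (accₐ ≔ var wₐ ⨾ FOR oₐ (var ℓₐ) (accₐ ≔ var accₐ ⊕ var wₐ) ⨾ wₐ ≔ var accₐ)
    Inv : ℕ → State → Set
    Inv i s = s wₐ 0 ≡ wt i × (∀ k → k < i → s wtₐ k ≡ wt k)
    step : ∀ i s′ → s′ iₐ 0 ≡ i → s′ Aₐ 0 ≡ A → s′ ℓₐ 0 ≡ ℓ → Inv i s′ →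
           Runs body s′ (50 + ℓ * (20 + 7)) (λ s″ → Inv (suc i) (s″ [ iₐ , 0 ↦ suc i ]))
    step i s′ refl hA hℓ (e , W) = weaken (bound (ℓ * 27)) (assign-seq (if-runs {t = 30 + ℓ * 27}
      (λ nz → weaken (≤-trans (_ ≤! 30) (m≤m+n 30 _)) (assign
        (trans (cong₂ _+_ e e) (trans (cong (wt i +_) (sym (+-identityʳ (wt i)))) (cong (_* wt i) (sym (rad-bit (subst (i <_) hA (m∸n≢0⇒n<m nz)))))) , stored)))
      (λ z → weaken (bound′ (ℓ * 27)) (assign-seq (
        for oₐ (var ℓₐ) (accₐ ≔ var accₐ ⊕ var wₐ) ℓ 7 (λ o s″ → s″ accₐ 0 ≡ suc o * wt i) _ refl (2 ≤! 9)
          (λ s″ g → trans (g ℓₐ refl 0) hℓ)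
          (λ o s″ _ _ g q → weaken (_ ≤! 7) (assign (trans (cong₂ _+_ q (trans (g wₐ refl 0) e)) (+-comm (suc o * wt i) (wt i)))))
          (trans e (sym (+-identityʳ (wt i))))
        ▹ λ s₂ g (_ , q) → assign (trans q (cong (_* wt i) (sym (rad-machine (subst (_≤ i) hA (m∸n≡0⇒m≤n z))))) ,
            λ k lt → trans (g wtₐ refl k) (stored k lt)))))))
      where
      bound : ∀ x → 11 + (30 + x) ≤ 50 + x
      bound x = +-monoˡ-≤ x (_ ≤! 50)
      bound′ : ∀ x → 4 + (20 + x + 4) ≤ 30 + x
      bound′ x = lin 2 (z≤n {0}) (solve (x ∷ []))
      stored : ∀ k → k < suc i → (s′ wtₐ [ i ⇐ s′ wₐ 0 ]) k ≡ wt k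
      stored k lt = upd-elim (s′ wtₐ) i _ k (_≡ wt k) (λ { refl → e }) (λ ne → W k (≤∧≢⇒< (≤-pred lt) (ne ∘ sym)))

-- Schedules in virtual time

Decided : Set → State → Set
Decided P s = (P × s 0 0 ≡ 1) ⊎ (¬ P × s 0 0 ≡ 0)

module Translation (t d p : ℕ → ℕ) (n m A ℓ : ℕ) (1≤A : 1 ≤ A) (1≤m : 1 ≤ m) (w≤ℓ : ∀ j → Windows.w t d p j ≤ ℓ)
                   (rk≤A : ∀ X → Windows.rk t d p X n ≤ A)
                   (w>0⇒<n : ∀ j → 0 < Windows.w t d p j → j < n)
                   (p≤w : ∀ j → p j ≤ Windows.w t d p j) (p>0 : ∀ j → 0 < Windows.w t d p j → 0 < p j)
                   (t≤d : ∀ j → j < n → t j ≤ d j)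
                   {R : ℕ} {pos vt : ℕ → ℕ} (TL : Walking.Timeline t d p n m A ℓ 1≤A w≤ℓ rk≤A R pos vt) where

  open Windows t d p
  open Walking t d p n m A ℓ 1≤A w≤ℓ rk≤A using (row-injective; module Timeline)
  open Timeline TL using (at)
  open Filling t d p n m A ℓ 1≤A w≤ℓ rk≤A w>0⇒<n p≤w p>0 TL using (same-slot)

  -- Offsets within the windows are kept and only the time axis changes. A job with empty window has
  -- processing time 0 by `p≤w`; it is put at its release on machine 0, which exists since m ≥ 1.
  plan⇒feasible : ∀ s μ → Plan m vt w p (λ j → 0 < w j) s μ → ∃[ s′ ] ∃[ μ′ ] Feasible n m t d p s′ μ′
  plan⇒feasible s μ P = (λ j → t j + offset j) , machine , record
    { on = on′ ; from = λ j _ → m≤m+n (t j) (offset j) ; until = until′ ; alone = alone }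
    where
    open Plan P
    offset machine : ℕ → ℕ
    offset j with 0 <? w j
    ... | yes _ = s j ∸ vt j
    ... | no _  = 0
    machine j with 0 <? w j
    ... | yes _ = μ j
    ... | no _  = 0
    on′ : ∀ j → j < n → machine j < m
    on′ j _ with 0 <? w j
    ... | yes z = on j z
    ... | no _  = 1≤m
    machine≡ : ∀ j → 0 < w j → machine j ≡ μ j
    machine≡ j z with 0 <? w j
    ... | yes _ = refl
    ... | no nz = contradiction z nz
    offset≡ : ∀ j → 0 < w j → vt j + offset j ≡ s j
    offset≡ j z with 0 <? w j
    ... | yes _ = m+[n∸m]≡n (from j z)
    ... | no nz = contradiction z nz
    offset+p≤w : ∀ j → offset j + p j ≤ w j
    offset+p≤w j with 0 <? w j
    ... | yes z = +-cancelˡ-≤ (vt j) _ _ (≤-trans (≤-reflexive (trans (sym (+-assoc (vt j) (s j ∸ vt j) (p j))) (cong (_+ p j) (m+[n∸m]≡n (from j z))))) (until j z))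
    ... | no _  = p≤w j
    until′ : ∀ j → j < n → t j + offset j + p j ≤ d j
    until′ j lt = ≤-trans (≤-reflexive (+-assoc (t j) (offset j) (p j))) (≤-trans (+-monoʳ-≤ (t j) (offset+p≤w j)) (≤-reflexive (m+[n∸m]≡n (t≤d j lt))))
    record Runs-at (j τ : ℕ) : Set where
      field
        o   : ℕ
        o<w : o < w j
        τ≡  : τ ≡ t j + o
        lo  : s j ≤ vt j + o
        hi  : vt j + o < s j + p j
    runs-at : ∀ j τ → t j + offset j ≤ τ → τ < t j + offset j + p j → Runs-at j τ
    runs-at j τ a b = record
      { o = o ; o<w = o<w ; τ≡ = sym τ≡
      ; lo = ≤-trans (≤-reflexive (sym (offset≡ j z))) (+-monoʳ-≤ (vt j) (+-cancelˡ-≤ (t j) _ _ (≤-trans a (≤-reflexive (sym τ≡)))))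
      ; hi = ≤-trans (+-monoʳ-< (vt j) o<) (≤-reflexive (trans (sym (+-assoc (vt j) _ _)) (cong (_+ p j) (offset≡ j z)))) }
      where
      o = τ ∸ t j
      τ≡ : t j + o ≡ τ
      τ≡ = m+[n∸m]≡n (≤-trans (m≤m+n (t j) (offset j)) a)
      o< : o < offset j + p j
      o< = +-cancelˡ-< (t j) _ _ (≤-trans (s≤s (≤-reflexive τ≡)) (≤-trans b (≤-reflexive (+-assoc (t j) (offset j) (p j)))))
      o<w : o < w j
      o<w = ≤-trans o< (offset+p≤w j)
      z : 0 < w j
      z = ≤-trans (s≤s z≤n) o<w
    alone : ∀ i j τ → i < n → j < n → machine i ≡ machine j → t i + offset i ≤ τ → τ < t i + offset i + p i →
            t j + offset j ≤ τ → τ < t j + offset j + p j → i ≡ j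
    alone i j τ _ _ e a b a′ b′ with i ≟ j
    ... | yes q = q
    ... | no ne = ⊥-elim (case apart i j z z′ (trans (sym (machine≡ i z)) (trans e (machine≡ j z′))) ne of λ where
        (inj₁ le) → <⇒≱ (I.hi) (≤-trans le (≤-trans J.lo (≤-reflexive (sym same))))
        (inj₂ le) → <⇒≱ (J.hi) (≤-trans le (≤-trans I.lo (≤-reflexive same))))
      where
      module I = Runs-at (runs-at i τ a b)
      module J = Runs-at (runs-at j τ a′ b′)
      z = ≤-trans (s≤s z≤n) I.o<w
      z′ = ≤-trans (s≤s z≤n) J.o<w
      same : vt i + I.o ≡ vt j + J.o
      same = row-injective (trans (sym (at i I.o I.o<w)) (trans (cong (λ x → pos (suc x)) (trans (sym I.τ≡) J.τ≡)) (at j J.o J.o<w)))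

  feasible⇒plan : ∀ s μ → Feasible n m t d p s μ → ∃[ s′ ] Plan m vt w p (λ j → 0 < w j) s′ μ
  feasible⇒plan s μ F = s′ , record
    { on = λ j z → on j (w>0⇒<n j z)
    ; from = λ j _ → m≤m+n (vt j) _
    ; until = λ j z → ≤-trans (≤-reflexive (+-assoc (vt j) _ _)) (+-monoʳ-≤ (vt j) (offset+p≤w j z))
    ; apart = apart
    }
    where
    open Feasible F
    s′ : ℕ → ℕ
    s′ j = vt j + (s j ∸ t j)
    offset+p≤w : ∀ j → 0 < w j → s j ∸ t j + p j ≤ w j
    offset+p≤w j z = +-cancelˡ-≤ (t j) _ _ (≤-trans (≤-reflexive (trans (sym (+-assoc (t j) _ _)) (cong (_+ p j) (m+[n∸m]≡n (from j lt)))))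
      (≤-trans (until j lt) (m≤n+m∸n (d j) (t j))))
      where lt = w>0⇒<n j z
    -- If two virtual intervals overlap on a machine, the later start lies in the window of the
    -- other job. By `same-slot` both offsets denote one real slot, and there `alone` applies.
    collide : ∀ i j → 0 < w i → 0 < w j → μ i ≡ μ j → s′ i ≤ s′ j → s′ j < s′ i + p i → i ≡ j
    collide i j z z′ e le lt = alone i j (s j) (w>0⇒<n i z) (w>0⇒<n j z′) e
        (≤-trans (≤-reflexive (sym si)) (≤-trans (+-monoʳ-≤ (t i) a≤b) (≤-reflexive sj)))
        (≤-trans (s≤s (≤-reflexive (sym sj))) (≤-trans (+-monoʳ-< (t i) b<) (≤-reflexive (trans (sym (+-assoc (t i) _ _)) (cong (_+ p i) si)))))
        ≤-refl (m<m+n (s j) (p>0 j z′))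
      where
      b = s′ j ∸ vt i
      vb : vt i + b ≡ s′ j
      vb = m+[n∸m]≡n (≤-trans (m≤m+n (vt i) _) le)
      a≤b : s i ∸ t i ≤ b
      a≤b = +-cancelˡ-≤ (vt i) _ _ (≤-trans le (≤-reflexive (sym vb)))
      b< : b < s i ∸ t i + p i
      b< = +-cancelˡ-< (vt i) _ _ (≤-trans (s≤s (≤-reflexive vb)) (≤-trans lt (≤-reflexive (+-assoc (vt i) _ _))))
      si : t i + (s i ∸ t i) ≡ s i
      si = m+[n∸m]≡n (from i (w>0⇒<n i z))
      o<w : s j ∸ t j < w j
      o<w = ≤-trans (m<m+n (s j ∸ t j) (p>0 j z′)) (offset+p≤w j z′)
      sj : t i + b ≡ s j
      sj = trans (suc-injective (same-slot i j b (s j ∸ t j) (≤-trans b< (offset+p≤w i z)) o<w vb)) (m+[n∸m]≡n (from j (w>0⇒<n j z′)))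
    apart : ∀ i j → 0 < w i → 0 < w j → μ i ≡ μ j → i ≢ j → s′ i + p i ≤ s′ j ⊎ s′ j + p j ≤ s′ i
    apart i j z z′ e ne with s′ i + p i ≤? s′ j | s′ j + p j ≤? s′ i
    ... | yes le | _ = inj₁ le
    ... | no _ | yes le = inj₂ le
    ... | no a | no b with ≤-total (s′ i) (s′ j)
    ...   | inj₁ le = contradiction (collide i j z z′ e le (≰⇒> a)) ne
    ...   | inj₂ le = contradiction (sym (collide j i z′ z (sym e) le (≰⇒> b))) ne

module Solving (t d p : ℕ → ℕ) (n m A ℓ : ℕ) (1≤n : 1 ≤ n) (1≤A : 1 ≤ A) (1≤m : 1 ≤ m)
               (w≤ℓ : ∀ j → Windows.w t d p j ≤ ℓ)
               (rk≤A : ∀ X → Windows.rk t d p X n ≤ A)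
               (w>0⇒<n : ∀ j → 0 < Windows.w t d p j → j < n)
               (p≤w : ∀ j → p j ≤ Windows.w t d p j) (p>0 : ∀ j → 0 < Windows.w t d p j → 0 < p j)
               (t≤d : ∀ j → j < n → t j ≤ d j)
               (room : Radix.Room A m ℓ) where

  open Windows t d p
  open Radix A m ℓ
  open Room room
  open Machine room using (N; Weights)
  open Powers N 64≤N
  open PerJob n 1≤n
  open Levels A m ℓ room
  open Walking t d p n m A ℓ 1≤A w≤ℓ rk≤A using (walk-runs; rows≤; module Timeline; Timeline)
  open Weighing A m ℓ using (weights-runs)

  Answer : Set
  Answer = ∃[ s ] ∃[ μ ] Feasible n m t d p s μ

  nℓ≤ : n * ℓ ≤n^ 1
  nℓ≤ = per-job 1 (one ℓ≤N)

  walk-time : 6 + (20 + n * 28 + (24 + (n + 1 + n * ℓ) * 60)) ≤n^ 9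
  walk-time = plusₙ 8 (once 8 (const 6 7)) (plusₙ 7 (plusₙ 6 (once 6 (const 20 5)) (per-job 6 (const 28 5)))
    (plusₙ 6 (once 6 (const 24 5)) (raiseₙ 4 6 (timesₙ 3 1 (plusₙ 2 (plusₙ 1 (≤-trans (≤-reflexive (sym (*-identityʳ n))) (per-job 1 (const 1 0))) (once 1 (const 1 0))) (raiseₙ 1 2 nℓ≤)) (const 60 0)))))

  rows-time : 20 + n * (20 + (20 + ℓ * (20 + 90))) ≤n^ 9
  rows-time = plusₙ 8 (once 8 (const 20 7)) (per-job 8 (plus 7 (const 20 6) (plus 6 (const 20 5) (raise 4 6 (times 1 3 (one ℓ≤N) (plus 2 (const 20 1) (plus 1 (const 45 0) (const 45 0))))))))

  weights-time : 10 + (20 + K * (20 + (50 + ℓ * (20 + 7))) + 4) ≤n^ 9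
  weights-time = once 9 (plus 8 (const 10 7) (plus 7 (plus 6 (const 20 5) (times 1 5 (one K≤N) (plus 4 (const 20 3) (plus 3 (const 50 2) (raise 2 3 (times 1 1 (one ℓ≤N) (const 27 0))))))) (const 4 6)))

  sweep-time : ∀ {R} → R ≤ n * ℓ → 27 + R * (20 + N ^ 28) ≤n^ 31
  sweep-time le = plusₙ 30 (once 30 (const 27 29)) (timesₙ 1 29 (≤-trans le nℓ≤) (plus 28 (const 20 27) ≤-refl))

  dynamic-runs : ∀ s → Reads n m s → s Aₐ 0 ≡ A → s ℓₐ 0 ≡ ℓ → (∀ X → s markₐ X ≡ rk X n) → (∀ X → s posₐ X ≡ 0) →
                 s xₐ 0 ≡ 0 → s rowsₐ 0 ≡ 0 → s nextₐ 0 ≡ 0 → (∀ X → s cntₐ X ≡ 0) → (∀ a → s fitₐ a ≡ 0) → (∀ a → s nxtₐ a ≡ 0) →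
                 s curₐ 0 ≡ 0 → (∀ a → s reachₐ a ≡ 0) →
                 Runs dynamicProgram s (n * N ^ 35) (Decided Answer)
  dynamic-runs s rd hA hℓ hmk hpos hx hR hnx hcnt hfit hnxt hcur hreach =
    -- The sweep dominates: at most nℓ rows of cost N^28 amount to n · N^31, and each of the four
    -- further sums adds one exponent.
    weaken (plusₙ 34 (raiseₙ 9 34 walk-time) (plusₙ 33 (raiseₙ 9 33 rows-time) (plusₙ 32 (raiseₙ 9 32 weights-time) ≤-refl)))
    (walk-runs s rd hA hℓ hmk hpos hx hR hnx w>0⇒<n
    ▹ λ s₁ f₁ (vt , TL) → let
        module Fl = Filling t d p n m A ℓ 1≤A w≤ℓ rk≤A w>0⇒<n p≤w p>0 TL
        module Tr = Translation t d p n m A ℓ 1≤A 1≤m w≤ℓ rk≤A w>0⇒<n p≤w p>0 t≤d TL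
      in Fl.rows-runs s₁ (reads-frame {walk} refl refl refl refl refl f₁ rd) (λ _ → refl)
           (λ X → trans (f₁ cntₐ refl X) (hcnt X)) (λ a → trans (f₁ fitₐ refl a) (hfit a)) (λ a → trans (f₁ nxtₐ refl a) (hnxt a))
    ▹ λ s₂ f₂ L → weights-runs s₂ (trans (f₂ Aₐ refl 0) (trans (f₁ Aₐ refl 0) hA)) (trans (f₂ mₐ refl 0) (trans (f₁ mₐ refl 0) (Reads.read-m rd))) (trans (f₂ ℓₐ refl 0) (trans (f₁ ℓₐ refl 0) hℓ))
    ▹ λ s₃ f₃ (hK , hw , hN) → let
        module Sm = Semantics {m = m} L
        module Sw = Sweep A m ℓ room (s₁ rowsₐ 0) (Fl.Table (s₂ fitₐ)) (Fl.Table (s₂ nxtₐ)) Sm.fit≤ℓ Sm.nxt<A Sm.nxt-injective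
        sweeping = Sw.sweep-runs s₃ (hK , hw) hN
          (trans (f₃ ℓₐ refl 0) (trans (f₂ ℓₐ refl 0) (trans (f₁ ℓₐ refl 0) hℓ)))
          (trans (f₃ Aₐ refl 0) (trans (f₂ Aₐ refl 0) (trans (f₁ Aₐ refl 0) hA)))
          (trans (f₃ mₐ refl 0) (trans (f₂ mₐ refl 0) (trans (f₁ mₐ refl 0) (Reads.read-m rd))))
          (trans (f₃ rowsₐ refl 0) (f₂ rowsₐ refl 0))
          (λ h c _ _ → f₃ fitₐ refl _) (λ h c _ _ → f₃ nxtₐ refl _)
          (trans (f₃ curₐ refl 0) (trans (f₂ curₐ refl 0) (trans (f₁ curₐ refl 0) hcur)))
          (λ a → trans (f₃ reachₐ refl a) (trans (f₂ reachₐ refl a) (trans (f₁ reachₐ refl a) (hreach a))))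
      in weaken (plusₙ 31 (sweep-time (rows≤ (Timeline.walked TL))) (once 31 (const 7 30)))
        (sweeping ▹ λ s₄ f₄ Lv → if-runs {t = 3}
        (λ nz → assign (inj₁ ((case Level.sound Lv 0 (≤-trans (1 ≤! 64) 64≤N) (subst (λ a → s₄ reachₐ a ≢ 0) (sym (+-identityʳ _)) nz) of λ where
          (D , _ , _ , r) → case Sm.reach⇒plan D r of λ where
            (σ , μ , P) → Tr.plan⇒feasible σ μ P) , refl)))
        (λ z → assign (inj₂ ((λ { (σ , μ , F) → case Tr.feasible⇒plan σ μ F of λ where
          (σ′ , P) → case Sm.Complete.plan⇒reach n w>0⇒<n 1≤ℓ σ′ μ P of λ where
            (D , bd , r , zs) → Level.complete Lv D bd r (trans (cong (s₄ reachₐ) (trans (cong (s₄ curₐ 0 +_) (Sw.enc-zero K zs)) (+-identityʳ _))) z) }) , refl)))))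

-- Bounding a real number by natural numbers

private
  ℕ→ℚᵘ : ℕ → ℚᵘ.ℚᵘ
  ℕ→ℚᵘ n = ℚᵘ.mkℚᵘ (ℤ.+ n) 0

  -- `ℕ→ℚ` divides by a gcd and does not compute on a variable. The unnormalised fraction does, so
  -- arithmetic is transported from there.
  unnormalise : ∀ n → ℚ.toℚᵘ (ℕ→ℚ n) ℚᵘ.≃ ℕ→ℚᵘ n
  unnormalise n = ℚₚ.toℚᵘ-fromℚᵘ (ℕ→ℚᵘ n)

ℕ→ℚ-* : ∀ a b → ℕ→ℚ (a * b) ≡ ℕ→ℚ a ℚ.* ℕ→ℚ b
ℕ→ℚ-* a b = ℚₚ.toℚᵘ-injective (ℚᵘₚ.≃-trans (unnormalise (a * b)) (ℚᵘₚ.≃-sym (ℚᵘₚ.≃-trans (ℚₚ.toℚᵘ-homo-* (ℕ→ℚ a) (ℕ→ℚ b))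
  (ℚᵘₚ.≃-trans (ℚᵘₚ.*-cong (unnormalise a) (unnormalise b)) (ℚᵘ.*≡* (cong (ℤ._* ℤ.1ℤ) (sym (ℤₚ.pos-* a b))))))))

ℕ→ℚ-+ : ∀ a b → ℕ→ℚ (a + b) ≡ ℕ→ℚ a ℚ.+ ℕ→ℚ b
ℕ→ℚ-+ a b = ℚₚ.toℚᵘ-injective (ℚᵘₚ.≃-trans (unnormalise (a + b)) (ℚᵘₚ.≃-sym (ℚᵘₚ.≃-trans (ℚₚ.toℚᵘ-homo-+ (ℕ→ℚ a) (ℕ→ℚ b))
  (ℚᵘₚ.≃-trans (ℚᵘₚ.+-cong (unnormalise a) (unnormalise b)) (ℚᵘ.*≡* (cong (ℤ._* ℤ.1ℤ) (cong₂ ℤ._+_ (ℤₚ.*-identityʳ (ℤ.+ a)) (ℤₚ.*-identityʳ (ℤ.+ b)))))))))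

ℕ→ℚ-cancel-≤ : ∀ {a b} → ℕ→ℚ a ℚ.≤ ℕ→ℚ b → a ≤ b
ℕ→ℚ-cancel-≤ {a} {b} le with ℚᵘₚ.≤-respˡ-≃ (unnormalise a) (ℚᵘₚ.≤-respʳ-≃ (unnormalise b) (ℚₚ.toℚᵘ-mono-≤ le))
... | ℚᵘ.*≤* h = ℤₚ.drop‿+≤+ (subst₂ ℤ._≤_ (ℤₚ.*-identityʳ (ℤ.+ a)) (ℤₚ.*-identityʳ (ℤ.+ b)) h)

ℕ→ℚ-mono-< : ∀ {a b} → a < b → ℕ→ℚ a ℚ.< ℕ→ℚ b
ℕ→ℚ-mono-< lt = ℚₚ.≰⇒> λ le → <⇒≱ lt (ℕ→ℚ-cancel-≤ le)

ceiling : ∀ u → ∃[ B ] u ℚ.< ℕ→ℚ B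
ceiling u@(ℚ.mkℚ z k _) = B , ℚₚ.toℚᵘ-cancel-< (ℚᵘₚ.<-respʳ-≃ (ℚᵘₚ.≃-sym (unnormalise B)) (ℚᵘ.*<* (begin-strict
    z ℤ.* ℤ.1ℤ             ≡⟨ ℤₚ.*-identityʳ z ⟩
    z                      ≤⟨ ≤-∣∣ z ⟩
    ℤ.+ ℤ.∣ z ∣            <⟨ ℤ.+<+ (n<1+n ℤ.∣ z ∣) ⟩
    ℤ.+ B                  ≤⟨ ℤ.+≤+ (m≤m*n B (suc k)) ⟩
    ℤ.+ (B * suc k)        ≡⟨ ℤₚ.pos-* B (suc k) ⟩
    ℤ.+ B ℤ.* ℤ.+ (suc k)  ∎)))
  where
  open ℤₚ.≤-Reasoning
  B = suc ℤ.∣ z ∣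
  ≤-∣∣ : ∀ i → i ℤ.≤ ℤ.+ ℤ.∣ i ∣
  ≤-∣∣ (ℤ.+ _)      = ℤₚ.≤-refl
  ≤-∣∣ (ℤ.-[1+ _ ]) = ℤ.-≤+

module Rounding (lam : ℝ) (1≤lam : 1 ≤ lam · 1) where

  open ℝ lam

  U-up : ∀ {q r} → q ℚ.< r → U q → U r
  U-up {q} {r} lt u = Equivalence.from (U-rounded r) (q , lt , u)

  L<U : ∀ {q r} → L q → U r → q ℚ.< r
  L<U {q} {r} l u = ℚₚ.≰⇒> λ le → disjoint q (l , up le)
    where
    up : r ℚ.≤ q → U q
    up le with r ℚₚ.≟ q
    ... | yes refl = u
    ... | no ne    = U-up (ℚₚ.≰⇒> λ le′ → ne (ℚₚ.≤-antisym le le′)) u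

  -- The product with lam is an infimum over the rationals above lam, and b is one of them.
  cancel : ∀ {a b} → U (ℕ→ℚ b) → ∀ c → a ≤ lam · c → a ≤ b * c
  cancel {a} {b} u c h = ℕ→ℚ-cancel-≤ (subst (ℕ→ℚ a ℚ.≤_) (sym (ℕ→ℚ-* b c)) (h (ℕ→ℚ b) u))

  -- Some natural number lies in (lam , lam + 2]; as 1 ≤ lam, it is at most
  -- 3 lam.
  roof : ∃[ b ] (1 ≤ b × U (ℕ→ℚ b) × (∀ a → b * a ≤ lam · (3 * a)))
  roof with U-inhabited
  ... | u , Uu with ceiling u
  ...   | B , u<B = descend B (U-up u<B Uu)
    where
    -- Each of the three summands a, a and k · a is at most q · a, because 1 ≤ q and k ≤ q.
    scale : ∀ k q a → U q → ℕ→ℚ k ℚ.≤ q → ℕ→ℚ ((2 + k) * a) ℚ.≤ q ℚ.* ℕ→ℚ (3 * a)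
    scale k q a Uq k≤q = subst₂ ℚ._≤_
      (sym (trans (ℕ→ℚ-+ a (a + k * a)) (cong (x ℚ.+_) (trans (ℕ→ℚ-+ a (k * a)) (cong (x ℚ.+_) (ℕ→ℚ-* k a))))))
      (sym (trans (cong (q ℚ.*_) (trans (cong (λ y → ℕ→ℚ (a + (a + y))) (+-identityʳ a)) (trans (ℕ→ℚ-+ a (a + a)) (cong (x ℚ.+_) (ℕ→ℚ-+ a a)))))
        (trans (ℚₚ.*-distribˡ-+ q x (x ℚ.+ x)) (cong (q ℚ.* x ℚ.+_) (ℚₚ.*-distribˡ-+ q x x)))))
      (ℚₚ.+-mono-≤ one≤ (ℚₚ.+-mono-≤ one≤ (ℚₚ.*-monoʳ-≤-nonNeg x {{ℚₚ.normalize-nonNeg a 1}} k≤q)))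
      where
      x = ℕ→ℚ a
      one≤ : x ℚ.≤ q ℚ.* x
      one≤ = subst (ℚ._≤ q ℚ.* x) (ℚₚ.*-identityˡ x)
        (ℚₚ.*-monoʳ-≤-nonNeg x {{ℚₚ.normalize-nonNeg a 1}} (subst (ℚ.1ℚ ℚ.≤_) (ℚₚ.*-identityʳ q) (1≤lam q Uq)))
    0≤U : ∀ q → U q → ℕ→ℚ 0 ℚ.≤ q
    0≤U q Uq = ℚₚ.≤-trans (ℚₚ.<⇒≤ (ℕ→ℚ-mono-< {0} {1} (s≤s z≤n))) (subst (ℚ.1ℚ ℚ.≤_) (ℚₚ.*-identityʳ q) (1≤lam q Uq))
    Roof : Set
    Roof = ∃[ b ] (1 ≤ b × U (ℕ→ℚ b) × (∀ a → b * a ≤ lam · (3 * a)))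
    -- Comparison with lam is not decidable. Asked about k and k + 1, `located` either yields k <
    -- lam, so that k + 2 exceeds lam by less than 2, or lets the upper bound come down by one.
    choose : ∀ k → U (ℕ→ℚ (2 + k)) → (U (ℕ→ℚ (suc k)) → Roof) → Roof
    choose k u lower with located (ℕ→ℚ-mono-< (n<1+n k))
    ... | inj₁ l  = 2 + k , s≤s z≤n , u , λ a q Uq → scale k q a Uq (ℚₚ.<⇒≤ (L<U l Uq))
    ... | inj₂ u′ = lower u′
    descend : ∀ k → U (ℕ→ℚ k) → Roof
    descend zero          u = contradiction (cancel {1} {0} u 1 1≤lam) λ ()
    -- An upper bound 1 would contradict 1 ≤ lam only by way of roundedness; offering 2 avoids that
    -- argument.
    descend (suc zero)    u = 2 , s≤s z≤n , U-up (ℕ→ℚ-mono-< {1} {2} ≤-refl) u , λ a q Uq → scale 0 q a Uq (0≤U q Uq)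
    descend (suc (suc k)) u = choose k u (descend (suc k))

-- Schedules of an instance

padded-toℕ : ∀ {n} (v : Vector ℕ n) j → padded v (toℕ j) ≡ v j
padded-toℕ v zero    = refl
padded-toℕ v (suc j) = padded-toℕ (λ i → v (suc i)) j

padded-≥ : ∀ {n} (v : Vector ℕ n) {j} → n ≤ j → padded v j ≡ 0
padded-≥ {zero}  v le = refl
padded-≥ {suc n} v (s≤s le) = padded-≥ (λ i → v (suc i)) le

∣-∣≡∸+∸ : ∀ a b → ∣ a - b ∣ ≡ (a ∸ b) + (b ∸ a)
∣-∣≡∸+∸ zero    zero    = refl
∣-∣≡∸+∸ zero    (suc b) = refl
∣-∣≡∸+∸ (suc a) zero    = sym (+-identityʳ _)
∣-∣≡∸+∸ (suc a) (suc b) = ∣-∣≡∸+∸ a b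

foldr-⊔-ub : ∀ {n} (v : Vector ℕ n) j → v j ≤ foldr _⊔_ 0 v
foldr-⊔-ub v zero    = m≤m⊔n _ _
foldr-⊔-ub v (suc j) = ≤-trans (foldr-⊔-ub (λ i → v (suc i)) j) (m≤n⊔m (v zero) _)

foldr-⊔-lub : ∀ {n} (v : Vector ℕ n) B → (∀ j → v j ≤ B) → foldr _⊔_ 0 v ≤ B
foldr-⊔-lub {zero}  v B h = z≤n
foldr-⊔-lub {suc n} v B h = ⊔-lub (h zero) (foldr-⊔-lub (λ i → v (suc i)) B λ j → h (suc j))

module Jobs (I : Instance) where

  open Instance I public
  t d p : ℕ → ℕ
  t = padded release
  d = padded deadline
  p = padded ptime

  to-job : ∀ {P : ℕ → Set} → (∀ j → P (toℕ {n} j)) → ∀ j → j < n → P j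
  to-job {P} h j lt = subst P (toℕ-fromℕ< lt) (h (fromℕ< lt))

  feasible : Schedulable I → ∃[ s ] ∃[ μ ] Feasible n m t d p s μ
  feasible (S , F) = s , μ , record
    { on = to-job λ j → subst (_< m) (sym (μ≡ j)) (toℕ<n (machine j))
    ; from = to-job λ j → subst₂ _≤_ (sym (padded-toℕ release j)) (sym (s≡ j)) (afterRelease j)
    ; until = to-job λ j → subst₂ _≤_ (sym (cong₂ _+_ (s≡ j) (p≡ j))) (sym (padded-toℕ deadline j)) (beforeDeadline j)
    ; alone = λ i j τ i<n j<n → to-job {λ i → μ i ≡ μ j → s i ≤ τ → τ < s i + p i → s j ≤ τ → τ < s j + p j → i ≡ j}
        (λ i → to-job {λ j → μ (toℕ i) ≡ μ j → s (toℕ i) ≤ τ → τ < s (toℕ i) + p (toℕ i) → s j ≤ τ → τ < s j + p j → toℕ i ≡ j}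
          (λ j e a b a′ b′ → cong toℕ (oneJobPerMachine i j τ (toℕ-injective (trans (sym (μ≡ i)) (trans e (μ≡ j))))
            (subst (_≤ τ) (s≡ i) a , subst (τ <_) (cong₂ _+_ (s≡ i) (p≡ i)) b)
            (subst (_≤ τ) (s≡ j) a′ , subst (τ <_) (cong₂ _+_ (s≡ j) (p≡ j)) b′))) j j<n) i i<n
    }
    where
    open Schedule S
    open IsFeasible F
    s μ : ℕ → ℕ
    s = padded start
    μ = padded (λ j → toℕ (machine j))
    s≡ : ∀ j → s (toℕ j) ≡ start j
    s≡ = padded-toℕ start
    μ≡ : ∀ j → μ (toℕ j) ≡ toℕ (machine j)
    μ≡ = padded-toℕ (λ j → toℕ (machine j))
    p≡ : ∀ j → p (toℕ j) ≡ ptime j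
    p≡ = padded-toℕ ptime

  schedulable : ∀ s μ → Feasible n m t d p s μ → Schedulable I
  schedulable s μ F = record { start = λ j → s (toℕ j) ; machine = λ j → fromℕ< (on (toℕ j) (toℕ<n j)) } , record
    { oneJobPerMachine = λ i j τ e (a , b) (a′ , b′) → toℕ-injective (alone (toℕ i) (toℕ j) τ (toℕ<n i) (toℕ<n j)
        (trans (sym (toℕ-fromℕ< _)) (trans (cong toℕ e) (toℕ-fromℕ< _)))
        a (subst (λ x → τ < s (toℕ i) + x) (sym (padded-toℕ ptime i)) b)
        a′ (subst (λ x → τ < s (toℕ j) + x) (sym (padded-toℕ ptime j)) b′))
    ; afterRelease = λ j → subst (_≤ s (toℕ j)) (padded-toℕ release j) (from (toℕ j) (toℕ<n j))
    ; beforeDeadline = λ j → subst₂ (λ x y → s (toℕ j) + x ≤ y) (padded-toℕ ptime j) (padded-toℕ deadline j) (until (toℕ j) (toℕ<n j))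
    }
    where open Feasible F

  width : ∀ j → (d (toℕ {n} j) ∸ t (toℕ j)) + (t (toℕ j) ∸ d (toℕ j)) ≡ ∣ deadline j - release j ∣
  width j = trans (cong₂ (λ x y → (x ∸ y) + (y ∸ x)) (padded-toℕ deadline j) (padded-toℕ release j)) (sym (∣-∣≡∸+∸ (deadline j) (release j)))

-- The size of the state space

module Bound (m ℓ L : ℕ) (2≤ℓ : 2 ≤ ℓ) (1≤m : 1 ≤ m) (1≤L : 1 ≤ L) where

  private instance
    ℓ≢0 : NonZero ℓ
    ℓ≢0 = >-nonZero (≤-trans (1 ≤! 2) 2≤ℓ)

  -- The exponent comes from (ℓ + 1)^m ≤ ℓ^(2m) and 2^A ≤ ℓ^(8mL), as 2m + 8mL ≤ 10mL. Capacity and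
  -- marking are measured against the same power.
  Z : ℕ
  Z = ℓ ^ (10 * (m * L))

  m≤mL : m ≤ m * L
  m≤mL = ≤-trans (≤-reflexive (sym (*-identityʳ m))) (*-monoʳ-≤ m 1≤L)

  1≤mL : 1 ≤ m * L
  1≤mL = ≤-trans 1≤m m≤mL

  64≤Z : 64 ≤ Z
  64≤Z = ≤-trans (64 ≤! 1024) (≤-trans (^-monoʳ-≤ 2 (*-monoʳ-≤ 10 1≤mL)) (^-monoˡ-≤ (10 * (m * L)) 2≤ℓ))

  ℓ≤Z : ℓ ≤ Z
  ℓ≤Z = ≤-trans (≤-reflexive (sym (*-identityʳ ℓ))) (^-monoʳ-≤ ℓ {1} (≤-trans 1≤mL (m≤n*m (m * L) 10)))

  m≤Z : m ≤ Z
  m≤Z = ≤-trans (<⇒≤ (n<2^n m)) (≤-trans (^-monoˡ-≤ m 2≤ℓ) (^-monoʳ-≤ ℓ (≤-trans m≤mL (m≤n*m (m * L) 10))))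

module Size (A m ℓ L S : ℕ) (2≤ℓ : 2 ≤ ℓ) (1≤m : 1 ≤ m) (1≤L : 1 ≤ L) (A≡ : A ≡ S * (m * (4 * L)))
            (ℓ<2^S : ℓ < 2 ^ S) (2^S≤2ℓ : 2 ^ S ≤ 2 * ℓ) where

  open Radix A m ℓ
  open Bound m ℓ L 2≤ℓ 1≤m 1≤L

  private instance
    ℓ≢0 : NonZero ℓ
    ℓ≢0 = >-nonZero (≤-trans (1 ≤! 2) 2≤ℓ)

  wt-bits : ∀ i → i ≤ A → wt i ≡ 2 ^ i
  wt-bits zero    _  = refl
  wt-bits (suc i) le = cong₂ _*_ (rad-bit le) (wt-bits i (<⇒≤ le))

  wt-machines : ∀ k → wt (A + k) ≡ suc ℓ ^ k * 2 ^ A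
  wt-machines zero    = trans (cong wt (+-identityʳ A)) (trans (wt-bits A ≤-refl) (sym (*-identityˡ (2 ^ A))))
  wt-machines (suc k) = trans (cong wt (+-suc A k)) (trans (cong₂ _*_ (rad-machine (m≤m+n A k)) (wt-machines k)) (sym (*-assoc (suc ℓ) (suc ℓ ^ k) (2 ^ A))))

  2≤S : 2 ≤ S
  2≤S = ≰⇒> λ le → <⇒≱ ℓ<2^S (≤-trans (^-monoʳ-≤ 2 le) 2≤ℓ)

  8≤A : 8 ≤ A
  8≤A = ≤-trans (*-mono-≤ 2≤S (*-mono-≤ 1≤m (*-monoʳ-≤ 4 1≤L))) (≤-reflexive (sym A≡))

  1≤A : 1 ≤ A
  1≤A = ≤-trans (1 ≤! 8) 8≤A

  2^A≤N : 2 ^ A ≤ wt K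
  2^A≤N = ≤-trans (m≤n*m (2 ^ A) (suc ℓ ^ m) {{m^n≢0 (suc ℓ) m}}) (≤-reflexive (sym (wt-machines m)))

  64≤N : 64 ≤ wt K
  64≤N = ≤-trans (≤-trans (64 ≤! 256) (^-monoʳ-≤ 2 8≤A)) 2^A≤N

  ℓ≤N : ℓ ≤ wt K
  ℓ≤N = ≤-trans (≤-trans (n≤1+n ℓ) (≤-trans (≤-reflexive (sym (*-identityʳ (suc ℓ)))) (^-monoʳ-≤ (suc ℓ) 1≤m)))
          (≤-trans (m≤m*n (suc ℓ ^ m) (2 ^ A) {{m^n≢0 2 A}}) (≤-reflexive (sym (wt-machines m))))

  K≤N : K ≤ wt K
  K≤N = ≤-trans (product (n<2^n A) (≤-trans (n<2^n m) (^-monoˡ-≤ m (≤-trans 2≤ℓ (n≤1+n ℓ))))) (≤-reflexive (trans (*-comm (2 ^ A) _) (sym (wt-machines m))))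
    where
    product : ∀ {a b x y} → a < x → b < y → a + b ≤ x * y
    product {a} {b} {suc x} {suc y} (s≤s l) (s≤s r) = ≤-trans (+-mono-≤ l r) (lin (1 + x * y) (z≤n {0}) (solve (x ∷ y ∷ [])))

  2ℓ≤ℓ² : 2 * ℓ ≤ ℓ ^ 2
  2ℓ≤ℓ² = ≤-trans (*-monoˡ-≤ ℓ 2≤ℓ) (≤-reflexive (cong (ℓ *_) (sym (*-identityʳ ℓ))))

  sucℓ≤ℓ² : suc ℓ ≤ ℓ ^ 2
  sucℓ≤ℓ² = ≤-trans (+-monoˡ-≤ ℓ (≤-trans (1 ≤! 2) 2≤ℓ)) (≤-trans (≤-reflexive (cong (ℓ +_) (sym (+-identityʳ ℓ)))) 2ℓ≤ℓ²)

  N≤Z : wt K ≤ Z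
  N≤Z = begin
    wt K                                    ≡⟨ wt-machines m ⟩
    suc ℓ ^ m * 2 ^ A                       ≡⟨ cong (λ x → suc ℓ ^ m * 2 ^ x) A≡ ⟩
    suc ℓ ^ m * 2 ^ (S * (m * (4 * L)))     ≡⟨ cong (suc ℓ ^ m *_) (^-*-assoc 2 S (m * (4 * L))) ⟨
    suc ℓ ^ m * (2 ^ S) ^ (m * (4 * L))     ≤⟨ *-mono-≤ (^-monoˡ-≤ m sucℓ≤ℓ²) (^-monoˡ-≤ (m * (4 * L)) (≤-trans 2^S≤2ℓ 2ℓ≤ℓ²)) ⟩
    (ℓ ^ 2) ^ m * (ℓ ^ 2) ^ (m * (4 * L))   ≡⟨ ^-distribˡ-+-* (ℓ ^ 2) m (m * (4 * L)) ⟨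
    (ℓ ^ 2) ^ (m + m * (4 * L))             ≡⟨ ^-*-assoc ℓ 2 (m + m * (4 * L)) ⟩
    ℓ ^ (2 * (m + m * (4 * L)))             ≤⟨ ^-monoʳ-≤ ℓ exponent ⟩
    Z                                       ∎
    where
    open ≤-Reasoning
    exponent : 2 * (m + m * (4 * L)) ≤ 10 * (m * L)
    exponent = lin 0 (+-mono-≤ m≤mL m≤mL) (solve (m ∷ L ∷ []))

  room : Room
  room = record { 1≤ℓ = ≤-trans (1 ≤! 2) 2≤ℓ ; 64≤N = 64≤N ; K≤N = K≤N ; ℓ≤N = ℓ≤N }

-- Correctness

module Correctness (I : Instance) (L : ℕ) (1≤L : 1 ≤ L)
                   (loose : ∀ j → ∣ Instance.deadline I j - Instance.release I j ∣ ≤ L * Instance.ptime I j) where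

  open Jobs I
  open Windows t d p
  open Scanning t d p n m

  Answer : Set
  Answer = ∃[ s ] ∃[ μ ] Feasible n m t d p s μ

  u≤ℓ : ∀ j → j < n → u j ≤ ℓ
  u≤ℓ = to-job λ j → subst (_≤ ℓ) (sym (width j)) (foldr-⊔-ub (λ j → ∣ deadline j - release j ∣) j)

  ℓ≤ : ∀ B → (∀ j → j < n → u j ≤ B) → ℓ ≤ B
  ℓ≤ B h = foldr-⊔-lub (λ j → ∣ deadline j - release j ∣) B λ j → subst (_≤ B) (width j) (h (toℕ j) (toℕ<n j))

  w-beyond : ∀ j → n ≤ j → w j ≡ 0
  w-beyond j le = cong₂ _∸_ (padded-≥ deadline le) (padded-≥ release le)

  w≤u : ∀ j → w j ≤ u j
  w≤u j = m≤m+n (w j) _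

  w≤ℓ : ∀ j → w j ≤ ℓ
  w≤ℓ j with j <? n
  ... | yes lt = ≤-trans (w≤u j) (u≤ℓ j lt)
  ... | no ge  = ≤-trans (≤-reflexive (w-beyond j (≮⇒≥ ge))) z≤n

  w≤Lp : ∀ j → w j ≤ L * p j
  w≤Lp j with j <? n
  ... | yes lt = ≤-trans (w≤u j) (to-job {λ j → u j ≤ L * p j}
                   (λ j → subst₂ _≤_ (sym (width j)) (cong (L *_) (sym (padded-toℕ ptime j))) (loose j)) j lt)
  ... | no ge  = ≤-trans (≤-reflexive (w-beyond j (≮⇒≥ ge))) z≤n

  p>0 : ∀ j → 0 < w j → 0 < p j
  p>0 j z = n≢0⇒n>0 λ e → <⇒≱ z (≤-trans (w≤Lp j) (≤-reflexive (trans (cong (L *_) e) (*-zeroʳ L))))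

  w>0⇒<n : ∀ j → 0 < w j → j < n
  w>0⇒<n j z = ≰⇒> λ le → <⇒≢ z (sym (w-beyond j le))

  2≤ℓ⇒1≤n : 2 ≤ ℓ → 1 ≤ n
  2≤ℓ⇒1≤n le = ≰⇒> λ n≤0 → contradiction (≤-trans le (ℓ≤ 0 λ j lt → contradiction (≤-trans lt n≤0) λ ())) λ ()

  answer-runs : ∀ a s {Q : State → Set} → Q (s [ 0 , 0 ↦ a ]) → Runs (answer a) s 3 Q
  answer-runs a s q = assign q

  reads-input : Reads n m (input I)
  reads-input = mkReads refl refl (λ _ → refl) (λ _ → refl) (λ _ → refl)

  module _ (within : ∀ j → j < n → t j + p j ≤ d j) (1≤m : 1 ≤ m)
           (s₁ : State) (f₁ : Same scan (input I) s₁) (hℓ : s₁ ℓₐ 0 ≡ ℓ) where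

    t≤d : ∀ j → j < n → t j ≤ d j
    t≤d j lt = ≤-trans (m≤m+n (t j) (p j)) (within j lt)

    p≤w : ∀ j → p j ≤ w j
    p≤w j with j <? n
    ... | yes lt = m+n≤o⇒m≤o∸n (p j) (≤-trans (≤-reflexive (+-comm (p j) (t j))) (within j lt))
    ... | no ge  = ≤-trans (≤-reflexive (padded-≥ ptime (≮⇒≥ ge))) z≤n

    reads₁ : Reads n m s₁
    reads₁ = reads-frame {scan} refl refl refl refl refl f₁ reads-input

    -- Windows have at most one slot, so every job starts at its release; its rank among the jobs of
    -- that slot is below m and serves as its machine.
    unit-feasible : ℓ ≤ 1 → (∀ X → rk X n ≤ m) → Answer
    unit-feasible ℓ≤1 rk≤m = t , machine , record
      { on = λ j _ → on j ; from = λ _ _ → ≤-refl ; until = within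
      ; alone = λ i j τ _ _ e a b a′ b′ → case (window i τ a b , window j τ a′ b′) of λ where
          ((z , q) , (z′ , q′)) → rk-inj (suc τ) i j (subst (λ x → Act i (suc x)) q (here i z)) (subst (λ x → Act j (suc x)) q′ (here j z′))
            (trans (cong (λ x → rk (suc x) i) (sym q)) (trans (sym (machine≡ i z)) (trans e (trans (machine≡ j z′) (cong (λ x → rk (suc x) j) q′)))))
      }
      where
      machine : ℕ → ℕ
      machine j with 0 <? w j
      ... | yes _ = rk (suc (t j)) j
      ... | no _  = 0
      here : ∀ j → 0 < w j → Act j (suc (t j))
      here j z = subst (λ x → Act j (suc x)) (+-identityʳ (t j)) (act-at j 0 z)
      machine≡ : ∀ j → 0 < w j → machine j ≡ rk (suc (t j)) j
      machine≡ j z with 0 <? w j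
      ... | yes _ = refl
      ... | no nz = contradiction z nz
      on : ∀ j → machine j < m
      on j with 0 <? w j
      ... | yes z = ≤-trans (rk-< _ (w>0⇒<n j z) (here j z)) (rk≤m _)
      ... | no _  = 1≤m
      window : ∀ j τ → t j ≤ τ → τ < t j + p j → 0 < w j × t j ≡ τ
      window j τ a b = ≤-trans (+-cancelˡ-< (t j) 0 _ (≤-trans (s≤s (≤-trans (≤-reflexive (+-identityʳ (t j))) a)) b)) (p≤w j) ,
        ≤-antisym a (≤-pred (≤-trans b (≤-trans (+-monoʳ-≤ (t j) (≤-trans (p≤w j) (≤-trans (w≤ℓ j) ℓ≤1))) (≤-reflexive (+-comm (t j) 1)))))

    -- The cap `Aₐ` is m itself and marking decides alone. No loop runs over m, which need not be
    -- bounded in terms of n.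
    light-runs : ∀ b → ℓ ≤ 1 → Runs (schedule b) s₁ (9 + (20 + n * 88 + 11)) (Decided Answer)
    light-runs b ℓ≤1 = if-runs {t = 4} {Q = λ s → s Aₐ 0 ≡ m}
        (λ nz → contradiction no-excess nz)
        (λ _ → assign (Reads.read-m reads₁))
      ▹ λ s₂ f₂ hA → weaken (+-monoˡ-≤ 11 (+-monoʳ-≤ 20 (*-monoʳ-≤ n (+-monoʳ-≤ 40 (*-monoˡ-≤ 48 ℓ≤1)))))
      (M.mark-runs s₂ (reads-frame {IF var ℓₐ ⊖ lit 1 THEN capacity b ELSE Aₐ ≔ var mₐ} refl refl refl refl refl f₂ reads₁) hA
        ((λ X → trans (f₂ markₐ refl X) (f₁ markₐ refl X)) , (λ _ X → ≤-trans (≤-reflexive (trans (f₂ markₐ refl X) (f₁ markₐ refl X))) z≤n) ,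
         λ nz → contradiction (trans (f₂ fullₐ refl 0) (f₁ fullₐ refl 0)) nz)
      ▹ λ s₃ f₃ (cnt , ok , over) → if-runs {t = 8}
        (λ nz → weaken (3 ≤! 8) (answer-runs 0 s₃ (inj₂ ((λ { (_ , _ , F) → case over nz of λ { (X , lt) →
          <⇒≱ (subst (m <_) (cnt X) lt) (Volume.unit-rank F p>0 (λ j → ≤-trans (w≤ℓ j) ℓ≤1) X) } }) , refl))))
        (λ z → if-runs {t = 3}
          (λ nz → contradiction (trans (cong (_∸ 1) (trans (f₃ ℓₐ refl 0) (f₂ ℓₐ refl 0))) no-excess) nz)
          (λ _ → answer-runs 1 s₃ (inj₁ (unit-feasible ℓ≤1 (λ X → subst (_≤ m) (cnt X) (ok z X)) , refl)))))
      where
      module M = Marking n m m ℓ w≤ℓ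
      no-excess : s₁ ℓₐ 0 ∸ 1 ≡ 0
      no-excess = trans (cong (_∸ 1) hℓ) (m≤n⇒m∸n≡0 ℓ≤1)

    module _ (2≤ℓ : 2 ≤ ℓ) where

      open Bound m ℓ L 2≤ℓ 1≤m 1≤L
      open Powers Z 64≤Z
      open PerJob n (2≤ℓ⇒1≤n 2≤ℓ)

      excess : ∀ {k} → k ≡ ℓ → k ∸ 1 ≢ 0
      excess e z = <⇒≱ 2≤ℓ (m∸n≡0⇒m≤n (trans (cong (_∸ 1) (sym e)) z))

      capacity-time : 20 + m * (20 + 6) + (23 + (ℓ + 1) * (20 + 30)) ≤n^ 6
      capacity-time = once 6 (plus 5 (plus 4 (const 20 3) (raise 2 4 (times 1 1 (one m≤Z) (const 26 0))))
        (plus 4 (const 23 3) (raise 3 4 (times 2 1 (plus 1 (one ℓ≤Z) (const 1 0)) (const 50 0)))))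

      mark-time : 20 + n * (20 + (20 + ℓ * (20 + 28))) ≤n^ 6
      mark-time = plusₙ 5 (once 5 (const 20 4)) (per-job 5 (plus 4 (const 20 3) (plus 3 (const 20 2) (raise 2 3 (times 1 1 (one ℓ≤Z) (const 48 0))))))

      heavy-runs : Runs (schedule (4 * L)) s₁ (n * Z ^ 38) (Decided Answer)
      heavy-runs = weaken (plusₙ 37 (plusₙ 36 (once 36 (const 5 35)) (raiseₙ 6 36 capacity-time))
                            (plusₙ 36 (raiseₙ 6 36 mark-time) (plusₙ 35 (once 35 (const 8 34)) ≤-refl)))
        (if-runs {Q = λ s → ∃[ S ] (s Aₐ 0 ≡ S * (m * (4 * L)) × ℓ < 2 ^ S × 2 ^ S ≤ 2 * ℓ)}
          (λ _ → capacity-runs (4 * L) m ℓ s₁ (≤-trans (1 ≤! 2) 2≤ℓ) (Reads.read-m reads₁) hℓ (f₁ stepₐ refl 0) (f₁ Aₐ refl 0))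
          (λ z → contradiction z (excess hℓ))
        ▹ after-capacity)
        where
        setup : Program
        setup = IF var ℓₐ ⊖ lit 1 THEN capacity (4 * L) ELSE Aₐ ≔ var mₐ
        after-capacity : ∀ s₂ → Same setup s₁ s₂ → ∃[ S ] (s₂ Aₐ 0 ≡ S * (m * (4 * L)) × ℓ < 2 ^ S × 2 ^ S ≤ 2 * ℓ) →
          Runs (mark ⨾ IF var fullₐ THEN answer 0 ELSE IF var ℓₐ ⊖ lit 1 THEN dynamicProgram ELSE answer 1) s₂
               (20 + n * (20 + (20 + ℓ * (20 + 28))) + (8 + n * Z ^ 35)) (Decided Answer)
        after-capacity s₂ f₂ (S , A≡ , ℓ<2^S , 2^S≤2ℓ) =
          M.mark-runs s₂ reads₂ refl
            ((λ X → clean markₐ refl refl X) , (λ _ X → ≤-trans (≤-reflexive (clean markₐ refl refl X)) z≤n) ,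
             λ nz → contradiction (clean fullₐ refl refl 0) nz)
          ▹ λ s₃ f₃ (cnt , ok , over) → if-runs {t = 5 + n * Z ^ 35}
            (λ nz → weaken (≤-trans (3 ≤! 5) (m≤m+n 5 _)) (answer-runs 0 s₃ (inj₂ ((λ { (_ , _ , F) → case over nz of λ { (X , lt) →
              <⇒≱ (subst₂ _<_ A≡ (cnt X) lt) (Volume.active-rank F L w≤Lp S (λ j → ≤-<-trans (≤-trans (p≤w j) (w≤ℓ j)) ℓ<2^S) X) } }) , refl))))
            (λ z → if-runs {t = n * Z ^ 35}
              (λ _ → weaken (*-monoʳ-≤ n (^-monoˡ-≤ 35 Sz.N≤Z)) (Solving.dynamic-runs t d p n m A ℓ (2≤ℓ⇒1≤n 2≤ℓ) Sz.1≤A 1≤m w≤ℓ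
                (λ X → subst (_≤ A) (cnt X) (ok z X)) w>0⇒<n p≤w p>0 t≤d Sz.room
                s₃ (reads-frame {mark} refl refl refl refl refl f₃ reads₂) (f₃ Aₐ refl 0) (trans (f₃ ℓₐ refl 0) (trans (f₂ ℓₐ refl 0) hℓ)) cnt
                (λ X → trans (f₃ posₐ refl X) (clean posₐ refl refl X)) (trans (f₃ xₐ refl 0) (clean xₐ refl refl 0))
                (trans (f₃ rowsₐ refl 0) (clean rowsₐ refl refl 0)) (trans (f₃ nextₐ refl 0) (clean nextₐ refl refl 0))
                (λ X → trans (f₃ cntₐ refl X) (clean cntₐ refl refl X)) (λ X → trans (f₃ fitₐ refl X) (clean fitₐ refl refl X))
                (λ X → trans (f₃ nxtₐ refl X) (clean nxtₐ refl refl X)) (trans (f₃ curₐ refl 0) (clean curₐ refl refl 0))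
                (λ X → trans (f₃ reachₐ refl X) (clean reachₐ refl refl X))))
              (λ q → contradiction q (excess (trans (f₃ ℓₐ refl 0) (trans (f₂ ℓₐ refl 0) hℓ)))))
          where
          A : ℕ
          A = s₂ Aₐ 0
          module Sz = Size A m ℓ L S 2≤ℓ 1≤m 1≤L A≡ ℓ<2^S 2^S≤2ℓ
          module M = Marking n m A ℓ w≤ℓ
          reads₂ : Reads n m s₂
          reads₂ = reads-frame {setup} refl refl refl refl refl f₂ reads₁
          clean : ∀ a → writes scan a ≡ false → writes setup a ≡ false → ∀ k → s₂ a k ≡ input I a k
          clean = same-trans {scan} {setup} f₁ f₂

  -- The number 380 is 10 · 38: the heavy case takes time n · Z^38, and Z is ℓ to the power 10mL.
  schedule-runs : (∀ j → j < n → t j + p j ≤ d j) → 1 ≤ m → ∀ s₁ → Same scan (input I) s₁ → s₁ ℓₐ 0 ≡ ℓ →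
                  Runs (schedule (4 * L)) s₁ (41 + ℓ ^ (L * (380 * m)) * n + n * 88) (Decided Answer)
  schedule-runs within 1≤m s₁ f₁ hℓ with ℓ ≤? 1
  ... | yes le = weaken (lin (1 + ℓ ^ (L * (380 * m)) * n) (z≤n {0}) (light-cost (ℓ ^ (L * (380 * m)) * n) n)) (light-runs within 1≤m s₁ f₁ hℓ (4 * L) le)
    where
    light-cost : ∀ x n → 9 + (20 + n * 88 + 11) + 0 + (1 + x) ≡ 41 + x + n * 88 + 0
    light-cost x n = solve (x ∷ n ∷ [])
  ... | no gt = weaken (≤-trans (≤-reflexive (trans (*-comm n _) (cong (_* n) (trans (^-*-assoc ℓ (10 * (m * L)) 38) (cong (ℓ ^_) (exponent 10 38 m L))))))
                  (≤-trans (m≤n+m _ 41) (m≤m+n _ (n * 88)))) (heavy-runs within 1≤m s₁ f₁ hℓ (≰⇒> gt))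
    where
    exponent : ∀ a b m L → a * (m * L) * b ≡ L * (a * b * m)
    exponent a b m L = solve (a ∷ b ∷ m ∷ L ∷ [])

  solver-runs : Runs (solver (4 * L)) (input I) (20 + n * 80 + (6 + (41 + ℓ ^ (L * (380 * m)) * n + n * 88))) (Decided Answer)
  solver-runs = scan-runs (input I) reads-input refl refl
    ▹ λ s₁ f₁ (ub , lub , ok , bad) → let
        hℓ : s₁ ℓₐ 0 ≡ ℓ
        hℓ = ≤-antisym (lub ℓ u≤ℓ) (ℓ≤ _ ub)
        x = ℓ ^ (L * (380 * m)) * n
      in if-runs {t = 3 + (41 + x + n * 88)}
      (λ nz → weaken (≤-trans (3 ≤! 44) (≤-trans (m≤m+n 44 x) (m≤m+n (44 + x) (n * 88)))) (answer-runs 0 s₁ (inj₂ ((λ { (s , _ , F) → case bad nz of λ { (j , lt , d<) →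
        <⇒≱ d< (≤-trans (+-monoˡ-≤ (p j) (Feasible.from F j lt)) (Feasible.until F j lt)) } }) , refl))))
      (λ z → if-runs {t = 41 + x + n * 88}
        (λ nz → schedule-runs (ok z) (n≢0⇒n>0 λ e → nz (trans (f₁ mₐ refl 0) e)) s₁ f₁ hℓ)
        (λ m≡0 → weaken (≤-trans (6 ≤! 41) (≤-trans (m≤m+n 41 x) (m≤m+n (41 + x) (n * 88)))) (if-runs {t = 3}
          (λ nz → answer-runs 0 s₁ (inj₂ ((λ { (_ , _ , F) →
            contradiction (≤-trans (Feasible.on F 0 (n≢0⇒n>0 λ e → nz (trans (f₁ nₐ refl 0) e))) (≤-reflexive (trans (sym (f₁ mₐ refl 0)) m≡0))) λ () }) , refl)))
          (λ n≡0 → let none : ∀ {j} → j < n → ⊥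
                       none lt = contradiction (≤-trans lt (≤-reflexive (trans (sym (f₁ nₐ refl 0)) n≡0))) λ ()
            in answer-runs 1 s₁ (inj₁ ((t , t , record
              { on = λ _ lt → ⊥-elim (none lt) ; from = λ _ lt → ⊥-elim (none lt) ; until = λ _ lt → ⊥-elim (none lt)
              ; alone = λ _ _ _ lt → ⊥-elim (none lt) }) , refl))))))

  decides : DecidesWithin (solver (4 * L)) I (ℓ ^ (L * (380 * m)) * n + (100 + n * 200))
  decides = final , steps , exec , ≤-trans within (total (ℓ ^ (L * (380 * m)) * n) n) , (case post of λ where
      (inj₁ ((σ , μ , F) , r)) → inj₁ (schedulable σ μ F , r)
      (inj₂ (no-plan , r))     → inj₂ ((λ S → no-plan (feasible S)) , r))
    where
    open Runs solver-runs
    total : ∀ x n → 20 + n * 80 + (6 + (41 + x + n * 88)) ≤ x + (100 + n * 200)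
    total x n = lin (33 + n * 32) (z≤n {0}) (solve (x ∷ n ∷ []))

-- As nothing is sorted, the additive term is linear. From n = 2 on the logarithm is at least 1, and
-- 100 + 200n ≤ 300n.
linear∈O : (λ n → 100 + n * 200) ∈O[ (λ n → n * ⌊log₂ n ⌋) ]
linear∈O = 300 , 2 , λ n 2≤n → ≤-trans (slope n (≤-trans (1 ≤! 2) 2≤n))
  (*-monoʳ-≤ 300 (≤-trans (≤-reflexive (sym (*-identityʳ n))) (*-monoʳ-≤ n (⌊log₂⌋-mono-≤ 2≤n))))
  where
  slope : ∀ n → 1 ≤ n → 100 + n * 200 ≤ 300 * n
  slope n 1≤n = lin {A = 100 * 1} {B = 100 * n} 0 (*-monoʳ-≤ 100 1≤n) (solve (n ∷ []))

theorem4p1 :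
    Σ[ c ∈ ℕ ] Σ[ g ∈ (ℕ → ℕ) ] (g ∈O[ (λ n → n * ⌊log₂ n ⌋) ] ×
      ((lam : ℝ) → 1 ≤ lam · 1 →
        Σ[ P ∈ Program ] Σ[ f ∈ (ℕ → ℕ) ] ((∀ m → f m ≤ lam · (c * m)) ×
          ((I : Instance) → HasLooseness lam I →
            DecidesWithin P I
              (Instance.ℓ I ^ f (Instance.m I) * Instance.n I + g (Instance.n I))))))
-- 1140 = 3 · 380, the factor 3 being the price of replacing lam by the natural number L.
theorem4p1 = 1140 , _ , linear∈O , λ lam 1≤lam → let
    open Rounding lam 1≤lam
    (L , 1≤L , UL , below) = roof
  in solver (4 * L) , (λ m → L * (380 * m)) ,
     (λ m → subst (L * (380 * m) ≤ lam ·_) (sym (*-assoc 3 380 m)) (below (380 * m))) ,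
     λ I loose → Correctness.decides I L 1≤L λ j → cancel {b = L} UL (Instance.ptime I j) (loose j)
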